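{- Let $d\ge 0$ be an integer, let $b_0=0<b_1<\dots<b_d$ be real numbers, and let $p_0(x),p_1(x),\dots,p_d(x)\in\mathbf{R}[x]$ be polynomials with real coefficients, not all of them zero. Then the function $$F(x)=\sum_{i=0}^d p_i(x)\log(x+b_i),$$ defined for $x>0$, has only finitely many positive real zeros. In particular, the sequence $(\log n)_{n\ge 1}$ is not holonomic.
   Context: A sequence of complex numbers $(a_n)_{n\ge 1}$ is called holonomic (P-recursive, D-finite) if there exist an integer $d\ge 0$ and polynomials $p_0(x),\dots,p_d(x)\in\mathbf{C}[x]$, not all zero, such that $p_d(n)a_{n+d}+\cdots+p_1(n)a_{n+1}+p_0(n)a_n=0$ for every integer $n\ge 1$. Here $\log$ denotes the natural logarithm. -}

module Defs where

open import Algebra.Bundles.Raw using (RawRing)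
import Algebra.Definitions.RawSemiring as RawSemiringDefs
open import Axiom.ExcludedMiddle using (ExcludedMiddle)
open import Data.Fin.Base using (Fin; toℕ)
open import Data.Integer.Base using (+_)
open import Data.List.Base using (List; foldr)
open import Data.List.Relation.Unary.All using (All)
open import Data.List.Relation.Unary.Any using (Any)
open import Data.Nat.Base as ℕ using (ℕ; suc; _!; _⊔_)
import Data.Nat.Properties as ℕ
open import Data.Product.Base using (∃; ∃-syntax; _×_; _,_)
open import Data.Rational.Base as ℚ using (ℚ; 0ℚ; 1ℚ; ½; Positive)
import Data.Rational.Properties as ℚ
open import Data.Rational.Solver using (module +-*-Solver)
open import Level using (0ℓ)
open import Relation.Binary.PropositionalEquality
  using (_≡_; refl; sym; trans; cong; cong₂; subst)
open import Relation.Nullary.Decidable.Core using (Dec; yes; no)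
open import Relation.Nullary.Negation.Core using (¬_)

-- Real numbers: Cauchy sequences of rationals, with the setoid equality
-- "the difference tends to 0".

IsCauchy : (ℕ → ℚ) → Set
IsCauchy s = ∀ ε → 0ℚ ℚ.< ε →
  ∃[ N ] ∀ m n → N ℕ.≤ m → N ℕ.≤ n → ℚ.∣ s m ℚ.- s n ∣ ℚ.< ε

record ℝ : Set where
  constructor mkℝ
  field
    seq    : ℕ → ℚ
    cauchy : IsCauchy seq

open ℝ public

abstract
  0<half : ∀ {ε} → 0ℚ ℚ.< ε → 0ℚ ℚ.< ½ ℚ.* ε
  0<half {ε} 0<ε =
    ℚ.positive⁻¹ (½ ℚ.* ε) {{ℚ.pos*pos⇒pos ½ ε {{ℚ.positive 0<ε}}}}

  half+half : ∀ ε → ½ ℚ.* ε ℚ.+ ½ ℚ.* ε ≡ ε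
  half+half ε =
    trans (sym (ℚ.*-distribʳ-+ ε ½ ½)) (ℚ.*-identityˡ ε)

  ⊔≤ˡ : ∀ {m n k} → m ⊔ n ℕ.≤ k → m ℕ.≤ k
  ⊔≤ˡ {m} {n} = ℕ.≤-trans (ℕ.m≤m⊔n m n)

  ⊔≤ʳ : ∀ {m n k} → m ⊔ n ℕ.≤ k → n ℕ.≤ k
  ⊔≤ʳ {m} {n} = ℕ.≤-trans (ℕ.m≤n⊔m m n)

  const-cauchy : ∀ q → IsCauchy (λ _ → q)
  const-cauchy q ε 0<ε =
    0 , λ _ _ _ _ → subst (λ t → ℚ.∣ t ∣ ℚ.< ε) (sym (ℚ.+-inverseʳ q)) 0<ε

  +-cauchy : ∀ s t → IsCauchy s → IsCauchy t →
             IsCauchy (λ n → s n ℚ.+ t n)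
  +-cauchy s t cs ct ε 0<ε
    with cs (½ ℚ.* ε) (0<half 0<ε) | ct (½ ℚ.* ε) (0<half 0<ε)
  ... | M , hM | N , hN = M ⊔ N , λ m n p q → begin-strict
    ℚ.∣ (s m ℚ.+ t m) ℚ.- (s n ℚ.+ t n) ∣
      ≡⟨ cong ℚ.∣_∣ (rearrange (s m) (t m) (s n) (t n)) ⟩
    ℚ.∣ (s m ℚ.- s n) ℚ.+ (t m ℚ.- t n) ∣
      ≤⟨ ℚ.∣p+q∣≤∣p∣+∣q∣ (s m ℚ.- s n) (t m ℚ.- t n) ⟩
    ℚ.∣ s m ℚ.- s n ∣ ℚ.+ ℚ.∣ t m ℚ.- t n ∣
      <⟨ ℚ.+-mono-< (hM m n (⊔≤ˡ p) (⊔≤ˡ q))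
                    (hN m n (⊔≤ʳ {M} p) (⊔≤ʳ {M} q)) ⟩
    ½ ℚ.* ε ℚ.+ ½ ℚ.* ε
      ≡⟨ half+half ε ⟩
    ε ∎
    where
    open ℚ.≤-Reasoning
    open +-*-Solver
    rearrange : ∀ a b c d →
      (a ℚ.+ b) ℚ.- (c ℚ.+ d) ≡ (a ℚ.- c) ℚ.+ (b ℚ.- d)
    rearrange = solve 4
      (λ a b c d → (a :+ b) :- (c :+ d) := (a :- c) :+ (b :- d)) refl

  neg-cauchy : ∀ s → IsCauchy s → IsCauchy (λ n → ℚ.- s n)
  neg-cauchy s cs ε 0<ε with cs ε 0<ε
  ... | N , hN = N , λ m n p q → begin-strict
    ℚ.∣ ℚ.- s m ℚ.- (ℚ.- s n) ∣ ≡⟨ cong ℚ.∣_∣ (rearrange (s m) (s n)) ⟩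
    ℚ.∣ ℚ.- (s m ℚ.- s n) ∣     ≡⟨ ℚ.∣-p∣≡∣p∣ (s m ℚ.- s n) ⟩
    ℚ.∣ s m ℚ.- s n ∣           <⟨ hN m n p q ⟩
    ε ∎
    where
    open ℚ.≤-Reasoning
    open +-*-Solver
    rearrange : ∀ a b → ℚ.- a ℚ.- (ℚ.- b) ≡ ℚ.- (a ℚ.- b)
    rearrange = solve 2 (λ a b → :- a :- (:- b) := :- (a :- b)) refl

  bounded-tail : ∀ {s} → IsCauchy s →
    ∃[ B ] Positive B × ∃[ N ] ∀ n → N ℕ.≤ n → ℚ.∣ s n ∣ ℚ.≤ B
  bounded-tail {s} cs with cs 1ℚ (ℚ.positive⁻¹ 1ℚ)
  ... | N , hN =
    1ℚ ℚ.+ ℚ.∣ s N ∣ ,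
    ℚ.pos+nonNeg⇒pos 1ℚ ℚ.∣ s N ∣ {{ℚ.∣-∣-nonNeg (s N)}} ,
    N , λ n p → begin
      ℚ.∣ s n ∣
        ≡⟨ cong ℚ.∣_∣ (rearrange (s n) (s N)) ⟩
      ℚ.∣ (s n ℚ.- s N) ℚ.+ s N ∣
        ≤⟨ ℚ.∣p+q∣≤∣p∣+∣q∣ (s n ℚ.- s N) (s N) ⟩
      ℚ.∣ s n ℚ.- s N ∣ ℚ.+ ℚ.∣ s N ∣
        ≤⟨ ℚ.+-monoˡ-≤ ℚ.∣ s N ∣ (ℚ.<⇒≤ (hN n N p ℕ.≤-refl)) ⟩
      1ℚ ℚ.+ ℚ.∣ s N ∣ ∎
    where
    open ℚ.≤-Reasoning
    open +-*-Solver
    rearrange : ∀ a b → a ≡ (a ℚ.- b) ℚ.+ b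
    rearrange = solve 2 (λ a b → a := (a :- b) :+ b) refl

  divide : ∀ B → Positive B → ∀ ε → 0ℚ ℚ.< ε →
           ∃[ δ ] 0ℚ ℚ.< δ × B ℚ.* δ ≡ ε
  divide B B>0 ε 0<ε = B⁻¹ ℚ.* ε ,
    ℚ.positive⁻¹ (B⁻¹ ℚ.* ε)
      {{ℚ.pos*pos⇒pos B⁻¹ {{ℚ.1/pos⇒pos B {{B>0}}}} ε {{ℚ.positive 0<ε}}}} ,
    trans (sym (ℚ.*-assoc B B⁻¹ ε))
          (trans (cong (ℚ._* ε) (ℚ.*-inverseʳ B {{B≢0}})) (ℚ.*-identityˡ ε))
    where
    B≢0 : ℚ.NonZero B
    B≢0 = ℚ.pos⇒nonZero B {{B>0}}
    B⁻¹ : ℚ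
    B⁻¹ = (ℚ.1/ B) {{B≢0}}

  *-mono-bound : ∀ a b {A D} → Positive A → ℚ.∣ a ∣ ℚ.≤ A → ℚ.∣ b ∣ ℚ.< D →
                 ℚ.∣ a ℚ.* b ∣ ℚ.< A ℚ.* D
  *-mono-bound a b {A} {D} A>0 a≤ b< = begin-strict
    ℚ.∣ a ℚ.* b ∣         ≡⟨ ℚ.∣p*q∣≡∣p∣*∣q∣ a b ⟩
    ℚ.∣ a ∣ ℚ.* ℚ.∣ b ∣
      ≤⟨ ℚ.*-monoʳ-≤-nonNeg ℚ.∣ b ∣ {{ℚ.∣-∣-nonNeg b}} a≤ ⟩
    A ℚ.* ℚ.∣ b ∣         <⟨ ℚ.*-monoʳ-<-pos A {{A>0}} b< ⟩
    A ℚ.* D ∎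
    where open ℚ.≤-Reasoning

  *-cauchy : ∀ s t → IsCauchy s → IsCauchy t →
             IsCauchy (λ n → s n ℚ.* t n)
  *-cauchy s t cs ct ε 0<ε =
    let A , A>0 , K , hK = bounded-tail cs
        B , B>0 , L , hL = bounded-tail ct
        δ , 0<δ , Aδ = divide A A>0 (½ ℚ.* ε) (0<half 0<ε)
        η , 0<η , Bη = divide B B>0 (½ ℚ.* ε) (0<half 0<ε)
        M , hM = ct δ 0<δ
        N , hN = cs η 0<η
    in
    (K ⊔ L) ⊔ (M ⊔ N) , λ m n p q → begin-strict
      ℚ.∣ s m ℚ.* t m ℚ.- s n ℚ.* t n ∣
        ≡⟨ cong ℚ.∣_∣ (rearrange (s m) (t m) (s n) (t n)) ⟩
      ℚ.∣ s m ℚ.* (t m ℚ.- t n) ℚ.+ t n ℚ.* (s m ℚ.- s n) ∣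
        ≤⟨ ℚ.∣p+q∣≤∣p∣+∣q∣ (s m ℚ.* (t m ℚ.- t n)) (t n ℚ.* (s m ℚ.- s n)) ⟩
      ℚ.∣ s m ℚ.* (t m ℚ.- t n) ∣ ℚ.+ ℚ.∣ t n ℚ.* (s m ℚ.- s n) ∣
        <⟨ ℚ.+-mono-<
             (*-mono-bound (s m) (t m ℚ.- t n) A>0
               (hK m (⊔≤ˡ {K} (⊔≤ˡ p)))
               (hM m n (⊔≤ˡ {M} (⊔≤ʳ {K ⊔ L} p)) (⊔≤ˡ {M} (⊔≤ʳ {K ⊔ L} q))))
             (*-mono-bound (t n) (s m ℚ.- s n) B>0
               (hL n (⊔≤ʳ {K} (⊔≤ˡ q)))
               (hN m n (⊔≤ʳ {M} (⊔≤ʳ {K ⊔ L} p)) (⊔≤ʳ {M} (⊔≤ʳ {K ⊔ L} q)))) ⟩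
      A ℚ.* δ ℚ.+ B ℚ.* η
        ≡⟨ cong₂ ℚ._+_ Aδ Bη ⟩
      ½ ℚ.* ε ℚ.+ ½ ℚ.* ε
        ≡⟨ half+half ε ⟩
      ε ∎
    where
    open ℚ.≤-Reasoning
    open +-*-Solver
    rearrange : ∀ a b c d →
      a ℚ.* b ℚ.- c ℚ.* d ≡ a ℚ.* (b ℚ.- d) ℚ.+ d ℚ.* (a ℚ.- c)
    rearrange = solve 4
      (λ a b c d → a :* b :- c :* d := a :* (b :- d) :+ d :* (a :- c)) refl

infixl 6 _+_ _-_
infixl 7 _*_
infix  8 -_
infix  4 _≈_ _<_

ι : ℚ → ℝ
ι q = mkℝ (λ _ → q) (const-cauchy q)

_+_ : ℝ → ℝ → ℝ
x + y =
  mkℝ (λ n → seq x n ℚ.+ seq y n) (+-cauchy (seq x) (seq y) (cauchy x) (cauchy y))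

-_ : ℝ → ℝ
- x = mkℝ (λ n → ℚ.- seq x n) (neg-cauchy (seq x) (cauchy x))

_-_ : ℝ → ℝ → ℝ
x - y = x + - y

_*_ : ℝ → ℝ → ℝ
x * y =
  mkℝ (λ n → seq x n ℚ.* seq y n) (*-cauchy (seq x) (seq y) (cauchy x) (cauchy y))

0ℝ 1ℝ : ℝ
0ℝ = ι 0ℚ
1ℝ = ι 1ℚ

fromℕ : ℕ → ℝ
fromℕ n = ι (+ n ℚ./ 1)

_≈_ : ℝ → ℝ → Set
x ≈ y = ∀ ε → 0ℚ ℚ.< ε →
  ∃[ N ] ∀ n → N ℕ.≤ n → ℚ.∣ seq x n ℚ.- seq y n ∣ ℚ.< ε

-- The gap ε must be uniform in n: a termwise strict inequality alone does
-- not separate the limits.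
_<_ : ℝ → ℝ → Set
x < y = ∃[ ε ] 0ℚ ℚ.< ε ×
  ∃[ N ] ∀ n → N ℕ.≤ n → seq x n ℚ.+ ε ℚ.< seq y n

ℝ-rawRing : RawRing 0ℓ 0ℓ
ℝ-rawRing = record
  { Carrier = ℝ ; _≈_ = _≈_ ; _+_ = _+_ ; _*_ = _*_ ; -_ = -_
  ; 0# = 0ℝ ; 1# = 1ℝ }

open RawSemiringDefs (RawRing.rawSemiring ℝ-rawRing) public
  using (sum; _^_)

infix 4 _⟶_

_⟶_ : (ℕ → ℝ) → ℝ → Set
s ⟶ l = ∀ ε → 0ℝ < ε →
  ∃[ N ] ∀ n → N ℕ.≤ n → s n - l < ε × l - s n < ε

expPartialSum : ℝ → ℕ → ℝ
expPartialSum y n =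
  sum {n} λ k → ι ((+ 1 ℚ./ (toℕ k !)) {{ℕ._!≢0 (toℕ k)}}) * y ^ toℕ k

ExpIs : ℝ → ℝ → Set
ExpIs y x = expPartialSum y ⟶ x

valueOr0 : {P : ℝ → Set} → Dec (∃ P) → ℝ
valueOr0 (yes (y , _)) = y
valueOr0 (no  _)       = 0ℝ

-- The y with exp y = Σ yᵏ / k! equal to x, unique up to ≈. The fallback 0 is
-- only reached when no such y exists, i.e. for x ≤ 0.
log : ExcludedMiddle 0ℓ → ℝ → ℝ
log em x = valueOr0 (em {∃[ y ] ExpIs y x})

-- Polynomials are coefficient lists, constant term first.
module Polynomial (R : RawRing 0ℓ 0ℓ) where
  open RawRing R using (Carrier; 0#)
    renaming (_≈_ to _≈ᴿ_; _+_ to _+ᴿ_; _*_ to _*ᴿ_)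

  Poly : Set
  Poly = List Carrier

  eval : Poly → Carrier → Carrier
  eval p x = foldr (λ a v → a +ᴿ x *ᴿ v) 0# p

  -- Equality of coefficient lists is only meaningful up to trailing zeros,
  -- so the zero polynomial is any list all of whose entries vanish.
  IsZero : Poly → Set
  IsZero = All (_≈ᴿ 0#)

module ℝ[x] = Polynomial ℝ-rawRing

FinitelyMany : (ℝ → Set) → Set
FinitelyMany P = ∃[ zs ] ∀ x → P x → Any (x ≈_) zs

logSum : ExcludedMiddle 0ℓ → ∀ {d} →
         (Fin (suc d) → ℝ[x].Poly) → (Fin (suc d) → ℝ) → ℝ → ℝ
logSum em p b x = sum λ i → ℝ[x].eval (p i) x * log em (x + b i)

record ℂ : Set where
  constructor _+i_
  field
    re im : ℝ

open ℂ public

ℂ-rawRing : RawRing 0ℓ 0ℓ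
ℂ-rawRing = record
  { Carrier = ℂ
  ; _≈_ = λ z w → re z ≈ re w × im z ≈ im w
  ; _+_ = λ z w → (re z + re w) +i (im z + im w)
  ; _*_ = λ z w → (re z * re w - im z * im w) +i (re z * im w + im z * re w)
  ; -_  = λ z → (- re z) +i (- im z)
  ; 0#  = 0ℝ +i 0ℝ
  ; 1#  = 1ℝ +i 0ℝ
  }

ofReal : ℝ → ℂ
ofReal x = x +i 0ℝ

module ℂ[x] = Polynomial ℂ-rawRing

-- Sequences are indexed from 1: the value a 0 is never used.
Holonomic : (ℕ → ℂ) → Set
Holonomic a =
  ∃[ d ] ∃ λ (p : Fin (suc d) → ℂ[x].Poly) →
    ¬ (∀ i → ℂ[x].IsZero (p i)) ×
    (∀ n → 1 ℕ.≤ n →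
      sumℂ (λ i → ℂ[x].eval (p i) (ofReal (fromℕ n)) *ℂ a (n ℕ.+ toℕ i)) ≈ℂ 0#)
  where
  open RawRing ℂ-rawRing using (0#) renaming (_*_ to _*ℂ_; _≈_ to _≈ℂ_)
  open RawSemiringDefs (RawRing.rawSemiring ℂ-rawRing) using ()
    renaming (sum to sumℂ)

{-# OPTIONS --safe #-}

-- Between two positive zeros of a differentiable function lies a zero of its
-- derivative, so it suffices that some iterated derivative of
-- F = Σ pᵢ log(x + bᵢ) has finitely many zeros (Rolle). Differentiating often
-- enough removes every logarithm and leaves a rational function. It is not
-- zero: if pᵢ ≠ 0 vanishes to order m at -bᵢ, the derivatives of
-- pᵢ log(x + bᵢ) of order above m have a pole at -bᵢ, which no other summand
-- can cancel. Finally, log' = 1/x follows from the functional equation of exp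
-- and 1 + y ≤ exp y.

module Submission where

open import Defs using (IsCauchy; 0<half; module Polynomial)
open import Algebra.Bundles using (CommutativeRing)
open import Algebra.Bundles.Raw using (RawRing)
import Algebra.Definitions.RawSemiring as RawSemiringDefs
import Algebra.Properties.CommutativeMonoid.Sum as Sum
import Algebra.Properties.Semiring.Exp as Exponentiation
import Algebra.Solver.Ring as RingSolver
open import Algebra.Solver.Ring.AlmostCommutativeRing
  using (_-Raw-AlmostCommutative⟶_; Induced-equivalence; fromCommutativeRing)
open import Axiom.ExcludedMiddle using (ExcludedMiddle)
open import Data.Empty using (⊥)
open import Data.Fin.Base as Fin using (Fin; zero; suc; toℕ)
open import Data.Fin.Properties as Fin using (toℕ-inject₁; toℕ-fromℕ)
open import Data.Integer.Base as ℤ using (+_; -[1+_])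
import Data.Integer.Properties as ℤ
open import Data.List.Base using ([]; _∷_; _++_; length; map)
open import Data.List.Relation.Unary.All as All using ([]; _∷_)
open import Data.List.Relation.Unary.All.Properties using (map⁻)
open import Data.List.Relation.Unary.Any as Any using (Any; here; there)
open import Data.List.Relation.Unary.Any.Properties using (++⁺ˡ; ++⁺ʳ)
open import Data.Maybe.Base using (just; nothing)
open import Data.Nat.Base as ℕ using (ℕ; zero; suc)
import Data.Nat.Properties as ℕ
open import Data.Product.Base using (∃; ∃-syntax; _×_; _,_; proj₁; proj₂)
open import Data.Rational.Base as ℚ using (ℚ; 0ℚ; 1ℚ; ½)
import Data.Rational.Properties as ℚ
import Data.Rational.Solver as ℚSolver
open import Data.Rational.Unnormalised.Base as ℚᵘ using (mkℚᵘ)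
import Data.Rational.Unnormalised.Properties as ℚᵘ
open import Data.Sum.Base using (_⊎_; inj₁; inj₂; [_,_]′)
open import Level using (0ℓ)
open import Relation.Binary.Definitions using (WeaklyDecidable; tri<; tri≈; tri>)
open import Relation.Binary.PropositionalEquality as ≡ using (_≡_)
import Relation.Binary.Reasoning.Setoid as SetoidReasoning
open import Relation.Binary.Structures using (IsEquivalence)
open import Relation.Nullary.Decidable.Core using (Dec; yes; no)
open import Relation.Nullary.Negation.Core using (¬_; contradiction)

-- The pole at `-bᵢ` lies outside the domain of `F`, so no analysis can take place there. It is
-- carried by a polynomial instead: every derivative of `F` is kept as a numerator over a
-- denominator that is positive for `x > 0`, and a nonzero value at `-bᵢ` of the logarithm-free part
-- of that numerator certifies the pole. Hence Rolle's theorem is proved for quotients, with a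
-- Wronskian in place of the derivative. A pole of order `k ≥ 1` stays under differentiation because
-- its leading coefficient is multiplied by `-k`. As long as `pᵢ(-bᵢ) = 0` and no pole has appeared
-- yet, a factor `x + bᵢ` cancels instead, so the order of vanishing of `pᵢ` never has to be
-- computed. The second claim follows by taking `bᵢ = i`. The logarithms are real, so a recurrence
-- for `log n` with complex polynomials splits into one for the real and one for the imaginary parts
-- of the coefficients. Each says that such an `F` vanishes at every positive integer, which is too
-- many zeros unless all its polynomials are zero.

fromℕℚ : ℕ → ℚ
fromℕℚ n = + n ℚ./ 1

toℚᵘ-fromℕℚ : ∀ n → ℚ.toℚᵘ (fromℕℚ n) ℚᵘ.≃ mkℚᵘ (+ n) 0
toℚᵘ-fromℕℚ n = ℚ.toℚᵘ-fromℚᵘ (mkℚᵘ (+ n) 0)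

fromℕℚ-+ : ∀ m n → fromℕℚ (m ℕ.+ n) ≡ fromℕℚ m ℚ.+ fromℕℚ n
fromℕℚ-+ m n = ℚ.toℚᵘ-injective (begin
  ℚ.toℚᵘ (fromℕℚ (m ℕ.+ n))                     ≈⟨ toℚᵘ-fromℕℚ (m ℕ.+ n) ⟩
  mkℚᵘ (+ (m ℕ.+ n)) 0                          ≈⟨ ℚᵘ.*≡* (≡.cong (λ k → k ℤ.* + 1) sum≡) ⟩
  mkℚᵘ (+ m) 0 ℚᵘ.+ mkℚᵘ (+ n) 0
    ≈⟨ ℚᵘ.+-cong (toℚᵘ-fromℕℚ m) (toℚᵘ-fromℕℚ n) ⟨
  ℚ.toℚᵘ (fromℕℚ m) ℚᵘ.+ ℚ.toℚᵘ (fromℕℚ n)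
    ≈⟨ ℚ.toℚᵘ-homo-+ (fromℕℚ m) (fromℕℚ n) ⟨
  ℚ.toℚᵘ (fromℕℚ m ℚ.+ fromℕℚ n)                ∎)
  where
  open ℚᵘ.≃-Reasoning
  sum≡ : + (m ℕ.+ n) ≡ + m ℤ.* + 1 ℤ.+ + n ℤ.* + 1
  sum≡ = ≡.trans (ℤ.pos-+ m n)
    (≡.sym (≡.cong₂ ℤ._+_ (ℤ.*-identityʳ (+ m)) (ℤ.*-identityʳ (+ n))))

fromℕℚ-* : ∀ m n → fromℕℚ (m ℕ.* n) ≡ fromℕℚ m ℚ.* fromℕℚ n
fromℕℚ-* m n = ℚ.toℚᵘ-injective (begin
  ℚ.toℚᵘ (fromℕℚ (m ℕ.* n))                     ≈⟨ toℚᵘ-fromℕℚ (m ℕ.* n) ⟩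
  mkℚᵘ (+ (m ℕ.* n)) 0
    ≈⟨ ℚᵘ.*≡* (≡.cong (λ k → k ℤ.* + 1) (ℤ.pos-* m n)) ⟩
  mkℚᵘ (+ m) 0 ℚᵘ.* mkℚᵘ (+ n) 0
    ≈⟨ ℚᵘ.*-cong (toℚᵘ-fromℕℚ m) (toℚᵘ-fromℕℚ n) ⟨
  ℚ.toℚᵘ (fromℕℚ m) ℚᵘ.* ℚ.toℚᵘ (fromℕℚ n)
    ≈⟨ ℚ.toℚᵘ-homo-* (fromℕℚ m) (fromℕℚ n) ⟨
  ℚ.toℚᵘ (fromℕℚ m ℚ.* fromℕℚ n)                ∎)
  where open ℚᵘ.≃-Reasoning

-- A positive fraction is at least the reciprocal of its denominator, so the denominator itself
-- serves as `n`.
fromℕℚ-archimedean : ∀ δ → 0ℚ ℚ.< δ → ∃[ n ] 1ℚ ℚ.≤ fromℕℚ n ℚ.* δ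
fromℕℚ-archimedean δ@(ℚ.mkℚ (+ suc a) d _) _ = suc d , ℚ.toℚᵘ-cancel-≤ (begin
  ℚ.toℚᵘ 1ℚ
    ≤⟨ ℚᵘ.*≤* (ℤ.+≤+ bound) ⟩
  mkℚᵘ (+ suc d) 0 ℚᵘ.* ℚ.toℚᵘ δ
    ≃⟨ ℚᵘ.*-congʳ {ℚ.toℚᵘ δ} (toℚᵘ-fromℕℚ (suc d)) ⟨
  ℚ.toℚᵘ (fromℕℚ (suc d)) ℚᵘ.* ℚ.toℚᵘ δ
    ≃⟨ ℚ.toℚᵘ-homo-* (fromℕℚ (suc d)) δ ⟨
  ℚ.toℚᵘ (fromℕℚ (suc d) ℚ.* δ) ∎)
  where
  open ℚᵘ.≤-Reasoning
  bound : suc (d ℕ.+ 0 ℕ.+ 0) ℕ.≤ suc ((a ℕ.+ d ℕ.* suc a) ℕ.* 1)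
  bound = ℕ.s≤s (ℕ.≤-trans
    (ℕ.≤-reflexive (≡.trans (ℕ.+-identityʳ (d ℕ.+ 0)) (ℕ.+-identityʳ d)))
    (ℕ.≤-trans (ℕ.m≤m*n d (suc a)) (ℕ.≤-trans (ℕ.m≤n+m (d ℕ.* suc a) a)
      (ℕ.≤-reflexive (≡.sym (ℕ.*-identityʳ _))))))
fromℕℚ-archimedean (ℚ.mkℚ (+ ℕ.zero) d _) (ℚ.*<* (ℤ.+<+ ()))
fromℕℚ-archimedean (ℚ.mkℚ -[1+ a ] d _) (ℚ.*<* ())

∣∣<-intro : ∀ {p ε} → p ℚ.< ε → ℚ.- p ℚ.< ε → ℚ.∣ p ∣ ℚ.< ε
∣∣<-intro {p} {ε} p<ε -p<ε with ℚ.∣p∣≡p∨∣p∣≡-p p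
... | inj₁ eq = ≡.subst (ℚ._< ε) (≡.sym eq) p<ε
... | inj₂ eq = ≡.subst (ℚ._< ε) (≡.sym eq) -p<ε

-- Axioms of a complete Archimedean ordered field

record RealField : Set₁ where
  infix 4 _<_
  field
    commutativeRing : CommutativeRing 0ℓ 0ℓ

  open CommutativeRing commutativeRing public hiding (zero)

  field
    _<_         : Carrier → Carrier → Set
    <-resp-≈    : ∀ {x x′ y y′} → x ≈ x′ → y ≈ y′ → x < y → x′ < y′
    <-irrefl    : ∀ {x} → ¬ x < x
    <-trans     : ∀ {x y z} → x < y → y < z → x < z
    <-cmp       : ∀ x y → x < y ⊎ x ≈ y ⊎ y < x
    +-monoʳ-<   : ∀ z {x y} → x < y → z + x < z + y
    *-pos       : ∀ {x y} → 0# < x → 0# < y → 0# < x * y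
    reciprocal  : ∀ {x} → 0# < x → ∃[ y ] x * y ≈ 1#
    ι           : ℚ → Carrier
    ι-+         : ∀ p q → ι (p ℚ.+ q) ≈ ι p + ι q
    ι-*         : ∀ p q → ι (p ℚ.* q) ≈ ι p * ι q
    ι-neg       : ∀ p → ι (ℚ.- p) ≈ - ι p
    ι-0         : ι 0ℚ ≈ 0#
    ι-1         : ι 1ℚ ≈ 1#
    ι-<         : ∀ {p q} → p ℚ.< q → ι p < ι q
    archimedean : ∀ {x} → 0# < x → ∃[ ε ] 0ℚ ℚ.< ε × ι ε < x
    approximate : ∀ x ε → 0ℚ ℚ.< ε → ∃[ q ] (x - ι q < ι ε × ι q - x < ι ε)
    -- Limits are demanded of rational sequences only; together with `approximate` this yields
    -- limits of all Cauchy sequences.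
    complete    : ∀ q → IsCauchy q →
      ∃[ l ] ∀ ε → 0ℚ ℚ.< ε → ∃[ N ] ∀ n → N ℕ.≤ n →
        ι (q n) - l < ι ε × l - ι (q n) < ι ε

module Analysis (K : RealField) (em : ExcludedMiddle 0ℓ) where

  open RealField K
  open SetoidReasoning setoid

  -- The solver evaluates constants through this copy of ι, so that 0ℚ and 1ℚ
  -- denote 0# and 1# on the nose.
  ι′ : ℚ → Carrier
  ι′ q with q ℚ.≟ 0ℚ | q ℚ.≟ 1ℚ
  ... | yes _ | _     = 0#
  ... | no  _ | yes _ = 1#
  ... | no  _ | no  _ = ι q

  ι′≈ι : ∀ q → ι′ q ≈ ι q
  ι′≈ι q with q ℚ.≟ 0ℚ | q ℚ.≟ 1ℚ
  ... | yes ≡.refl | _          = sym ι-0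
  ... | no  _      | yes ≡.refl = sym ι-1
  ... | no  _      | no  _      = refl

  ι-homomorphism :
    CommutativeRing.rawRing ℚ.+-*-commutativeRing
      -Raw-AlmostCommutative⟶ fromCommutativeRing commutativeRing
  ι-homomorphism = record
    { ⟦_⟧    = ι′
    ; +-homo = λ p q → trans (ι′≈ι _)
        (trans (ι-+ p q) (sym (+-cong (ι′≈ι p) (ι′≈ι q))))
    ; *-homo = λ p q → trans (ι′≈ι _)
        (trans (ι-* p q) (sym (*-cong (ι′≈ι p) (ι′≈ι q))))
    ; -‿homo = λ p → trans (ι′≈ι _) (trans (ι-neg p) (sym (-‿cong (ι′≈ι p))))
    ; 0-homo = refl
    ; 1-homo = refl
    }

  ι-≟ : WeaklyDecidable (Induced-equivalence ι-homomorphism)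
  ι-≟ p q with p ℚ.≟ q
  ... | yes ≡.refl = just refl
  ... | no  _      = nothing

  open RingSolver (CommutativeRing.rawRing ℚ.+-*-commutativeRing)
    (fromCommutativeRing commutativeRing) ι-homomorphism ι-≟
    using (solve; _:+_; _:*_; _:-_; :-_; con; _:=_)
  open Sum +-commutativeMonoid
    using (sum; sum-init-last; sum-cong-≗; sum-cong-≋; sum-remove; ∑-distrib-+)
  open Exponentiation semiring using (_^_)

  -- Order and inequalities

  infix 4 _≤_
  -- By `<-cmp` this negation is the usual weak order, and a weak inequality can be proved by
  -- refuting a strict one.
  _≤_ : Carrier → Carrier → Set
  x ≤ y = ¬ y < x

  <⇒≤ : ∀ {x y} → x < y → x ≤ y
  <⇒≤ x<y y<x = <-irrefl (<-trans x<y y<x)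

  ≰⇒> : ∀ {x y} → ¬ x ≤ y → y < x
  ≰⇒> {x} {y} x≰y with <-cmp x y
  ... | inj₁ x<y        = contradiction (<⇒≤ x<y) x≰y
  ... | inj₂ (inj₂ y<x) = y<x
  ... | inj₂ (inj₁ x≈y) =
    contradiction (λ y<x → <-irrefl (<-resp-≈ refl x≈y y<x)) x≰y

  ≤-resp-≈ : ∀ {x x′ y y′} → x ≈ x′ → y ≈ y′ → x ≤ y → x′ ≤ y′
  ≤-resp-≈ p q x≤y y′<x′ = x≤y (<-resp-≈ (sym q) (sym p) y′<x′)

  ≤-refl : ∀ {x} → x ≤ x
  ≤-refl = <-irrefl

  ≤-reflexive : ∀ {x y} → x ≈ y → x ≤ y
  ≤-reflexive x≈y = ≤-resp-≈ refl x≈y ≤-refl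

  <-≤-trans : ∀ {x y z} → x < y → y ≤ z → x < z
  <-≤-trans {x} {y} {z} x<y y≤z with <-cmp y z
  ... | inj₁ y<z        = <-trans x<y y<z
  ... | inj₂ (inj₁ y≈z) = <-resp-≈ refl y≈z x<y
  ... | inj₂ (inj₂ z<y) = contradiction z<y y≤z

  ≤-<-trans : ∀ {x y z} → x ≤ y → y < z → x < z
  ≤-<-trans {x} {y} {z} x≤y y<z with <-cmp x y
  ... | inj₁ x<y        = <-trans x<y y<z
  ... | inj₂ (inj₁ x≈y) = <-resp-≈ (sym x≈y) refl y<z
  ... | inj₂ (inj₂ y<x) = contradiction y<x x≤y

  ≤-trans : ∀ {x y z} → x ≤ y → y ≤ z → x ≤ z
  ≤-trans x≤y y≤z z<x = y≤z (<-≤-trans z<x x≤y)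

  ≤-antisym : ∀ {x y} → x ≤ y → y ≤ x → x ≈ y
  ≤-antisym {x} {y} x≤y y≤x with <-cmp x y
  ... | inj₁ x<y        = contradiction x<y y≤x
  ... | inj₂ (inj₁ x≈y) = x≈y
  ... | inj₂ (inj₂ y<x) = contradiction y<x x≤y

  ≤-total : ∀ x y → x ≤ y ⊎ y ≤ x
  ≤-total x y with <-cmp x y
  ... | inj₁ x<y        = inj₁ (<⇒≤ x<y)
  ... | inj₂ (inj₁ x≈y) = inj₁ (≤-reflexive x≈y)
  ... | inj₂ (inj₂ y<x) = inj₂ (<⇒≤ y<x)

  0<-difference : ∀ {x y} → x < y → 0# < y - x
  0<-difference {x} {y} x<y =
    <-resp-≈ (-‿inverseˡ x) (+-comm (- x) y) (+-monoʳ-< (- x) x<y)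

  0≤-difference : ∀ {x y} → x ≤ y → 0# ≤ y - x
  0≤-difference {x} {y} x≤y y-x<0 = x≤y
    (<-resp-≈ (solve 2 (λ x y → x :+ (y :- x) := y) refl x y) (+-identityʳ x)
      (+-monoʳ-< x y-x<0))

  -- Together with `≤-by` this splits an inequality into a ring identity for the difference, left to
  -- the solver, and the sign of a suitably arranged expression.
  <-by : ∀ {x y e} → y - x ≈ e → 0# < e → x < y
  <-by {x} {y} eq 0<e =
    <-resp-≈ (+-identityʳ x)
      (trans (+-congˡ (sym eq)) (solve 2 (λ x y → x :+ (y :- x) := y) refl x y))
      (+-monoʳ-< x 0<e)

  ≤-by : ∀ {x y e} → y - x ≈ e → 0# ≤ e → x ≤ y
  ≤-by {x} {y} eq 0≤e y<x = 0≤e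
    (<-by (trans (+-congˡ (-‿cong (sym eq)))
                 (solve 2 (λ x y → con 0ℚ :- (y :- x) := x :- y) refl x y))
      (0<-difference y<x))

  2# : Carrier
  2# = 1# + 1#

  2⁻¹ : Carrier
  2⁻¹ = ι ½

  0≤-≈ : ∀ {x y} → x ≈ y → 0# ≤ x → 0# ≤ y
  0≤-≈ = ≤-resp-≈ refl

  +-pos : ∀ {x y} → 0# < x → 0# < y → 0# < x + y
  +-pos {x} 0<x 0<y =
    <-trans 0<x (<-resp-≈ (+-identityʳ x) refl (+-monoʳ-< x 0<y))

  pos+nonneg : ∀ {x y} → 0# < x → 0# ≤ y → 0# < x + y
  pos+nonneg {x} {y} 0<x 0≤y =
    <-≤-trans 0<x (≤-by (solve 2 (λ x y → x :+ y :- x := y) refl x y) 0≤y)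

  +-nonneg : ∀ {x y} → 0# ≤ x → 0# ≤ y → 0# ≤ x + y
  +-nonneg {x} {y} 0≤x 0≤y =
    ≤-trans 0≤x (≤-by (solve 2 (λ x y → x :+ y :- x := y) refl x y) 0≤y)

  *-nonneg : ∀ {x y} → 0# ≤ x → 0# ≤ y → 0# ≤ x * y
  *-nonneg {x} {y} 0≤x 0≤y with <-cmp 0# x | <-cmp 0# y
  ... | inj₂ (inj₂ x<0) | _               = contradiction x<0 0≤x
  ... | _               | inj₂ (inj₂ y<0) = contradiction y<0 0≤y
  ... | inj₁ 0<x        | inj₁ 0<y        = <⇒≤ (*-pos 0<x 0<y)
  ... | inj₂ (inj₁ 0≈x) | _               =
    ≤-reflexive (trans (sym (zeroˡ y)) (*-congʳ 0≈x))
  ... | _               | inj₂ (inj₁ 0≈y) =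
    ≤-reflexive (trans (sym (zeroʳ x)) (*-congˡ 0≈y))

  +-mono-≤ : ∀ {w x y z} → w ≤ x → y ≤ z → w + y ≤ x + z
  +-mono-≤ {w} {x} {y} {z} w≤x y≤z = ≤-by
    (solve 4 (λ w x y z → x :+ z :- (w :+ y) := (x :- w) :+ (z :- y)) refl w x y z)
    (+-nonneg (0≤-difference w≤x) (0≤-difference y≤z))

  +-mono-< : ∀ {w x y z} → w < x → y < z → w + y < x + z
  +-mono-< {w} {x} {y} {z} w<x y<z = <-by
    (solve 4 (λ w x y z → x :+ z :- (w :+ y) := (x :- w) :+ (z :- y)) refl w x y z)
    (+-pos (0<-difference w<x) (0<-difference y<z))

  *-monoˡ-≤ : ∀ {a x y} → 0# ≤ a → x ≤ y → a * x ≤ a * y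
  *-monoˡ-≤ {a} {x} {y} 0≤a x≤y = ≤-by
    (solve 3 (λ a x y → a :* y :- a :* x := a :* (y :- x)) refl a x y)
    (*-nonneg 0≤a (0≤-difference x≤y))

  *-monoˡ-< : ∀ {a x y} → 0# < a → x < y → a * x < a * y
  *-monoˡ-< {a} {x} {y} 0<a x<y = <-by
    (solve 3 (λ a x y → a :* y :- a :* x := a :* (y :- x)) refl a x y)
    (*-pos 0<a (0<-difference x<y))

  *-mono-≤ : ∀ {w x y z} → 0# ≤ w → 0# ≤ z → w ≤ x → y ≤ z → w * y ≤ x * z
  *-mono-≤ {w} {x} {y} {z} 0≤w 0≤z w≤x y≤z = ≤-by
    (solve 4 (λ w x y z → x :* z :- w :* y := w :* (z :- y) :+ (x :- w) :* z)
      refl w x y z)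
    (+-nonneg (*-nonneg 0≤w (0≤-difference y≤z)) (*-nonneg (0≤-difference w≤x) 0≤z))

  *-cancelˡ-≤ : ∀ {a x y} → 0# < a → a * x ≤ a * y → x ≤ y
  *-cancelˡ-≤ 0<a ax≤ay y<x = ax≤ay (*-monoˡ-< 0<a y<x)

  *-cancelˡ-< : ∀ {a x y} → 0# < a → a * x < a * y → x < y
  *-cancelˡ-< 0<a ax<ay = ≰⇒> λ y≤x → *-monoˡ-≤ (<⇒≤ 0<a) y≤x ax<ay

  *-cancelˡ-≈ : ∀ {a x y} → 0# < a → a * x ≈ a * y → x ≈ y
  *-cancelˡ-≈ 0<a eq = ≤-antisym (*-cancelˡ-≤ 0<a (≤-reflexive eq))
                                 (*-cancelˡ-≤ 0<a (≤-reflexive (sym eq)))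

  neg-pos : ∀ {x} → x < 0# → 0# < - x
  neg-pos {x} x<0 = <-resp-≈ refl (+-identityˡ (- x)) (0<-difference x<0)

  neg-nonneg : ∀ {x} → x ≤ 0# → 0# ≤ - x
  neg-nonneg {x} x≤0 = 0≤-≈ (+-identityˡ (- x)) (0≤-difference x≤0)

  ≈⇒difference≈0 : ∀ {x y} → x ≈ y → x - y ≈ 0#
  ≈⇒difference≈0 {x} {y} x≈y = trans (+-congʳ x≈y) (-‿inverseʳ y)

  difference≈0⇒≈ : ∀ {x y} → x - y ≈ 0# → x ≈ y
  difference≈0⇒≈ {x} {y} eq = begin
    x           ≈⟨ solve 2 (λ x y → x := (x :- y) :+ y) refl x y ⟩
    (x - y) + y ≈⟨ +-congʳ eq ⟩
    0# + y      ≈⟨ +-identityˡ y ⟩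
    y           ∎

  x*y≈0⇒x≈0∨y≈0 : ∀ {x y} → x * y ≈ 0# → x ≈ 0# ⊎ y ≈ 0#
  x*y≈0⇒x≈0∨y≈0 {x} {y} xy≈0 with <-cmp x 0#
  ... | inj₂ (inj₁ x≈0) = inj₁ x≈0
  ... | inj₂ (inj₂ 0<x) = inj₂ (*-cancelˡ-≈ 0<x (trans xy≈0 (sym (zeroʳ x))))
  ... | inj₁ x<0        = inj₂ (*-cancelˡ-≈ (neg-pos x<0) (begin
    - x * y   ≈⟨ solve 2 (λ x y → :- x :* y := :- (x :* y)) refl x y ⟩
    - (x * y) ≈⟨ -‿cong xy≈0 ⟩
    - 0#      ≈⟨ solve 1 (λ x → :- con 0ℚ := :- x :* con 0ℚ) refl x ⟩
    - x * 0#  ∎))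

  *-nonzero : ∀ {x y} → ¬ x ≈ 0# → ¬ y ≈ 0# → ¬ x * y ≈ 0#
  *-nonzero x≉0 y≉0 xy≈0 with x*y≈0⇒x≈0∨y≈0 xy≈0
  ... | inj₁ x≈0 = x≉0 x≈0
  ... | inj₂ y≈0 = y≉0 y≈0

  ι-pos : ∀ {ε} → 0ℚ ℚ.< ε → 0# < ι ε
  ι-pos 0<ε = <-resp-≈ ι-0 refl (ι-< 0<ε)

  0<1 : 0# < 1#
  0<1 = <-resp-≈ refl ι-1 (ι-pos (ℚ.positive⁻¹ 1ℚ))

  0≤1 : 0# ≤ 1#
  0≤1 = <⇒≤ 0<1

  0<2 : 0# < 2#
  0<2 = +-pos 0<1 0<1

  0<2⁻¹ : 0# < 2⁻¹
  0<2⁻¹ = ι-pos (ℚ.positive⁻¹ ½)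

  half : ∀ {x} → 0# < x → 0# < 2⁻¹ * x
  half = *-pos 0<2⁻¹

  minimum : ∀ {x y} → 0# < x → 0# < y → ∃[ z ] 0# < z × z ≤ x × z ≤ y
  minimum {x} {y} 0<x 0<y with ≤-total x y
  ... | inj₁ x≤y = x , 0<x , ≤-refl , x≤y
  ... | inj₂ y≤x = y , 0<y , y≤x , ≤-refl

  -- Bounds ∣ x ∣ ≤ e are kept as pairs of inequalities, without an absolute
  -- value function.
  infix 4 ∣_∣≤_
  ∣_∣≤_ : Carrier → Carrier → Set
  ∣ x ∣≤ e = x ≤ e × - x ≤ e

  ∣∣≤-by : ∀ {x e u v} → e - x ≈ u → e + x ≈ v → 0# ≤ u → 0# ≤ v → ∣ x ∣≤ e
  ∣∣≤-by {x} {e} p q 0≤u 0≤v =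
    ≤-by p 0≤u , ≤-by (trans (solve 2 (λ e x → e :- :- x := e :+ x) refl e x) q) 0≤v

  ∣∣≤-lower : ∀ {x e} → ∣ x ∣≤ e → 0# ≤ e - x
  ∣∣≤-lower (x≤e , _) = 0≤-difference x≤e

  ∣∣≤-upper : ∀ {x e} → ∣ x ∣≤ e → 0# ≤ e + x
  ∣∣≤-upper {x} {e} (_ , -x≤e) = 0≤-≈
    (solve 2 (λ e x → e :- :- x := e :+ x) refl e x) (0≤-difference -x≤e)

  ∣∣≤-resp-≈ : ∀ {x y e f} → x ≈ y → e ≈ f → ∣ x ∣≤ e → ∣ y ∣≤ f
  ∣∣≤-resp-≈ p q (a , b) = ≤-resp-≈ p q a , ≤-resp-≈ (-‿cong p) q b

  ∣∣≤-weaken : ∀ {x e f} → e ≤ f → ∣ x ∣≤ e → ∣ x ∣≤ f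
  ∣∣≤-weaken e≤f (a , b) = ≤-trans a e≤f , ≤-trans b e≤f

  ∣∣≤-nonneg : ∀ {x e} → ∣ x ∣≤ e → 0# ≤ e
  ∣∣≤-nonneg {x} {e} ∣x∣≤e = *-cancelˡ-≤ 0<2
    (≤-by (solve 2 (λ e x → (con 1ℚ :+ con 1ℚ) :* e :- (con 1ℚ :+ con 1ℚ) :* con 0ℚ
                        := (e :- x) :+ (e :+ x)) refl e x)
      (+-nonneg (∣∣≤-lower ∣x∣≤e) (∣∣≤-upper ∣x∣≤e)))

  ∣∣≤-self : ∀ {x} → 0# ≤ x → ∣ x ∣≤ x
  ∣∣≤-self {x} 0≤x = ≤-refl ,
    ≤-by (solve 1 (λ x → x :- :- x := x :+ x) refl x) (+-nonneg 0≤x 0≤x)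

  ∣∣≤-exists : ∀ x → ∃[ e ] 0# ≤ e × ∣ x ∣≤ e
  ∣∣≤-exists x with ≤-total 0# x
  ... | inj₁ 0≤x = x , 0≤x , ∣∣≤-self 0≤x
  ... | inj₂ x≤0 = - x , neg-nonneg x≤0 ,
    ∣∣≤-by refl (-‿inverseˡ x)
      (+-nonneg (neg-nonneg x≤0) (neg-nonneg x≤0)) ≤-refl

  ∣∣≤-zero : ∀ {x} → x ≈ 0# → ∀ {e} → 0# ≤ e → ∣ x ∣≤ e
  ∣∣≤-zero x≈0 0≤e = ∣∣≤-resp-≈ (sym x≈0) refl (∣∣≤-weaken 0≤e (∣∣≤-self ≤-refl))

  ∣∣≤0⇒≈0 : ∀ {x} → ∣ x ∣≤ 0# → x ≈ 0#
  ∣∣≤0⇒≈0 {x} b@(x≤0 , _) =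
    ≤-antisym x≤0 (0≤-≈ (+-identityˡ x) (∣∣≤-upper b))

  ∣∣≤-neg : ∀ {x e} → ∣ x ∣≤ e → ∣ - x ∣≤ e
  ∣∣≤-neg {x} (a , b) = b , ≤-resp-≈ (solve 1 (λ x → x := :- :- x) refl x) refl a

  ∣∣≤-+ : ∀ {x y e f} → ∣ x ∣≤ e → ∣ y ∣≤ f → ∣ x + y ∣≤ e + f
  ∣∣≤-+ {x} {y} (a , b) (c , d) = +-mono-≤ a c ,
    ≤-resp-≈ (solve 2 (λ x y → :- x :+ :- y := :- (x :+ y)) refl x y) refl
      (+-mono-≤ b d)

  -- No case distinction on signs: `2(ef - xy) = (e - x)(f + y) + (e + x)(f - y)` and `2(ef + xy) =
  -- (e - x)(f - y) + (e + x)(f + y)`, where all four factors are nonnegative.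
  ∣∣≤-* : ∀ {x y e f} → ∣ x ∣≤ e → ∣ y ∣≤ f → ∣ x * y ∣≤ e * f
  ∣∣≤-* {x} {y} {e} {f} ∣x∣≤e ∣y∣≤f =
    *-cancelˡ-≤ 0<2 (≤-by
      (solve 4 (λ x y e f →
        (con 1ℚ :+ con 1ℚ) :* (e :* f) :- (con 1ℚ :+ con 1ℚ) :* (x :* y) :=
        (e :- x) :* (f :+ y) :+ (e :+ x) :* (f :- y)) refl x y e f)
      (+-nonneg (*-nonneg (∣∣≤-lower ∣x∣≤e) (∣∣≤-upper ∣y∣≤f))
                (*-nonneg (∣∣≤-upper ∣x∣≤e) (∣∣≤-lower ∣y∣≤f)))) ,
    *-cancelˡ-≤ 0<2 (≤-by
      (solve 4 (λ x y e f →
        (con 1ℚ :+ con 1ℚ) :* (e :* f) :- (con 1ℚ :+ con 1ℚ) :* (:- (x :* y)) :=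
        (e :- x) :* (f :- y) :+ (e :+ x) :* (f :+ y)) refl x y e f)
      (+-nonneg (*-nonneg (∣∣≤-lower ∣x∣≤e) (∣∣≤-lower ∣y∣≤f))
                (*-nonneg (∣∣≤-upper ∣x∣≤e) (∣∣≤-upper ∣y∣≤f))))

  ≤-from-slack : ∀ {x y} → (∀ ε → 0# < ε → x ≤ y + ε) → x ≤ y
  ≤-from-slack {x} {y} h y<x =
    h (2⁻¹ * (x - y)) (half (0<-difference y<x)) (<-by
      (solve 2 (λ x y → x :- (y :+ con ½ :* (x :- y)) := con ½ :* (x :- y)) refl x y)
      (half (0<-difference y<x)))

  reciprocal-pos : ∀ {x y} → 0# < x → x * y ≈ 1# → 0# < y
  reciprocal-pos {x} 0<x xy≈1 =
    *-cancelˡ-< 0<x (<-resp-≈ (sym (zeroʳ x)) (sym xy≈1) 0<1)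

  -- Natural numbers and powers of one half

  ν : ℕ → Carrier
  ν n = ι (fromℕℚ n)

  ν-suc : ∀ n → ν (suc n) ≈ 1# + ν n
  ν-suc n = trans (reflexive (≡.cong ι (fromℕℚ-+ 1 n)))
    (trans (ι-+ 1ℚ (fromℕℚ n)) (+-congʳ ι-1))

  ν-nonneg : ∀ n → 0# ≤ ν n
  ν-nonneg zero    = ≤-reflexive (sym ι-0)
  ν-nonneg (suc n) = 0≤-≈ (sym (ν-suc n)) (+-nonneg 0≤1 (ν-nonneg n))

  ν-suc-pos : ∀ n → 0# < ν (suc n)
  ν-suc-pos n = <-resp-≈ refl (sym (ν-suc n)) (pos+nonneg 0<1 (ν-nonneg n))

  ν-mono-≤′ : ∀ {m n} → m ℕ.≤′ n → ν m ≤ ν n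
  ν-mono-≤′ ℕ.≤′-refl           = ≤-refl
  ν-mono-≤′ (ℕ.≤′-step {n} m≤n) = ≤-trans (ν-mono-≤′ m≤n)
    (≤-by (trans (+-congʳ (ν-suc n))
      (solve 1 (λ x → con 1ℚ :+ x :- x := con 1ℚ) refl (ν n))) 0≤1)

  ν-mono-≤ : ∀ {m n} → m ℕ.≤ n → ν m ≤ ν n
  ν-mono-≤ m≤n = ν-mono-≤′ (ℕ.≤⇒≤′ m≤n)

  archimedean-ℕ : ∀ x → ∃[ n ] x ≤ ν n
  archimedean-ℕ x with <-cmp x 0#
  ... | inj₁ x<0        = 0 , ≤-trans (<⇒≤ x<0) (ν-nonneg 0)
  ... | inj₂ (inj₁ x≈0) = 0 , ≤-trans (≤-reflexive x≈0) (ν-nonneg 0)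
  ... | inj₂ (inj₂ 0<x) =
    let y , xy≈1 = reciprocal 0<x
        0<y = reciprocal-pos 0<x xy≈1
        δ , 0<δ , δ<y = archimedean 0<y
        n , 1≤nδ = fromℕℚ-archimedean δ 0<δ
        1≤ν*δ : 1# ≤ ν n * ι δ
        1≤ν*δ = ≤-resp-≈ ι-1 (ι-* (fromℕℚ n) δ) (ι-≤ 1≤nδ)
    in n , *-cancelˡ-≤ 0<y (≤-resp-≈ (trans (sym xy≈1) (*-comm x y)) (*-comm (ν n) y)
         (≤-trans 1≤ν*δ (*-monoˡ-≤ (ν-nonneg n) (<⇒≤ δ<y))))
    where
    ι-≤ : ∀ {p q} → p ℚ.≤ q → ι p ≤ ι q
    ι-≤ {p} {q} p≤q ιq<ιp with ℚ.<-cmp p q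
    ... | tri< p<q _ _ = <-irrefl (<-trans ιq<ιp (ι-< p<q))
    ... | tri≈ _ ≡.refl _ = <-irrefl ιq<ιp
    ... | tri> _ _ q<p = ℚ.<-irrefl ≡.refl (ℚ.<-≤-trans q<p p≤q)

  ι-cancel-< : ∀ {p q} → ι p < ι q → p ℚ.< q
  ι-cancel-< {p} {q} ιp<ιq with ℚ.<-cmp p q
  ... | tri< p<q _ _    = p<q
  ... | tri≈ _ ≡.refl _ = contradiction ιp<ιq <-irrefl
  ... | tri> _ _ q<p    = contradiction (ι-< q<p) (<⇒≤ ιp<ιq)

  2⁻ⁿ : ℕ → ℚ
  2⁻ⁿ zero    = 1ℚ
  2⁻ⁿ (suc n) = ½ ℚ.* 2⁻ⁿ n

  0<2⁻ⁿ : ∀ n → 0ℚ ℚ.< 2⁻ⁿ n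
  0<2⁻ⁿ zero    = ℚ.positive⁻¹ 1ℚ
  0<2⁻ⁿ (suc n) = 0<half (0<2⁻ⁿ n)

  hⁿ : ℕ → Carrier
  hⁿ n = ι (2⁻ⁿ n)

  hⁿ-suc : ∀ n → hⁿ (suc n) ≈ 2⁻¹ * hⁿ n
  hⁿ-suc n = ι-* ½ (2⁻ⁿ n)

  0<hⁿ : ∀ n → 0# < hⁿ n
  0<hⁿ n = ι-pos (0<2⁻ⁿ n)

  hⁿ≤1 : ∀ n → hⁿ n ≤ 1#
  hⁿ≤1 zero    = ≤-reflexive ι-1
  hⁿ≤1 (suc n) = ≤-by (trans (+-congˡ (-‿cong (hⁿ-suc n)))
    (solve 1 (λ h → con 1ℚ :- con ½ :* h := con ½ :+ con ½ :* (con 1ℚ :- h))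
      refl (hⁿ n)))
    (+-nonneg (<⇒≤ 0<2⁻¹) (*-nonneg (<⇒≤ 0<2⁻¹) (0≤-difference (hⁿ≤1 n))))

  -- The estimate `n ≤ 2ⁿ`, in the form that turns the Archimedean property into convergence of `hⁿ`
  -- to zero: once `n ≥ C / ε`, it gives `C * hⁿ n ≤ ε`.
  ν*hⁿ≤1 : ∀ n → ν n * hⁿ n ≤ 1#
  ν*hⁿ≤1 zero    = ≤-trans
    (≤-reflexive (trans (*-congʳ ι-0) (zeroˡ (hⁿ 0)))) 0≤1
  ν*hⁿ≤1 (suc n) = ≤-by (trans (+-congˡ (-‿cong (*-cong (ν-suc n) (hⁿ-suc n))))
    (solve 2 (λ k h → con 1ℚ :- (con 1ℚ :+ k) :* (con ½ :* h) :=
        con ½ :* (con 1ℚ :- h) :+ con ½ :* (con 1ℚ :- k :* h)) refl (ν n) (hⁿ n)))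
    (+-nonneg (*-nonneg (<⇒≤ 0<2⁻¹) (0≤-difference (hⁿ≤1 n)))
              (*-nonneg (<⇒≤ 0<2⁻¹) (0≤-difference (ν*hⁿ≤1 n))))

  hⁿ-null : ∀ C → 0# ≤ C → ∀ ε → 0# < ε → ∃[ N ] ∀ n → N ℕ.≤ n → C * hⁿ n ≤ ε
  hⁿ-null C 0≤C ε 0<ε =
    let r , εr≈1 = reciprocal 0<ε
        0<r = reciprocal-pos 0<ε εr≈1
        N , Cr≤N = archimedean-ℕ (C * r)
    in N , λ n N≤n → *-cancelˡ-≤ 0<r (≤-resp-≈
      (solve 3 (λ C r h → (C :* r) :* h := r :* (C :* h)) refl C r (hⁿ n))
      (trans (sym εr≈1) (*-comm ε r))
      (≤-trans (*-mono-≤ (*-nonneg 0≤C (<⇒≤ 0<r)) (<⇒≤ (0<hⁿ n))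
                 (≤-trans Cr≤N (ν-mono-≤ N≤n)) ≤-refl)
               (ν*hⁿ≤1 n)))

  -- Limits of sequences

  infix 4 _⟶_
  _⟶_ : (ℕ → Carrier) → Carrier → Set
  s ⟶ l = ∀ ε → 0# < ε → ∃[ N ] ∀ n → N ℕ.≤ n → s n - l < ε × l - s n < ε

  ⟶⇒∣∣≤ : ∀ {s l} → s ⟶ l → ∀ ε → 0# < ε →
    ∃[ N ] ∀ n → N ℕ.≤ n → ∣ s n - l ∣≤ ε
  ⟶⇒∣∣≤ {s} {l} s⟶l ε 0<ε =
    let N , close = s⟶l ε 0<ε
    in N , λ n N≤n → let below , above = close n N≤n in <⇒≤ below ,
      ≤-resp-≈ (solve 2 (λ s l → l :- s := :- (s :- l)) refl (s n) l) refl (<⇒≤ above)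

  half< : ∀ {ε} → 0# < ε → 2⁻¹ * ε < ε
  half< {ε} 0<ε =
    <-by (solve 1 (λ e → e :- con ½ :* e := con ½ :* e) refl ε) (half 0<ε)

  ∣∣≤⇒⟶ : ∀ {s l} →
    (∀ ε → 0# < ε → ∃[ N ] ∀ n → N ℕ.≤ n → ∣ s n - l ∣≤ ε) → s ⟶ l
  ∣∣≤⇒⟶ {s} {l} h ε 0<ε =
    let N , close = h (2⁻¹ * ε) (half 0<ε)
    in N , λ n N≤n → let below , above = close n N≤n in
      ≤-<-trans below (half< 0<ε) ,
      ≤-<-trans (≤-resp-≈ (solve 2 (λ s l → :- (s :- l) := l :- s) refl (s n) l)
        refl above) (half< 0<ε)

  ⟶-≤ : ∀ {s l c} N → s ⟶ l → (∀ n → N ℕ.≤ n → s n ≤ c) → l ≤ c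
  ⟶-≤ {s} {l} {c} N s⟶l s≤c c<l =
    let M , close = s⟶l (l - c) (0<-difference c<l)
        n = N ℕ.⊔ M
    in s≤c n (ℕ.m≤m⊔n N M) (<-by
      (solve 3 (λ l c s → s :- c := (l :- c) :- (l :- s)) refl l c (s n))
      (0<-difference (proj₂ (close n (ℕ.m≤n⊔m N M)))))

  ⟶-≥ : ∀ {s l c} N → s ⟶ l → (∀ n → N ℕ.≤ n → c ≤ s n) → c ≤ l
  ⟶-≥ {s} {l} {c} N s⟶l c≤s l<c =
    let M , close = s⟶l (c - l) (0<-difference l<c)
        n = N ℕ.⊔ M
    in c≤s n (ℕ.m≤m⊔n N M) (<-by
      (solve 3 (λ l c s → c :- s := (c :- l) :- (s :- l)) refl l c (s n))
      (0<-difference (proj₁ (close n (ℕ.m≤n⊔m N M)))))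

  ⟶-+ : ∀ {s t l m} → s ⟶ l → t ⟶ m → (λ n → s n + t n) ⟶ l + m
  ⟶-+ {s} {t} {l} {m} s⟶l t⟶m = ∣∣≤⇒⟶ λ ε 0<ε →
    let M , closeM = ⟶⇒∣∣≤ s⟶l (2⁻¹ * ε) (half 0<ε)
        N , closeN = ⟶⇒∣∣≤ t⟶m (2⁻¹ * ε) (half 0<ε)
    in M ℕ.⊔ N , λ n p → ∣∣≤-resp-≈
      (solve 4 (λ s t l m → (s :- l) :+ (t :- m) := s :+ t :- (l :+ m))
        refl (s n) (t n) l m)
      (solve 1 (λ e → con ½ :* e :+ con ½ :* e := e) refl ε)
      (∣∣≤-+ (closeM n (ℕ.≤-trans (ℕ.m≤m⊔n M N) p))
             (closeN n (ℕ.≤-trans (ℕ.m≤n⊔m M N) p)))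

  ⟶-* : ∀ {s l} c → s ⟶ l → (λ n → c * s n) ⟶ c * l
  ⟶-* {s} {l} c s⟶l = ∣∣≤⇒⟶ λ ε 0<ε →
    let C , 0≤C , ∣c∣≤C = ∣∣≤-exists c
        0<1+C = pos+nonneg 0<1 0≤C
        r , Cr≈1 = reciprocal 0<1+C
        0<r = reciprocal-pos 0<1+C Cr≈1
        N , close = ⟶⇒∣∣≤ s⟶l (r * ε) (*-pos 0<r 0<ε)
    in N , λ n p → ∣∣≤-resp-≈
      (solve 3 (λ c s l → c :* (s :- l) := c :* s :- c :* l) refl c (s n) l)
      (trans (sym (*-assoc (1# + C) r ε)) (trans (*-congʳ Cr≈1) (*-identityˡ ε)))
      (∣∣≤-* (∣∣≤-weaken (≤-by (solve 1 (λ C → con 1ℚ :+ C :- C := con 1ℚ) refl C) 0≤1)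
               ∣c∣≤C) (close n p))

  ⟶-shift : ∀ k {s l} → s ⟶ l → (λ n → s (k ℕ.+ n)) ⟶ l
  ⟶-shift k s⟶l ε 0<ε =
    let N , close = s⟶l ε 0<ε
    in N , λ n N≤n → close (k ℕ.+ n) (ℕ.≤-trans N≤n (ℕ.m≤n+m n k))

  ⟶-unshift : ∀ k {s l} → (λ n → s (k ℕ.+ n)) ⟶ l → s ⟶ l
  ⟶-unshift k {s} {l} s⟶l ε 0<ε =
    let N , close = s⟶l ε 0<ε
    in k ℕ.+ N , λ n k+N≤n →
      ≡.subst (λ m → s m - l < ε × l - s m < ε)
        (ℕ.m+[n∸m]≡n (ℕ.≤-trans (ℕ.m≤m+n k N) k+N≤n))
        (close (n ℕ.∸ k) (≡.subst (ℕ._≤ n ℕ.∸ k) (ℕ.m+n∸m≡n k N)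
          (ℕ.∸-monoˡ-≤ k k+N≤n)))

  ⟶-unique : ∀ {s l m} → s ⟶ l → s ⟶ m → l ≈ m
  ⟶-unique {s} {l} {m} s⟶l s⟶m = ≤-antisym (le s⟶l s⟶m) (le s⟶m s⟶l)
    where
    le : ∀ {l m} → s ⟶ l → s ⟶ m → l ≤ m
    le {l} {m} s⟶l s⟶m = ≤-from-slack λ ε 0<ε →
      let N , close = s⟶m ε 0<ε
      in ⟶-≤ N s⟶l λ n N≤n → <⇒≤ (<-by
        (solve 3 (λ m e s → m :+ e :- s := e :- (s :- m)) refl m ε (s n))
        (0<-difference (proj₁ (close n N≤n))))

  ⟶-resp-≈ : ∀ {s t l m} → (∀ n → s n ≈ t n) → l ≈ m → s ⟶ l → t ⟶ m
  ⟶-resp-≈ s≈t l≈m s⟶l ε 0<ε =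
    let N , close = s⟶l ε 0<ε
    in N , λ n N≤n →
      <-resp-≈ (+-cong (s≈t n) (-‿cong l≈m)) refl (proj₁ (close n N≤n)) ,
      <-resp-≈ (+-cong l≈m (-‿cong (s≈t n))) refl (proj₂ (close n N≤n))

  -- Completeness is available for rational sequences, so `s n` is replaced by a rational `q n`
  -- within `2⁻ⁿ n` of it; the two sequences have the same limit.
  cauchy-converges : ∀ s →
    (∀ ε → 0# < ε → ∃[ N ] ∀ m n → N ℕ.≤ m → N ℕ.≤ n → ∣ s m - s n ∣≤ ε) →
    ∃[ l ] s ⟶ l
  cauchy-converges s s-cauchy = proj₁ limit , ∣∣≤⇒⟶ s-close
    where
    q : ℕ → ℚ
    q n = proj₁ (approximate (s n) (2⁻ⁿ n) (0<2⁻ⁿ n))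

    q-close : ∀ n → ∣ s n - ι (q n) ∣≤ hⁿ n
    q-close n = let _ , below , above = approximate (s n) (2⁻ⁿ n) (0<2⁻ⁿ n) in
      <⇒≤ below ,
      ≤-resp-≈ (solve 2 (λ s q → q :- s := :- (s :- q)) refl (s n) (ι (q n))) refl
        (<⇒≤ above)

    h-small : ∀ ε → 0# < ε → ∃[ N ] ∀ n → N ℕ.≤ n → hⁿ n ≤ ε
    h-small ε 0<ε = let N , small = hⁿ-null 1# 0≤1 ε 0<ε in
      N , λ n N≤n → ≤-resp-≈ (*-identityˡ (hⁿ n)) refl (small n N≤n)

    q-cauchy : IsCauchy q
    q-cauchy ε 0<ε =
      -- Three errors of a quarter of `ε` leave one quarter to spare, which supplies the strict
      -- inequality in `IsCauchy`.
      let η = 2⁻¹ * (2⁻¹ * ι ε)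
          0<η = half (half (ι-pos 0<ε))
          M , closeM = s-cauchy η 0<η
          N , closeN = h-small η 0<η
      in M ℕ.⊔ N , λ m n p r →
        let M≤m = ℕ.≤-trans (ℕ.m≤m⊔n M N) p
            N≤m = ℕ.≤-trans (ℕ.m≤n⊔m M N) p
            M≤n = ℕ.≤-trans (ℕ.m≤m⊔n M N) r
            N≤n = ℕ.≤-trans (ℕ.m≤n⊔m M N) r
            below , above = ∣∣≤-resp-≈
              (trans (solve 4 (λ s t q r →
                  (:- (s :- q) :+ (s :- t)) :+ (t :- r) := q :- r)
                  refl (s m) (s n) (ι (q m)) (ι (q n)))
                (sym (trans (ι-+ (q m) (ℚ.- q n)) (+-congˡ (ι-neg (q n))))))
              (solve 1 (λ e → let f = con ½ :* (con ½ :* e) in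
                  (f :+ f) :+ f := e :- f) refl (ι ε))
              (∣∣≤-+ (∣∣≤-+
                (∣∣≤-neg (∣∣≤-weaken (closeN m N≤m) (q-close m)))
                (closeM m n M≤m M≤n))
                (∣∣≤-weaken (closeN n N≤n) (q-close n)))
            strict = <-by (solve 2 (λ e f → e :- (e :- f) := f) refl (ι ε) η) 0<η
        in ∣∣<-intro (ι-cancel-< (≤-<-trans below strict))
             (ι-cancel-< (≤-<-trans (≤-resp-≈ (sym (ι-neg _)) refl above) strict))

    limit : ∃[ l ] ∀ ε → 0ℚ ℚ.< ε → ∃[ N ] ∀ n → N ℕ.≤ n →
      ι (q n) - l < ι ε × l - ι (q n) < ι ε
    limit = complete q q-cauchy

    s-close : ∀ ε → 0# < ε → ∃[ N ] ∀ n → N ℕ.≤ n → ∣ s n - proj₁ limit ∣≤ ε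
    s-close ε 0<ε =
      let δ , 0<δ , δ<ε = archimedean (half 0<ε)
          M , closeM = h-small (2⁻¹ * ε) (half 0<ε)
          N , closeN = proj₂ limit δ 0<δ
          l = proj₁ limit
      in M ℕ.⊔ N , λ n p →
        let below , above = closeN n (ℕ.≤-trans (ℕ.m≤n⊔m M N) p) in
        ∣∣≤-resp-≈
          (solve 3 (λ s q l → (s :- q) :+ (q :- l) := s :- l) refl (s n) (ι (q n)) l)
          (solve 1 (λ e → con ½ :* e :+ con ½ :* e := e) refl ε)
          (∣∣≤-+ (∣∣≤-weaken (closeM n (ℕ.≤-trans (ℕ.m≤m⊔n M N) p)) (q-close n))
            (∣∣≤-weaken (<⇒≤ δ<ε) (<⇒≤ below ,
              ≤-resp-≈ (solve 2 (λ q l → l :- q := :- (q :- l)) refl (ι (q n)) l) refl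
                (<⇒≤ above))))

  geometric-converges : ∀ s C → 0# ≤ C →
    (∀ n → ∣ s (suc n) - s n ∣≤ C * hⁿ n) → ∃[ l ] s ⟶ l
  geometric-converges s C 0≤C step = cauchy-converges s λ ε 0<ε →
    let N , small = hⁿ-null C4 0≤C4 ε 0<ε
    in N , λ m n N≤m N≤n → ∣∣≤-weaken (small N ℕ.≤-refl) (∣∣≤-resp-≈
      (solve 3 (λ a b c → (a :- c) :+ :- (b :- c) := a :- b) refl (s m) (s n) (s N))
      (solve 2 (λ C h → let D = C :+ C in D :* h :+ D :* h := (D :+ D) :* h)
        refl C (hⁿ N))
      (∣∣≤-+ (tail N≤m) (∣∣≤-neg (tail N≤n))))
    where
    C2 C4 : Carrier
    C2 = C + C
    C4 = C2 + C2
    0≤C2 : 0# ≤ C2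
    0≤C2 = +-nonneg 0≤C 0≤C
    0≤C4 : 0# ≤ C4
    0≤C4 = +-nonneg 0≤C2 0≤C2

    -- The exact value `2(hⁿ N - hⁿ n)` of the finite geometric sum is what the induction preserves;
    -- the cruder bound `2 * hⁿ N` of `tail` would not reproduce itself.
    tail′ : ∀ {N n} → N ℕ.≤′ n → ∣ s n - s N ∣≤ C2 * (hⁿ N - hⁿ n)
    tail′ {N} ℕ.≤′-refl = ∣∣≤-zero (-‿inverseʳ (s N)) (≤-reflexive
      (solve 2 (λ C h → con 0ℚ := (C :+ C) :* (h :- h)) refl C (hⁿ N)))
    tail′ {N} (ℕ.≤′-step {n} N≤n) = ∣∣≤-resp-≈
      (solve 3 (λ a b c → (a :- b) :+ (b :- c) := a :- c) refl (s (suc n)) (s n) (s N))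
      (trans (solve 3 (λ C h k → C :* k :+ (C :+ C) :* (h :- k) :=
          (C :+ C) :* (h :- con ½ :* k)) refl C (hⁿ N) (hⁿ n))
        (*-congˡ (+-congˡ (-‿cong (sym (hⁿ-suc n))))))
      (∣∣≤-+ (step n) (tail′ N≤n))

    tail : ∀ {N n} → N ℕ.≤ n → ∣ s n - s N ∣≤ C2 * hⁿ N
    tail {N} {n} N≤n = ∣∣≤-weaken
      (*-monoˡ-≤ 0≤C2 (≤-by (solve 2 (λ h k → h :- (h :- k) := k) refl (hⁿ N) (hⁿ n))
        (<⇒≤ (0<hⁿ n)))) (tail′ (ℕ.≤⇒≤′ N≤n))

  -- Cousin's lemma: the nested-intervals argument behind every passage from
  -- local to global information on [a, b].
  module _ (P : Carrier → Carrier → Set) {a b : Carrier}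
    (joins : ∀ {u m v} → a ≤ u → u ≤ m → m ≤ v → v ≤ b → P u m → P m v → P u v)
    where

    record Bad : Set where
      constructor bad
      field
        left right : Carrier
        a≤left     : a ≤ left
        left≤right : left ≤ right
        right≤b    : right ≤ b
        ¬P         : ¬ P left right

    open Bad

    width : Bad → Carrier
    width I = right I - left I

    bisect : (I : Bad) → ∃[ J ] (left I ≤ left J × right J ≤ right I ×
      width J ≈ 2⁻¹ * width I)
    bisect (bad u v a≤u u≤v v≤b ¬Puv) = split
      where
      m : Carrier
      m = 2⁻¹ * (u + v)
      u≤m : u ≤ m
      u≤m = ≤-by (solve 2 (λ u v → con ½ :* (u :+ v) :- u := con ½ :* (v :- u))
        refl u v) (*-nonneg (<⇒≤ 0<2⁻¹) (0≤-difference u≤v))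
      m≤v : m ≤ v
      m≤v = ≤-by (solve 2 (λ u v → v :- con ½ :* (u :+ v) := con ½ :* (v :- u))
        refl u v) (*-nonneg (<⇒≤ 0<2⁻¹) (0≤-difference u≤v))
      split : ∃[ J ] (u ≤ left J × right J ≤ v × width J ≈ 2⁻¹ * (v - u))
      split with em {P u m}
      ... | no ¬Pum = bad u m a≤u u≤m (≤-trans m≤v v≤b) ¬Pum , ≤-refl , m≤v ,
        solve 2 (λ u v → con ½ :* (u :+ v) :- u := con ½ :* (v :- u)) refl u v
      ... | yes Pum =
        bad m v (≤-trans a≤u u≤m) m≤v v≤b (λ Pmv → ¬Puv (joins a≤u u≤m m≤v v≤b Pum Pmv)) ,
        u≤m , ≤-refl ,
        solve 2 (λ u v → v :- con ½ :* (u :+ v) := con ½ :* (v :- u)) refl u v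

    nested : Bad → ℕ → Bad
    nested I zero    = I
    nested I (suc n) = proj₁ (bisect (nested I n))

    width-nested : ∀ I n → width (nested I n) ≈ width I * hⁿ n
    width-nested I zero    = sym (trans (*-congˡ ι-1) (*-identityʳ (width I)))
    width-nested I (suc n) = begin
      width (nested I (suc n))    ≈⟨ proj₂ (proj₂ (proj₂ (bisect (nested I n)))) ⟩
      2⁻¹ * width (nested I n)    ≈⟨ *-congˡ (width-nested I n) ⟩
      2⁻¹ * (width I * hⁿ n)
        ≈⟨ solve 2 (λ w h → con ½ :* (w :* h) := w :* (con ½ :* h)) refl (width I) (hⁿ n) ⟩
      width I * (2⁻¹ * hⁿ n)      ≈⟨ *-congˡ (hⁿ-suc n) ⟨
      width I * hⁿ (suc n)        ∎

    lefts-increase : ∀ I {m n} → m ℕ.≤′ n → left (nested I m) ≤ left (nested I n)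
    lefts-increase I ℕ.≤′-refl           = ≤-refl
    lefts-increase I (ℕ.≤′-step {n} m≤n) =
      ≤-trans (lefts-increase I m≤n) (proj₁ (proj₂ (bisect (nested I n))))

    rights-decrease : ∀ I {m n} → m ℕ.≤′ n → right (nested I n) ≤ right (nested I m)
    rights-decrease I ℕ.≤′-refl           = ≤-refl
    rights-decrease I (ℕ.≤′-step {n} m≤n) =
      ≤-trans (proj₁ (proj₂ (proj₂ (bisect (nested I n))))) (rights-decrease I m≤n)

    left-step : ∀ I n →
      ∣ left (nested I (suc n)) - left (nested I n) ∣≤ width I * hⁿ n
    left-step I n = ∣∣≤-weaken
      (≤-trans (≤-by (solve 3 (λ l m r → (r :- l) :- (m :- l) := r :- m) refl
          (left J) (left J′) (right J))
        (0≤-difference (≤-trans (left≤right J′) (proj₁ (proj₂ (proj₂ (bisect J)))))))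
        (≤-reflexive (width-nested I n)))
      (∣∣≤-self (0≤-difference (proj₁ (proj₂ (bisect J)))))
      where
      J J′ : Bad
      J  = nested I n
      J′ = nested I (suc n)

    -- If `P a b` fails, the left ends of the bisected bad intervals converge to a point `c` lying
    -- in all of them. As soon as their width is at most the `δ` belonging to `c`, `local` declares
    -- such an interval good.
    cousin : a ≤ b →
      (∀ c → a ≤ c → c ≤ b → ∃[ δ ] 0# < δ × ∀ {u v} →
        a ≤ u → u ≤ c → c ≤ v → v ≤ b → v - u ≤ δ → P u v) →
      P a b
    cousin a≤b local with em {P a b}
    ... | yes Pab = Pab
    ... | no ¬Pab =
      let I = bad a b ≤-refl a≤b ≤-refl ¬Pab
          c , ⟶c = geometric-converges (λ n → left (nested I n)) (width I)
            (0≤-difference a≤b) (left-step I)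
          lefts≤c : ∀ n → left (nested I n) ≤ c
          lefts≤c n = ⟶-≥ n ⟶c (λ m n≤m → lefts-increase I (ℕ.≤⇒≤′ n≤m))
          c≤rights : ∀ n → c ≤ right (nested I n)
          c≤rights n = ⟶-≤ n ⟶c (λ m n≤m →
            ≤-trans (left≤right (nested I m)) (rights-decrease I (ℕ.≤⇒≤′ n≤m)))
          δ , 0<δ , P-near = local c (lefts≤c 0) (c≤rights 0)
          n , small = hⁿ-null (width I) (0≤-difference a≤b) δ 0<δ
          J = nested I n
      in contradiction
           (P-near (a≤left J) (lefts≤c n) (c≤rights n) (right≤b J)
             (≤-trans (≤-reflexive (width-nested I n)) (small n ℕ.≤-refl)))
           (¬P J)

  -- Differential calculus

  -- A quadratic error term makes the calculus free of ε's; every function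
  -- needed below is twice continuously differentiable.
  record HasDerivative (f : Carrier → Carrier) (y a : Carrier) : Set where
    field
      error radius : Carrier
      0≤error      : 0# ≤ error
      0<radius     : 0# < radius
      expansion    : ∀ {x e} → e ≤ radius → ∣ x - y ∣≤ e →
        ∣ (f x - f y) - a * (x - y) ∣≤ error * (e * e)

  open HasDerivative

  Differentiable : (Carrier → Carrier) → Carrier → Set
  Differentiable f y = ∃ (HasDerivative f y)

  -- Within the radius, the quadratic error is at most `error * radius * e`, so it joins the linear
  -- term in a bound linear in `e`.
  lipschitz : ∀ {f y a} (D : HasDerivative f y a) →
    ∃[ C ] 0# ≤ C × (∀ {x e} → e ≤ radius D → ∣ x - y ∣≤ e → ∣ f x - f y ∣≤ C * e)
  lipschitz {f} {y} {a} D =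
    let A , 0≤A , ∣a∣≤A = ∣∣≤-exists a
    in A + error D * radius D ,
       +-nonneg 0≤A (*-nonneg (0≤error D) (<⇒≤ (0<radius D))) ,
       λ {x} {e} e≤δ near →
         let 0≤e = ∣∣≤-nonneg near in
         ∣∣≤-weaken (≤-by
           (solve 4 (λ A M r e →
             (A :+ M :* r) :* e :- (A :* e :+ M :* (e :* e)) := M :* ((r :- e) :* e))
             refl A (error D) (radius D) e)
           (*-nonneg (0≤error D) (*-nonneg (0≤-difference e≤δ) 0≤e)))
         (∣∣≤-resp-≈
           (solve 3 (λ u v z → z :+ ((u :- v) :- z) := u :- v) refl
             (f x) (f y) (a * (x - y))) refl
           (∣∣≤-+ (∣∣≤-* ∣a∣≤A near) (expansion D e≤δ near)))

  -- A function on representatives may fail to respect `≈`. Differentiability at `y` forces it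
  -- there: the Lipschitz bound with `e = 0` makes the increment vanish.
  derivative-cong : ∀ {f y a} → HasDerivative f y a → ∀ {x} → x ≈ y → f x ≈ f y
  derivative-cong {f} {y} D {x} x≈y =
    let C , _ , lip = lipschitz D
    in difference≈0⇒≈ (∣∣≤0⇒≈0 (∣∣≤-resp-≈ refl (zeroʳ C)
         (lip (<⇒≤ (0<radius D)) (∣∣≤-zero (≈⇒difference≈0 x≈y) ≤-refl))))

  derivative-resp-≈ : ∀ {f g y a b} → (∀ x → f x ≈ g x) → a ≈ b →
    HasDerivative f y a → HasDerivative g y b
  derivative-resp-≈ {y = y} f≈g a≈b D = record
    { error = error D ; radius = radius D
    ; 0≤error = 0≤error D ; 0<radius = 0<radius D
    ; expansion = λ {x} e≤δ near → ∣∣≤-resp-≈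
        (+-cong (+-cong (f≈g x) (-‿cong (f≈g y))) (-‿cong (*-congʳ a≈b))) refl
        (expansion D e≤δ near)
    }

  derivative-const : ∀ c y → HasDerivative (λ _ → c) y 0#
  derivative-const c y = record
    { error = 0# ; radius = 1# ; 0≤error = ≤-refl ; 0<radius = 0<1
    ; expansion = λ {x} {e} _ _ → ∣∣≤-zero
        (solve 3 (λ c x y → (c :- c) :- con 0ℚ :* (x :- y) := con 0ℚ) refl c x y)
        (0≤-≈ (sym (zeroˡ (e * e))) ≤-refl)
    }

  derivative-id : ∀ y → HasDerivative (λ x → x) y 1#
  derivative-id y = record
    { error = 0# ; radius = 1# ; 0≤error = ≤-refl ; 0<radius = 0<1
    ; expansion = λ {x} {e} _ _ → ∣∣≤-zero
        (solve 2 (λ x y → (x :- y) :- con 1ℚ :* (x :- y) := con 0ℚ) refl x y)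
        (0≤-≈ (sym (zeroˡ (e * e))) ≤-refl)
    }

  derivative-+ : ∀ {f g y a b} → HasDerivative f y a → HasDerivative g y b →
    HasDerivative (λ x → f x + g x) y (a + b)
  derivative-+ {f} {g} {y} {a} {b} D E =
    let δ , 0<δ , δ≤D , δ≤E = minimum (0<radius D) (0<radius E)
    in record
    { error = error D + error E ; radius = δ
    ; 0≤error = +-nonneg (0≤error D) (0≤error E) ; 0<radius = 0<δ
    ; expansion = λ {x} {e} e≤δ near → ∣∣≤-resp-≈
        (solve 7 (λ f f′ g g′ a b h →
          ((f :- f′) :- a :* h) :+ ((g :- g′) :- b :* h) :=
          ((f :+ g) :- (f′ :+ g′)) :- (a :+ b) :* h) refl
          (f x) (f y) (g x) (g y) a b (x - y))
        (sym (distribʳ (e * e) (error D) (error E)))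
        (∣∣≤-+ (expansion D (≤-trans e≤δ δ≤D) near) (expansion E (≤-trans e≤δ δ≤E) near))
    }

  -- The error is `f y` times the error of `g`, plus `g y` times the error of `f`, plus the product
  -- of the two increments; the last is quadratic because both factors are bounded by `lipschitz`.
  derivative-* : ∀ {f g y a b} → HasDerivative f y a → HasDerivative g y b →
    HasDerivative (λ x → f x * g x) y (a * g y + f y * b)
  derivative-* {f} {g} {y} {a} {b} D E =
    let δ , 0<δ , δ≤D , δ≤E = minimum (0<radius D) (0<radius E)
        F , 0≤F , ∣f∣≤F = ∣∣≤-exists (f y)
        G , 0≤G , ∣g∣≤G = ∣∣≤-exists (g y)
        A , 0≤A , lip-f = lipschitz D
        B , 0≤B , lip-g = lipschitz E
    in record
    { error = (F * error E + G * error D) + A * B ; radius = δ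
    ; 0≤error = +-nonneg
        (+-nonneg (*-nonneg 0≤F (0≤error E)) (*-nonneg 0≤G (0≤error D)))
        (*-nonneg 0≤A 0≤B)
    ; 0<radius = 0<δ
    ; expansion = λ {x} {e} e≤δ near →
        let e≤D = ≤-trans e≤δ δ≤D
            e≤E = ≤-trans e≤δ δ≤E
        in ∣∣≤-resp-≈
        (solve 7 (λ f f′ g g′ a b h →
          (f′ :* ((g :- g′) :- b :* h) :+ g′ :* ((f :- f′) :- a :* h))
            :+ (f :- f′) :* (g :- g′) :=
          (f :* g :- f′ :* g′) :- (a :* g′ :+ f′ :* b) :* h) refl
          (f x) (f y) (g x) (g y) a b (x - y))
        (solve 7 (λ F G M N A B e →
          (F :* (M :* (e :* e)) :+ G :* (N :* (e :* e))) :+ (A :* e) :* (B :* e) :=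
          ((F :* M :+ G :* N) :+ A :* B) :* (e :* e)) refl
          F G (error E) (error D) A B e)
        (∣∣≤-+ (∣∣≤-+ (∣∣≤-* ∣f∣≤F (expansion E e≤E near))
                      (∣∣≤-* ∣g∣≤G (expansion D e≤D near)))
               (∣∣≤-* (lip-f e≤D near) (lip-g e≤E near)))
    }

  derivative-scale : ∀ {f y a} c → HasDerivative f y a →
    HasDerivative (λ x → c * f x) y (c * a)
  derivative-scale {f} {y} {a} c D = derivative-resp-≈ (λ _ → refl)
    (solve 3 (λ c a v → con 0ℚ :* v :+ c :* a := c :* a) refl c a (f y))
    (derivative-* (derivative-const c y) D)

  derivative-neg : ∀ {f y a} → HasDerivative f y a → HasDerivative (λ x → - f x) y (- a)
  derivative-neg {f} {a = a} D = derivative-resp-≈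
    (λ x → solve 1 (λ v → :- con 1ℚ :* v := :- v) refl (f x))
    (solve 1 (λ v → :- con 1ℚ :* v := :- v) refl a)
    (derivative-scale (- 1#) D)

  derivative-reflect : ∀ {f y a} c → HasDerivative f (c - y) a →
    HasDerivative (λ x → f (c - x)) y (- a)
  derivative-reflect {f} {y} {a} c D = record
    { error = error D ; radius = radius D
    ; 0≤error = 0≤error D ; 0<radius = 0<radius D
    ; expansion = λ {x} {e} e≤δ near → ∣∣≤-resp-≈
        (solve 6 (λ c x y a u v →
          (u :- v) :- a :* ((c :- x) :- (c :- y)) := (u :- v) :- (:- a) :* (x :- y))
          refl c x y a (f (c - x)) (f (c - y)))
        refl
        (expansion D e≤δ (∣∣≤-resp-≈
          (solve 3 (λ c x y → :- (x :- y) := (c :- x) :- (c :- y)) refl c x y) refl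
          (∣∣≤-neg near)))
    }

  derivative-sum : ∀ {n} (f : Fin n → Carrier → Carrier) (a : Fin n → Carrier) {y} →
    (∀ i → HasDerivative (f i) y (a i)) →
    HasDerivative (λ x → sum λ i → f i x) y (sum a)
  derivative-sum {zero}  f a {y} D = derivative-const 0# y
  derivative-sum {suc n} f a     D =
    derivative-+ (D zero) (derivative-sum (λ i → f (suc i)) (λ i → a (suc i)) λ i → D (suc i))

  scaled-below : ∀ {C v} → 0# ≤ C → 0# < v → ∃[ δ ] 0# < δ × C * δ < v
  scaled-below {C} {v} 0≤C 0<v =
    -- Dividing `v` by `1 + C` rather than by `C` covers `C ≈ 0`, and makes `v - C * δ` equal to `δ`
    -- itself.
    let 0<1+C = pos+nonneg 0<1 0≤C
        r , Cr≈1 = reciprocal 0<1+C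
        0<δ = *-pos (reciprocal-pos 0<1+C Cr≈1) 0<v
    in r * v , 0<δ , <-by (begin
         v - C * (r * v)                 ≈⟨ +-congʳ (*-identityˡ v) ⟨
         1# * v - C * (r * v)            ≈⟨ +-congʳ (*-congʳ Cr≈1) ⟨
         (1# + C) * r * v - C * (r * v)
           ≈⟨ solve 3 (λ C r v → (con 1ℚ :+ C) :* r :* v :- C :* (r :* v) := r :* v)
                refl C r v ⟩
         r * v                           ∎) 0<δ

  positive-nearby : ∀ {f c} → Differentiable f c → 0# < f c →
    ∃[ δ ] 0# < δ × ∀ {x} → ∣ x - c ∣≤ δ → 0# < f x
  positive-nearby {f} {c} (_ , D) 0<fc =
    let C , 0≤C , lip = lipschitz D
        δ₁ , 0<δ₁ , Cδ₁<fc = scaled-below 0≤C 0<fc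
        δ , 0<δ , δ≤D , δ≤δ₁ = minimum (0<radius D) 0<δ₁
    in δ , 0<δ , λ {x} near → <-resp-≈ refl
      (solve 3 (λ a b e → (b :- e) :+ (e :+ (a :- b)) := a) refl (f x) (f c) (C * δ))
      (pos+nonneg (0<-difference (≤-<-trans (*-monoˡ-≤ 0≤C δ≤δ₁) Cδ₁<fc))
                  (∣∣≤-upper (lip δ≤D near)))

  -- Over a distance `k` on either side, the gain of `f` is at least `k * (a - error * k)`, which is
  -- positive once `δ` is chosen with `error * δ < a`.
  increasing-nearby : ∀ {f c a} → HasDerivative f c a → 0# < a →
    ∃[ δ ] 0# < δ × (∀ {x} → c < x → x - c ≤ δ → f c < f x) ×
                    (∀ {x} → x < c → c - x ≤ δ → f x < f c)
  increasing-nearby {f} {c} {a} D 0<a =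
    let δ₁ , 0<δ₁ , Mδ₁<a = scaled-below (0≤error D) 0<a
        δ , 0<δ , δ≤D , δ≤δ₁ = minimum (0<radius D) 0<δ₁
        slope : ∀ {k} → k ≤ δ → 0# < a - error D * k
        slope k≤δ = 0<-difference
          (≤-<-trans (*-monoˡ-≤ (0≤error D) (≤-trans k≤δ δ≤δ₁)) Mδ₁<a)
    in δ , 0<δ ,
       (λ {x} c<x k≤δ → let 0<k = 0<-difference c<x in <-by
         (solve 5 (λ u v a M k → u :- v :=
           k :* (a :- M :* k) :+ (M :* (k :* k) :+ ((u :- v) :- a :* k)))
           refl (f x) (f c) a (error D) (x - c))
         (pos+nonneg (*-pos 0<k (slope k≤δ))
           (∣∣≤-upper (expansion D (≤-trans k≤δ δ≤D) (∣∣≤-self (<⇒≤ 0<k)))))) ,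
       (λ {x} x<c k≤δ → let 0<k = 0<-difference x<c in <-by
         (solve 6 (λ u v a M x c → let k = c :- x in v :- u :=
           k :* (a :- M :* k) :+ (M :* (k :* k) :- ((u :- v) :- a :* (x :- c))))
           refl (f x) (f c) a (error D) x c)
         (pos+nonneg (*-pos 0<k (slope k≤δ))
           (∣∣≤-lower (expansion D (≤-trans k≤δ δ≤D) (∣∣≤-resp-≈
             (solve 2 (λ x c → :- (c :- x) := x :- c) refl x c) refl
             (∣∣≤-neg (∣∣≤-self (<⇒≤ 0<k))))))))

  ∣∣≤-between : ∀ {u c v x e} → u ≤ c → c ≤ v → u ≤ x → x ≤ v → v - u ≤ e →
    ∣ x - c ∣≤ e
  ∣∣≤-between {u} {c} {v} {x} {e} u≤c c≤v u≤x x≤v v-u≤e =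
    ≤-by (solve 5 (λ u c v x e →
        e :- (x :- c) := ((e :- (v :- u)) :+ (v :- x)) :+ (c :- u)) refl u c v x e)
      (+-nonneg (+-nonneg (0≤-difference v-u≤e) (0≤-difference x≤v)) (0≤-difference u≤c)) ,
    ≤-by (solve 5 (λ u c v x e →
        e :- :- (x :- c) := ((e :- (v :- u)) :+ (v :- c)) :+ (x :- u)) refl u c v x e)
      (+-nonneg (+-nonneg (0≤-difference v-u≤e) (0≤-difference c≤v)) (0≤-difference u≤x))

  -- Cousin's lemma for the implication from positivity at the left end to positivity at the right
  -- end. Implications compose, and near each point `f` keeps its nonzero sign: a positive one
  -- proves the conclusion, a negative one refutes the premise.
  nonvanishing⇒positive : ∀ {f a b} → a ≤ b →
    (∀ c → a ≤ c → c ≤ b → Differentiable f c) →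
    (∀ c → a ≤ c → c ≤ b → ¬ f c ≈ 0#) → 0# < f a → 0# < f b
  nonvanishing⇒positive {f} {a} {b} a≤b diff f≉0 =
    cousin (λ u v → 0# < f u → 0# < f v) (λ _ _ _ _ Pum Pmv 0<fu → Pmv (Pum 0<fu)) a≤b local
    where
    local : ∀ c → a ≤ c → c ≤ b → ∃[ δ ] 0# < δ × ∀ {u v} →
      a ≤ u → u ≤ c → c ≤ v → v ≤ b → v - u ≤ δ → 0# < f u → 0# < f v
    local c a≤c c≤b with <-cmp 0# (f c)
    ... | inj₁ 0<fc =
      let δ , 0<δ , pos = positive-nearby (diff c a≤c c≤b) 0<fc
      in δ , 0<δ , λ _ u≤c c≤v _ small _ →
           pos (∣∣≤-between u≤c c≤v (≤-trans u≤c c≤v) ≤-refl small)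
    ... | inj₂ (inj₁ 0≈fc) = contradiction (sym 0≈fc) (f≉0 c a≤c c≤b)
    ... | inj₂ (inj₂ fc<0) =
      let a′ , D = diff c a≤c c≤b
          δ , 0<δ , pos = positive-nearby (- a′ , derivative-neg D) (neg-pos fc<0)
      in δ , 0<δ , λ {u} _ u≤c c≤v _ small 0<fu → contradiction
           (+-pos 0<fu (pos (∣∣≤-between u≤c c≤v ≤-refl (≤-trans u≤c c≤v) small)))
           (≤-reflexive (-‿inverseʳ (f u)))

  intermediate-value : ∀ {f a b} → a ≤ b →
    (∀ c → a ≤ c → c ≤ b → Differentiable f c) →
    0# < f a → f b < 0# → ∃[ c ] f c ≈ 0#
  intermediate-value {f} a≤b diff 0<fa fb<0 with em {∃[ c ] f c ≈ 0#}
  ... | yes zero-exists = zero-exists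
  ... | no  no-zero     = contradiction fb<0
    (<⇒≤ (nonvanishing⇒positive a≤b diff (λ c _ _ fc≈0 → no-zero (c , fc≈0)) 0<fa))

  -- For each slope `η > 0`, the bound `η * (v - u)` on the increment of `f` adds up over adjacent
  -- intervals. It holds locally because the quadratic error is eventually below `η` times the
  -- length; comparing both ends with the point `c` between them loses nothing, as the two lengths
  -- sum to `v - u`. Finally `η` is made small.
  zero-derivative⇒constant : ∀ {f} → (∀ y → HasDerivative f y 0#) → ∀ a b → f a ≈ f b
  zero-derivative⇒constant {f} D a b =
    [ (λ a≤b → sym (constant-≤ a≤b)) , constant-≤ ]′ (≤-total a b)
    where
    constant-≤ : ∀ {a b} → a ≤ b → f b ≈ f a
    constant-≤ {a} {b} a≤b = ≤-antisym
      (≤-from-slack λ ε 0<ε → ≤-by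
        (solve 3 (λ u v e → (u :+ e) :- v := e :- (v :- u)) refl (f a) (f b) ε)
        (∣∣≤-lower (close ε 0<ε)))
      (≤-from-slack λ ε 0<ε → ≤-by
        (solve 3 (λ u v e → (v :+ e) :- u := e :+ (v :- u)) refl (f a) (f b) ε)
        (∣∣≤-upper (close ε 0<ε)))
      where
      close : ∀ ε → 0# < ε → ∣ f b - f a ∣≤ ε
      close ε 0<ε =
        let η , 0<η , wη<ε = scaled-below (0≤-difference a≤b) 0<ε
        in ∣∣≤-weaken (≤-trans (≤-reflexive (*-comm η (b - a))) (<⇒≤ wη<ε))
          (cousin (λ u v → ∣ f v - f u ∣≤ η * (v - u))
            (λ {u} {m} {v} _ _ _ _ um mv → ∣∣≤-resp-≈
              (solve 3 (λ x y z → (z :- y) :+ (y :- x) := z :- x) refl (f u) (f m) (f v))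
              (solve 4 (λ e x y z → e :* (z :- y) :+ e :* (y :- x) := e :* (z :- x))
                refl η u m v)
              (∣∣≤-+ mv um))
            a≤b (local η 0<η))
        where
        local : ∀ η → 0# < η → ∀ c → a ≤ c → c ≤ b → ∃[ δ ] 0# < δ × ∀ {u v} →
          a ≤ u → u ≤ c → c ≤ v → v ≤ b → v - u ≤ δ → ∣ f v - f u ∣≤ η * (v - u)
        local η 0<η c _ _ =
          let M = error (D c)
              δ₁ , 0<δ₁ , Mδ₁<η = scaled-below (0≤error (D c)) 0<η
              δ , 0<δ , δ≤D , δ≤δ₁ = minimum (0<radius (D c)) 0<δ₁
              one-sided : ∀ {x k} → ∣ x - c ∣≤ k → k ≤ δ → ∣ f x - f c ∣≤ η * k
              one-sided {x} {k} near k≤δ = ∣∣≤-weaken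
                (≤-by (solve 4 (λ e M k d →
                    e :* k :- M :* (k :* k) := ((e :- M :* d) :+ M :* (d :- k)) :* k)
                    refl η M k δ₁)
                  (*-nonneg (+-nonneg (0≤-difference (<⇒≤ Mδ₁<η))
                    (*-nonneg (0≤error (D c)) (0≤-difference (≤-trans k≤δ δ≤δ₁))))
                    (∣∣≤-nonneg near)))
                (∣∣≤-resp-≈ (solve 3 (λ z x y → z :- con 0ℚ :* (x :- y) := z) refl
                    (f x - f c) x c) refl
                  (expansion (D c) (≤-trans k≤δ δ≤D) near))
          in δ , 0<δ , λ {u} {v} _ u≤c c≤v _ small → ∣∣≤-resp-≈
            (solve 3 (λ x y z → (z :- y) :+ :- (x :- y) := z :- x) refl (f u) (f c) (f v))
            (solve 4 (λ e x y z → e :* (z :- y) :+ e :* (y :- x) := e :* (z :- x))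
              refl η u c v)
            (∣∣≤-+
              (one-sided (∣∣≤-self (0≤-difference c≤v))
                (≤-trans (≤-by (solve 3 (λ u c v → (v :- u) :- (v :- c) := c :- u)
                  refl u c v) (0≤-difference u≤c)) small))
              (∣∣≤-neg (one-sided
                (∣∣≤-resp-≈ (solve 2 (λ u c → :- (c :- u) := u :- c) refl u c) refl
                  (∣∣≤-neg (∣∣≤-self (0≤-difference u≤c))))
                (≤-trans (≤-by (solve 3 (λ u c v → (v :- u) :- (c :- u) := v :- c)
                  refl u c v) (0≤-difference c≤v)) small))))

  -- Rolle's theorem for quotients

  Inside : Carrier → Carrier → Carrier → Set
  Inside a b c = a ≤ c × c ≤ b

  module _ (H G Z : Carrier → Carrier) where

    -- The Wronskian h G - H g, which is G² times the derivative of H / G, has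
    -- the sign of Z.
    record WronskianSign (c : Carrier) : Set where
      field
        {h g r s} : Carrier
        H′        : HasDerivative H c h
        G′        : HasDerivative G c g
        0<r       : 0# < r
        0<s       : 0# < s
        wronskian : r * (h * G c - H c * g) ≈ s * Z c

    open WronskianSign

    -- Strict increase of `H / G`, cleared of denominators. The function `G c * H - H c * G`
    -- vanishes at `c` and has positive derivative there, which compares `c` with its neighbours;
    -- transitivity of `⊏` carries the comparison through `c`. The property given to `cousin` is
    -- guarded by `u < v` because degenerate intervals occur there too.
    quotient-increasing : ∀ {a b} → a < b → (∀ {c} → Inside a b c → 0# < G c) →
      (∀ {c} → Inside a b c → 0# < Z c) → (∀ {c} → Inside a b c → WronskianSign c) →
      H a * G b < H b * G a
    quotient-increasing {a} {b} a<b 0<G 0<Z W = cousin (λ u v → u < v → u ⊏ v)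
      (λ a≤u u≤m m≤v v≤b → chain (a≤u , ≤-trans u≤m (≤-trans m≤v v≤b))
        (≤-trans a≤u u≤m , ≤-trans m≤v v≤b) (≤-trans a≤u (≤-trans u≤m m≤v) , v≤b)
        u≤m m≤v)
      (<⇒≤ a<b) local a<b
      where
      infix 4 _⊏_
      _⊏_ : Carrier → Carrier → Set
      u ⊏ v = H u * G v < H v * G u

      ⊏-resp-≈ : ∀ {u u′ v v′} → Inside a b u → Inside a b v → u′ ≈ u → v′ ≈ v →
        u ⊏ v → u′ ⊏ v′
      ⊏-resp-≈ iu iv p q = <-resp-≈
        (*-cong (sym (derivative-cong (H′ (W iu)) p)) (sym (derivative-cong (G′ (W iv)) q)))
        (*-cong (sym (derivative-cong (H′ (W iv)) q)) (sym (derivative-cong (G′ (W iu)) p)))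

      ⊏-trans : ∀ {u m v} → Inside a b u → Inside a b m → Inside a b v → u ⊏ m → m ⊏ v → u ⊏ v
      ⊏-trans {u} {m} {v} iu im iv u⊏m m⊏v = *-cancelˡ-< (0<G im) (<-trans
        (<-resp-≈
          (solve 3 (λ x y z → z :* (x :* y) := y :* (x :* z)) refl (H u) (G m) (G v))
          (solve 3 (λ x y z → z :* (x :* y) := y :* (x :* z)) refl (H m) (G u) (G v))
          (*-monoˡ-< (0<G iv) u⊏m))
        (<-resp-≈ refl
          (solve 3 (λ x y z → z :* (x :* y) := y :* (x :* z)) refl (H v) (G m) (G u))
          (*-monoˡ-< (0<G iu) m⊏v)))

      chain : ∀ {u m v} → Inside a b u → Inside a b m → Inside a b v → u ≤ m → m ≤ v →
        (u < m → u ⊏ m) → (m < v → m ⊏ v) → u < v → u ⊏ v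
      chain {u} {m} {v} iu im iv u≤m m≤v um mv u<v with <-cmp u m | <-cmp m v
      ... | inj₁ u<m        | inj₁ m<v        = ⊏-trans iu im iv (um u<m) (mv m<v)
      ... | inj₁ u<m        | inj₂ (inj₁ m≈v) = ⊏-resp-≈ iu im refl (sym m≈v) (um u<m)
      ... | inj₂ (inj₁ u≈m) | _               =
        ⊏-resp-≈ im iv u≈m refl (mv (<-resp-≈ u≈m refl u<v))
      ... | inj₂ (inj₂ m<u) | _               = contradiction m<u u≤m
      ... | _               | inj₂ (inj₂ v<m) = contradiction v<m m≤v

      local : ∀ c → a ≤ c → c ≤ b → ∃[ δ ] 0# < δ × ∀ {u v} →
        a ≤ u → u ≤ c → c ≤ v → v ≤ b → v - u ≤ δ → u < v → u ⊏ v
      local c a≤c c≤b =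
        let ic = a≤c , c≤b
            w = W ic
            0<W = *-cancelˡ-< (0<r w) (<-resp-≈ (sym (zeroʳ (r w))) (sym (wronskian w))
              (*-pos (0<s w) (0<Z ic)))
            D = derivative-+ (derivative-scale (G c) (H′ w))
                             (derivative-scale (- H c) (G′ w))
            δ , 0<δ , above , below = increasing-nearby D (<-resp-≈ refl
              (solve 4 (λ h g H G → h :* G :- H :* g := G :* h :+ (:- H) :* g)
                refl (h w) (g w) (H c) (G c)) 0<W)
            at-c : G c * H c + - H c * G c ≈ 0#
            at-c = solve 2 (λ H G → G :* H :+ (:- H) :* G := con 0ℚ) refl (H c) (G c)
        in δ , 0<δ , λ {u} {v} a≤u u≤c c≤v v≤b small →
          chain (a≤u , ≤-trans u≤c c≤b) ic (≤-trans a≤c c≤v , v≤b) u≤c c≤v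
          (λ u<c → <-by
            (solve 4 (λ H G h g → H :* g :- h :* G :=
               con 0ℚ :- (G :* h :+ (:- H) :* g)) refl (H c) (G c) (H u) (G u))
            (0<-difference (<-resp-≈ refl at-c (below u<c
              (≤-trans (≤-by (solve 3 (λ u c v → (v :- u) :- (c :- u) := v :- c)
                  refl u c v) (0≤-difference c≤v)) small)))))
          (λ c<v → <-by
            (solve 4 (λ H G h g → h :* G :- H :* g :=
               (G :* h :+ (:- H) :* g) :- con 0ℚ) refl (H c) (G c) (H v) (G v))
            (0<-difference (<-resp-≈ at-c refl (above c<v
              (≤-trans (≤-by (solve 3 (λ u c v → (v :- u) :- (v :- c) := c :- u)
                  refl u c v) (0≤-difference u≤c)) small)))))

  -- If `Z` had no zero, it would keep one sign on the interval and `H / G` would be strictly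
  -- monotone, although it vanishes at both ends. The negative sign is reduced to the positive one
  -- by negating `H` and `Z`. A zero at an endpoint is allowed, which `separated⇒finite` tolerates.
  rolle : ∀ H G Z {a b} → a < b → H a ≈ 0# → H b ≈ 0# →
    (∀ {c} → Inside a b c → 0# < G c) →
    (∀ {c} → Inside a b c → Differentiable Z c) →
    (∀ {c} → Inside a b c → WronskianSign H G Z c) →
    ∃[ c ] a ≤ c × c ≤ b × Z c ≈ 0#
  rolle H G Z {a} {b} a<b Ha≈0 Hb≈0 0<G Z′ W
    with em {∃[ c ] a ≤ c × c ≤ b × Z c ≈ 0#}
  ... | yes found = found
  ... | no  none  = contradiction (sign (<-cmp 0# (Z a))) λ ()
    where
    open WronskianSign

    Z≉0 : ∀ c → a ≤ c → c ≤ b → ¬ Z c ≈ 0#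
    Z≉0 c a≤c c≤b Zc≈0 = none (c , a≤c , c≤b , Zc≈0)

    sign : 0# < Z a ⊎ 0# ≈ Z a ⊎ Z a < 0# → ⊥
    sign (inj₁ 0<Za) = <-irrefl (<-resp-≈
      (trans (*-congʳ Ha≈0) (zeroˡ (G b))) (trans (*-congʳ Hb≈0) (zeroˡ (G a)))
      (quotient-increasing H G Z a<b 0<G
        (λ { {c} (a≤c , c≤b) → nonvanishing⇒positive a≤c
          (λ x a≤x x≤c → Z′ (a≤x , ≤-trans x≤c c≤b))
          (λ x a≤x x≤c → Z≉0 x a≤x (≤-trans x≤c c≤b)) 0<Za }) W))
    sign (inj₂ (inj₁ 0≈Za)) = Z≉0 a ≤-refl (<⇒≤ a<b) (sym 0≈Za)
    sign (inj₂ (inj₂ Za<0)) = <-irrefl (<-resp-≈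
      (trans (*-congʳ (-≈0 Ha≈0)) (zeroˡ (G b))) (trans (*-congʳ (-≈0 Hb≈0)) (zeroˡ (G a)))
      (quotient-increasing (λ x → - H x) G (λ x → - Z x) a<b 0<G
        (λ { {c} (a≤c , c≤b) → nonvanishing⇒positive a≤c
          (λ x a≤x x≤c → let _ , D = Z′ (a≤x , ≤-trans x≤c c≤b) in _ , derivative-neg D)
          (λ x a≤x x≤c -Zx≈0 → Z≉0 x a≤x (≤-trans x≤c c≤b)
            (trans (solve 1 (λ z → z := :- :- z) refl (Z x)) (-≈0 -Zx≈0)))
          (neg-pos Za<0) })
        (λ {c} i → let w = W i in record
          { H′ = derivative-neg (H′ w) ; G′ = G′ w ; 0<r = 0<r w ; 0<s = 0<s w
          ; wronskian = trans
              (solve 5 (λ r h G H g → r :* ((:- h) :* G :- (:- H) :* g) :=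
                 :- (r :* (h :* G :- H :* g))) refl (r w) (h w) (G c) (H c) (g w))
              (trans (-‿cong (wronskian w))
                (solve 2 (λ s z → :- (s :* z) := s :* (:- z)) refl (s w) (Z c))) })))
      where
      -≈0 : ∀ {x} → x ≈ 0# → - x ≈ 0#
      -≈0 {x} x≈0 = trans (-‿cong x≈0) (solve 0 (:- con 0ℚ := con 0ℚ) refl)

  -- The exponential series and the derivative of the logarithm

  *-pos-cancelˡ : ∀ {a x} → 0# < a → 0# < a * x → 0# < x
  *-pos-cancelˡ 0<a 0<ax = *-cancelˡ-< 0<a (<-resp-≈ (sym (zeroʳ _)) refl 0<ax)

  ^-nonneg : ∀ {x} n → 0# ≤ x → 0# ≤ x ^ n
  ^-nonneg zero    0≤x = 0≤1
  ^-nonneg (suc n) 0≤x = *-nonneg 0≤x (^-nonneg n 0≤x)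

  ∣∣≤-^ : ∀ {x B} n → ∣ x ∣≤ B → ∣ x ^ n ∣≤ B ^ n
  ∣∣≤-^ zero    b = ∣∣≤-self 0≤1
  ∣∣≤-^ (suc n) b = ∣∣≤-* b (∣∣≤-^ n b)

  -- With `n = k + 2` and `h = x - y`, the induction rests on `xⁿ⁺¹ - yⁿ⁺¹ - (n + 1) yⁿ h = x (xⁿ -
  -- yⁿ - n yⁿ⁻¹ h) + n yⁿ⁻¹ h²`. The constant `n (n - 1)` omits Taylor's factor one half, so that
  -- multiplied by `1 / n!` it becomes `1 / (n - 2)!`.
  ^-remainder : ∀ {x y e B} → ∣ x ∣≤ B → ∣ y ∣≤ B → ∣ x - y ∣≤ e → ∀ k →
    ∣ (x ^ (2 ℕ.+ k) - y ^ (2 ℕ.+ k)) - ν (2 ℕ.+ k) * y ^ suc k * (x - y) ∣≤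
      ν (2 ℕ.+ k) * ν (suc k) * B ^ k * (e * e)
  ^-remainder {x} {y} {e} {B} ∣x∣≤B ∣y∣≤B ∣x-y∣≤e zero = ∣∣≤-weaken
    (≤-by (trans (+-congʳ (*-congʳ (*-congʳ (*-cong ν2≈2 ν1≈1))))
      (solve 1 (λ e → (con 1ℚ :+ con 1ℚ) :* con 1ℚ :* con 1ℚ :* (e :* e) :- e :* e
        := e :* e) refl e)) (*-nonneg 0≤e 0≤e))
    (∣∣≤-resp-≈ (trans
      (solve 2 (λ x y → (x :- y) :* (x :- y) :=
        (x :* (x :* con 1ℚ) :- y :* (y :* con 1ℚ))
          :- (con 1ℚ :+ con 1ℚ) :* (y :* con 1ℚ) :* (x :- y)) refl x y)
      (+-congˡ (-‿cong (*-congʳ (*-congʳ (sym ν2≈2)))))) refl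
      (∣∣≤-* ∣x-y∣≤e ∣x-y∣≤e))
    where
    0≤e : 0# ≤ e
    0≤e = ∣∣≤-nonneg ∣x-y∣≤e
    ν1≈1 : ν 1 ≈ 1#
    ν1≈1 = ι-1
    ν2≈2 : ν 2 ≈ 2#
    ν2≈2 = trans (ν-suc 1) (+-congˡ ι-1)
  ^-remainder {x} {y} {e} {B} ∣x∣≤B ∣y∣≤B ∣x-y∣≤e (suc k) = ∣∣≤-weaken
    (≤-by (trans (+-cong (*-congʳ (*-congʳ (*-congʳ (ν-suc (2 ℕ.+ k)))))
            (-‿cong (+-congʳ (*-congˡ (*-congʳ (*-congʳ (*-congʳ (ν-suc (suc k)))))))))
        (trans (+-congʳ (*-congʳ (*-congʳ (*-congˡ (ν-suc (suc k))))))
          (solve 5 (λ B n n₂ P e →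
            (con 1ℚ :+ n₂) :* (con 1ℚ :+ n) :* (B :* P) :* (e :* e)
              :- (B :* ((con 1ℚ :+ n) :* n :* P :* (e :* e))
                   :+ n₂ :* (B :* P) :* (e :* e)) :=
            ((con 1ℚ :+ n₂) :* (con 1ℚ :+ n) :- (con 1ℚ :+ n) :* n :- n₂)
              :* (B :* P) :* (e :* e)) refl B (ν (suc k)) (ν (2 ℕ.+ k)) (B ^ k) e)))
      (*-nonneg (*-nonneg slack (^-nonneg (suc k) 0≤B)) (*-nonneg 0≤e 0≤e)))
    (∣∣≤-resp-≈
      (trans (solve 5 (λ x y X Y n₂ →
          x :* ((X :- y :* Y) :- n₂ :* Y :* (x :- y)) :+ n₂ :* Y :* ((x :- y) :* (x :- y))
          := (x :* X :- y :* (y :* Y)) :- (con 1ℚ :+ n₂) :* (y :* Y) :* (x :- y))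
          refl x y (x ^ (2 ℕ.+ k)) (y ^ suc k) (ν (2 ℕ.+ k)))
        (+-congˡ (-‿cong (*-congʳ (*-congʳ (sym (ν-suc (2 ℕ.+ k))))))))
      refl
      (∣∣≤-+ (∣∣≤-* ∣x∣≤B (^-remainder ∣x∣≤B ∣y∣≤B ∣x-y∣≤e k))
        (∣∣≤-* (∣∣≤-* (∣∣≤-self (ν-nonneg (2 ℕ.+ k))) (∣∣≤-^ (suc k) ∣y∣≤B))
               (∣∣≤-* ∣x-y∣≤e ∣x-y∣≤e))))
    where
    0≤e : 0# ≤ e
    0≤e = ∣∣≤-nonneg ∣x-y∣≤e
    0≤B : 0# ≤ B
    0≤B = ∣∣≤-nonneg ∣x∣≤B
    slack : 0# ≤ (1# + ν (2 ℕ.+ k)) * (1# + ν (suc k)) - (1# + ν (suc k)) * ν (suc k)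
                  - ν (2 ℕ.+ k)
    slack = 0≤-≈ (sym (trans
      (+-cong (+-congʳ (*-congʳ (+-congˡ (ν-suc (suc k))))) (-‿cong (ν-suc (suc k))))
      (solve 1 (λ n → (con 1ℚ :+ (con 1ℚ :+ n)) :* (con 1ℚ :+ n)
          :- (con 1ℚ :+ n) :* n :- (con 1ℚ :+ n) := con 1ℚ :+ n) refl (ν (suc k)))))
      (+-nonneg 0≤1 (ν-nonneg (suc k)))

  -- The coefficients c k = 1 / k!, given by their recursion.
  module Exponential (c : ℕ → Carrier) (c-zero : c 0 ≈ 1#)
    (c-suc : ∀ k → ν (suc k) * c (suc k) ≈ c k) where

    c-pos : ∀ k → 0# < c k
    c-pos zero    = <-resp-≈ refl (sym c-zero) 0<1
    c-pos (suc k) = *-pos-cancelˡ (ν-suc-pos k) (<-resp-≈ refl (sym (c-suc k)) (c-pos k))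

    c-nonneg : ∀ k → 0# ≤ c k
    c-nonneg k = <⇒≤ (c-pos k)

    c≤1 : ∀ k → c k ≤ 1#
    c≤1 zero    = ≤-reflexive c-zero
    c≤1 (suc k) = ≤-trans (≤-by
      (trans (+-congʳ (trans (sym (c-suc k)) (*-congʳ (ν-suc k))))
        (solve 2 (λ n d → (con 1ℚ :+ n) :* d :- d := n :* d) refl (ν k) (c (suc k))))
      (*-nonneg (ν-nonneg k) (c-nonneg (suc k)))) (c≤1 k)

    partialSum : Carrier → ℕ → Carrier
    partialSum y n = sum {n} λ k → c (toℕ k) * y ^ toℕ k

    partialSum-suc : ∀ y n → partialSum y (suc n) ≈ partialSum y n + c n * y ^ n
    partialSum-suc y n = trans (sum-init-last {n} λ k → c (toℕ k) * y ^ toℕ k)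
      (+-cong
        (reflexive (sum-cong-≗ {n} λ k → ≡.cong (λ j → c j * y ^ j) (toℕ-inject₁ k)))
        (reflexive (≡.cong (λ j → c j * y ^ j) (toℕ-fromℕ n))))

    partialSum-mono : ∀ {y} → 0# ≤ y → ∀ {m n} → m ℕ.≤′ n →
      partialSum y m ≤ partialSum y n
    partialSum-mono         0≤y ℕ.≤′-refl           = ≤-refl
    partialSum-mono {y} 0≤y (ℕ.≤′-step {n} m≤n) = ≤-trans (partialSum-mono 0≤y m≤n)
      (≤-by (trans (+-congʳ (partialSum-suc y n))
        (solve 2 (λ s t → (s :+ t) :- s := t) refl (partialSum y n) (c n * y ^ n)))
        (*-nonneg (c-nonneg n) (^-nonneg n 0≤y)))

    -- From an index `N ≥ 2B` on, the majorant `c k * B ^ k` at least halves with each step, so the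
    -- tail is dominated by a geometric series.
    partialSum-converges : ∀ y → ∃[ l ] partialSum y ⟶ l
    partialSum-converges y =
      let l , shifted⟶l = geometric-converges (λ j → partialSum y (N ℕ.+ j)) (a N)
            (a-nonneg N) step
      in l , ⟶-unshift N shifted⟶l
      where
      bound : ∃[ B ] 0# ≤ B × ∣ y ∣≤ B
      bound = ∣∣≤-exists y
      B : Carrier
      B = proj₁ bound
      0≤B : 0# ≤ B
      0≤B = proj₁ (proj₂ bound)
      N : ℕ
      N = proj₁ (archimedean-ℕ (B + B))
      a : ℕ → Carrier
      a k = c k * B ^ k
      a-nonneg : ∀ k → 0# ≤ a k
      a-nonneg k = *-nonneg (c-nonneg k) (^-nonneg k 0≤B)

      a-halves : ∀ k → N ℕ.≤ k → a (suc k) ≤ 2⁻¹ * a k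
      a-halves k N≤k = *-cancelˡ-≤ (ν-suc-pos k) (≤-by
        (trans (+-congˡ (-‿cong (trans
            (solve 4 (λ n d B P → n :* (d :* (B :* P)) := (n :* d) :* (B :* P))
              refl (ν (suc k)) (c (suc k)) B (B ^ k))
            (*-congʳ (c-suc k)))))
          (solve 4 (λ n d B P → n :* (con ½ :* (d :* P)) :- d :* (B :* P) :=
              con ½ :* ((n :- (B :+ B)) :* (d :* P)))
            refl (ν (suc k)) (c k) B (B ^ k)))
        (*-nonneg (<⇒≤ 0<2⁻¹) (*-nonneg (0≤-difference
          (≤-trans (proj₂ (archimedean-ℕ (B + B)))
            (ν-mono-≤ (ℕ.≤-trans N≤k (ℕ.n≤1+n k))))) (a-nonneg k))))

      a-geometric : ∀ j → a (N ℕ.+ j) ≤ a N * hⁿ j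
      a-geometric zero    = ≤-reflexive (trans
        (reflexive (≡.cong a (ℕ.+-identityʳ N)))
        (sym (trans (*-congˡ ι-1) (*-identityʳ (a N)))))
      a-geometric (suc j) = ≤-trans
        (≤-reflexive (reflexive (≡.cong a (ℕ.+-suc N j))))
        (≤-trans (a-halves (N ℕ.+ j) (ℕ.m≤m+n N j))
          (≤-trans (*-monoˡ-≤ (<⇒≤ 0<2⁻¹) (a-geometric j))
            (≤-reflexive (trans
              (solve 2 (λ A h → con ½ :* (A :* h) := A :* (con ½ :* h)) refl (a N) (hⁿ j))
              (*-congˡ (sym (hⁿ-suc j)))))))

      step : ∀ j → ∣ partialSum y (N ℕ.+ suc j) - partialSum y (N ℕ.+ j) ∣≤ a N * hⁿ j
      step j = ∣∣≤-weaken (a-geometric j) (∣∣≤-resp-≈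
        (sym (trans (+-congʳ (trans
            (reflexive (≡.cong (partialSum y) (ℕ.+-suc N j)))
            (partialSum-suc y (N ℕ.+ j))))
          (solve 2 (λ s t → (s :+ t) :- s := t) refl
            (partialSum y (N ℕ.+ j)) (c (N ℕ.+ j) * y ^ (N ℕ.+ j))))) refl
        (∣∣≤-* (∣∣≤-self (c-nonneg (N ℕ.+ j)))
               (∣∣≤-^ (N ℕ.+ j) (proj₂ (proj₂ bound)))))

    abstract
      exp : Carrier → Carrier
      exp y = proj₁ (partialSum-converges y)

      ⟶exp : ∀ y → partialSum y ⟶ exp y
      ⟶exp y = proj₂ (partialSum-converges y)

    partialSum≤exp : ∀ {y} → 0# ≤ y → ∀ n → partialSum y n ≤ exp y
    partialSum≤exp {y} 0≤y n =
      ⟶-≥ n (⟶exp y) λ m n≤m → partialSum-mono 0≤y (ℕ.≤⇒≤′ n≤m)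

    -- Sum of the bounds of `^-remainder` weighted by the coefficients. Since `k * c k` is
    -- `c (k - 1)`, the linear terms form a partial sum at `y` with one term fewer, and the error
    -- constants form one at `B` with two terms fewer.
    partialSum-remainder : ∀ {x y e B} → ∣ x ∣≤ B → ∣ y ∣≤ B → ∣ x - y ∣≤ e → ∀ n →
      ∣ (partialSum x (2 ℕ.+ n) - partialSum y (2 ℕ.+ n))
          - partialSum y (suc n) * (x - y) ∣≤ partialSum B n * (e * e)
    partialSum-remainder {x} {y} {e} ∣x∣≤B ∣y∣≤B ∣x-y∣≤e zero = ∣∣≤-zero
      (trans
        (solve 4 (λ x y d₀ d₁ →
          ((d₀ :* con 1ℚ :+ (d₁ :* (x :* con 1ℚ) :+ con 0ℚ))
            :- (d₀ :* con 1ℚ :+ (d₁ :* (y :* con 1ℚ) :+ con 0ℚ)))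
            :- (d₀ :* con 1ℚ :+ con 0ℚ) :* (x :- y) := (d₁ :- d₀) :* (x :- y))
          refl x y (c 0) (c 1))
        (trans (*-congʳ (≈⇒difference≈0 c1≈c0)) (zeroˡ (x - y))))
      (≤-reflexive (sym (zeroˡ (e * e))))
      where
      c1≈c0 : c 1 ≈ c 0
      c1≈c0 = trans (sym (*-identityˡ (c 1))) (trans (*-congʳ (sym ι-1)) (c-suc 0))
    partialSum-remainder {x} {y} {e} {B} ∣x∣≤B ∣y∣≤B ∣x-y∣≤e (suc n) = ∣∣≤-resp-≈
      (begin
        ((X - Y) - Z * h) + d * ((x² - y²) - m * y¹ * h)
          ≈⟨ solve 9 (λ X Y Z h d p q m r →
               ((X :- Y) :- Z :* h) :+ d :* ((p :- q) :- m :* r :* h) :=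
               ((X :+ d :* p) :- (Y :+ d :* q)) :- (Z :+ (m :* d) :* r) :* h) refl
               X Y Z h d x² y² m y¹ ⟩
        ((X + d * x²) - (Y + d * y²)) - (Z + (m * d) * y¹) * h
          ≈⟨ +-congˡ (-‿cong (*-congʳ (+-congˡ (*-congʳ (c-suc (suc n)))))) ⟩
        ((X + d * x²) - (Y + d * y²)) - (Z + c (suc n) * y¹) * h
          ≈⟨ +-cong (+-cong (partialSum-suc x (2 ℕ.+ n)) (-‿cong (partialSum-suc y (2 ℕ.+ n))))
                    (-‿cong (*-congʳ (partialSum-suc y (suc n)))) ⟨
        (partialSum x (3 ℕ.+ n) - partialSum y (3 ℕ.+ n)) - partialSum y (2 ℕ.+ n) * h ∎)
      (begin
        S * (e * e) + d * (m * ν (suc n) * B ^ n * (e * e))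
          ≈⟨ solve 6 (λ S e d m k P → S :* (e :* e) :+ d :* (m :* k :* P :* (e :* e)) :=
               (S :+ (k :* (m :* d)) :* P) :* (e :* e)) refl S e d m (ν (suc n)) (B ^ n) ⟩
        (S + (ν (suc n) * (m * d)) * B ^ n) * (e * e)
          ≈⟨ *-congʳ (+-congˡ (*-congʳ (trans (*-congˡ (c-suc (suc n))) (c-suc n)))) ⟩
        (S + c n * B ^ n) * (e * e)
          ≈⟨ *-congʳ (partialSum-suc B n) ⟨
        partialSum B (suc n) * (e * e) ∎)
      (∣∣≤-+ (partialSum-remainder ∣x∣≤B ∣y∣≤B ∣x-y∣≤e n)
             (∣∣≤-* (∣∣≤-self (c-nonneg (2 ℕ.+ n)))
                    (^-remainder ∣x∣≤B ∣y∣≤B ∣x-y∣≤e n)))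
      where
      X Y Z S h d m x² y² y¹ : Carrier
      X = partialSum x (2 ℕ.+ n)
      Y = partialSum y (2 ℕ.+ n)
      Z = partialSum y (suc n)
      S = partialSum B n
      h = x - y
      d = c (2 ℕ.+ n)
      m = ν (2 ℕ.+ n)
      x² = x ^ (2 ℕ.+ n)
      y² = y ^ (2 ℕ.+ n)
      y¹ = y ^ suc n

    exp-derivative : ∀ y → HasDerivative exp y (exp y)
    exp-derivative y =
      let Y , 0≤Y , ∣y∣≤Y = ∣∣≤-exists y
          -- All points within the radius `1` of `y` are bounded by `B`, so the single error
          -- constant `exp B` serves every partial sum and survives the limit.
          B = 1# + Y
          0≤B = +-nonneg 0≤1 0≤Y
      in record
      { error = exp B ; radius = 1#
      ; 0≤error = partialSum≤exp 0≤B 0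
      ; 0<radius = 0<1
      ; expansion = λ {x} {e} e≤1 near →
          let ∣x∣≤B = ∣∣≤-resp-≈ (solve 2 (λ x y → (x :- y) :+ y := x) refl x y) refl
                (∣∣≤-+ (∣∣≤-weaken e≤1 near) ∣y∣≤Y)
              ∣y∣≤B = ∣∣≤-weaken
                (≤-by (solve 1 (λ Y → (con 1ℚ :+ Y) :- Y := con 1ℚ) refl Y) 0≤1) ∣y∣≤Y
              0≤e = ∣∣≤-nonneg near
              bounded : ∀ n → ∣ (partialSum x (2 ℕ.+ n) - partialSum y (2 ℕ.+ n))
                - partialSum y (suc n) * (x - y) ∣≤ exp B * (e * e)
              bounded n = ∣∣≤-weaken
                (*-mono-≤ (partialSum-mono 0≤B (ℕ.z≤′n {n})) (*-nonneg 0≤e 0≤e)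
                  (partialSum≤exp 0≤B n) ≤-refl)
                (partialSum-remainder ∣x∣≤B ∣y∣≤B near n)
              limit = ⟶-resp-≈
                (λ n → solve 4 (λ X Y Z h → (X :+ (:- con 1ℚ) :* Y) :+ (:- h) :* Z :=
                         (X :- Y) :- Z :* h) refl
                  (partialSum x (2 ℕ.+ n)) (partialSum y (2 ℕ.+ n))
                  (partialSum y (suc n)) (x - y))
                (solve 3 (λ X Y h → (X :+ (:- con 1ℚ) :* Y) :+ (:- h) :* Y :=
                         (X :- Y) :- Y :* h) refl (exp x) (exp y) (x - y))
                (⟶-+ (⟶-+ (⟶-shift 2 (⟶exp x)) (⟶-* (- 1#) (⟶-shift 2 (⟶exp y))))
                     (⟶-* (- (x - y)) (⟶-shift 1 (⟶exp y))))
          in ⟶-≤ 0 limit (λ n _ → proj₁ (bounded n)) ,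
             ⟶-≤ 0 (⟶-resp-≈ (λ _ → -1* _) (-1* _) (⟶-* (- 1#) limit))
               (λ n _ → proj₂ (bounded n))
      }
      where
      -1* : ∀ x → - 1# * x ≈ - x
      -1* x = solve 1 (λ x → (:- con 1ℚ) :* x := :- x) refl x

    exp-cong : ∀ {x y} → x ≈ y → exp x ≈ exp y
    exp-cong {y = y} = derivative-cong (exp-derivative y)

    exp-0 : exp 0# ≈ 1#
    exp-0 = ⟶-unique (⟶-shift 1 (⟶exp 0#)) (⟶-resp-≈ (λ n → sym (partialSum-0 n)) refl
      (∣∣≤⇒⟶ λ ε 0<ε → 0 , λ _ _ → ∣∣≤-zero (-‿inverseʳ 1#) (<⇒≤ 0<ε)))
      where
      partialSum-0 : ∀ n → partialSum 0# (suc n) ≈ 1#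
      partialSum-0 zero    = trans (+-identityʳ _) (trans (*-identityʳ (c 0)) c-zero)
      partialSum-0 (suc n) = trans (partialSum-suc 0# (suc n)) (trans
        (+-cong (partialSum-0 n) (trans (*-congˡ (zeroˡ (0# ^ n))) (zeroʳ (c (suc n)))))
        (+-identityʳ 1#))

    -- The product `exp x * exp (s - x)` has derivative zero in `x`; its values at `0` and at `a`
    -- are compared.
    exp-+ : ∀ a b → exp (a + b) ≈ exp a * exp b
    exp-+ a b = begin
      exp s                       ≈⟨ *-identityˡ (exp s) ⟨
      1# * exp s                  ≈⟨ *-cong (sym exp-0) (exp-cong
        (solve 1 (λ s → s := s :- con 0ℚ) refl s)) ⟩
      exp 0# * exp (s - 0#)       ≈⟨ zero-derivative⇒constant derivative 0# a ⟩
      exp a * exp (s - a)         ≈⟨ *-congˡ (exp-cong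
        (solve 2 (λ a b → (a :+ b) :- a := b) refl a b)) ⟩
      exp a * exp b               ∎
      where
      s : Carrier
      s = a + b
      derivative : ∀ y → HasDerivative (λ x → exp x * exp (s - x)) y 0#
      derivative y = derivative-resp-≈ (λ _ → refl)
        (solve 2 (λ u v → u :* v :+ u :* (:- v) := con 0ℚ) refl (exp y) (exp (s - y)))
        (derivative-* (exp-derivative y) (derivative-reflect s (exp-derivative (s - y))))

    exp-inverse : ∀ y → exp y * exp (- y) ≈ 1#
    exp-inverse y = trans (sym (exp-+ y (- y)))
      (trans (exp-cong (-‿inverseʳ y)) exp-0)

    1+y≤exp-nonneg : ∀ {y} → 0# ≤ y → 1# + y ≤ exp y
    1+y≤exp-nonneg {y} 0≤y = ≤-trans (≤-reflexive (sym (begin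
      c 0 * 1# + (c 1 * (y * 1#) + 0#) ≈⟨ +-cong (*-congʳ c-zero)
        (+-congʳ (*-congʳ c1≈1)) ⟩
      1# * 1# + (1# * (y * 1#) + 0#)
        ≈⟨ solve 1 (λ y → con 1ℚ :* con 1ℚ :+ (con 1ℚ :* (y :* con 1ℚ) :+ con 0ℚ) :=
             con 1ℚ :+ y) refl y ⟩
      1# + y                           ∎))) (partialSum≤exp 0≤y 2)
      where
      c1≈1 : c 1 ≈ 1#
      c1≈1 = trans (sym (*-identityˡ (c 1)))
        (trans (*-congʳ (sym ι-1)) (trans (c-suc 0) c-zero))

    exp-pos-nonneg : ∀ {y} → 0# ≤ y → 0# < exp y
    exp-pos-nonneg 0≤y = <-≤-trans (pos+nonneg 0<1 0≤y) (1+y≤exp-nonneg 0≤y)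

    exp-pos : ∀ y → 0# < exp y
    exp-pos y with ≤-total 0# y
    ... | inj₁ 0≤y = exp-pos-nonneg 0≤y
    ... | inj₂ y≤0 = *-pos-cancelˡ (exp-pos-nonneg (neg-nonneg y≤0))
      (<-resp-≈ refl (sym (trans (*-comm _ _) (exp-inverse y))) 0<1)

    -- Comparison with the geometric series.
    1-t*exp≤1 : ∀ {t} → 0# ≤ t → 0# ≤ 1# - t → (1# - t) * exp t ≤ 1#
    1-t*exp≤1 {t} 0≤t 0≤1-t = ⟶-≤ 0 (⟶-* (1# - t) (⟶exp t)) λ n _ →
      ≤-trans (bounded n) (≤-by
        (solve 1 (λ p → con 1ℚ :- (con 1ℚ :- p) := p) refl (t ^ n)) (^-nonneg n 0≤t))
      where
      bounded : ∀ n → (1# - t) * partialSum t n ≤ 1# - t ^ n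
      bounded zero    = ≤-reflexive (trans (zeroʳ (1# - t)) (sym (-‿inverseʳ 1#)))
      bounded (suc n) = ≤-by
        (trans (+-congˡ (-‿cong (*-congˡ (partialSum-suc t n))))
          (solve 4 (λ t S d p →
            (con 1ℚ :- t :* p) :- (con 1ℚ :- t) :* (S :+ d :* p) :=
            ((con 1ℚ :- p) :- (con 1ℚ :- t) :* S) :+ ((con 1ℚ :- t) :* p) :* (con 1ℚ :- d))
            refl t (partialSum t n) (c n) (t ^ n)))
        (+-nonneg (0≤-difference (bounded n))
          (*-nonneg (*-nonneg 0≤1-t (^-nonneg n 0≤t)) (0≤-difference (c≤1 n))))

    -- Three ranges: two terms of the series for `y ≥ 0`, positivity of `exp` where `1 + y ≤ 0`, and
    -- in between `1-t*exp≤1` at `t = -y`, from which `exp (- y)` is cancelled.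
    1+y≤exp : ∀ y → 1# + y ≤ exp y
    1+y≤exp y with ≤-total 0# y | ≤-total 0# (1# + y)
    ... | inj₁ 0≤y | _           = 1+y≤exp-nonneg 0≤y
    ... | inj₂ _   | inj₂ 1+y≤0  = ≤-trans 1+y≤0 (<⇒≤ (exp-pos y))
    ... | inj₂ y≤0 | inj₁ 0≤1+y  = *-cancelˡ-≤ (exp-pos (- y)) (≤-trans
      (≤-resp-≈
        (solve 2 (λ y u → (con 1ℚ :- :- y) :* u := u :* (con 1ℚ :+ y)) refl y (exp (- y)))
        refl
        (1-t*exp≤1 (neg-nonneg y≤0)
          (0≤-≈ (solve 1 (λ y → con 1ℚ :+ y := con 1ℚ :- :- y) refl y) 0≤1+y)))
      (≤-reflexive (sym (trans (*-comm _ _) (exp-inverse y)))))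

    -- The inequality `1 + y ≤ exp y` brackets `x` for the intermediate value theorem: `exp x > x`,
    -- and `exp (- s) < x` for `s = 1 / x` because `exp s > s`.
    exp-surjective : ∀ {x} → 0# < x → ∃[ y ] exp y ≈ x
    exp-surjective {x} 0<x =
      let s , xs≈1 = reciprocal 0<x
          0<s = reciprocal-pos 0<x xs≈1
          exp-s<x = *-cancelˡ-< 0<s (<-≤-trans
            (*-monoʳ′ (exp-pos (- s))
              (<-≤-trans (<-by (solve 1 (λ s → (con 1ℚ :+ s) :- s := con 1ℚ) refl s) 0<1)
                (1+y≤exp s)))
            (≤-reflexive (trans (exp-inverse s) (trans (sym xs≈1) (*-comm x s)))))
          x<exp = <-≤-trans (<-by (solve 1 (λ s → (con 1ℚ :+ s) :- s := con 1ℚ) refl x) 0<1)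
            (1+y≤exp x)
          y , root = intermediate-value { λ y → x + - exp y} { - s} {x}
            (≤-by (solve 2 (λ x s → x :- :- s := x :+ s) refl x s)
              (+-nonneg (<⇒≤ 0<x) (<⇒≤ 0<s)))
            (λ z _ _ → _ ,
              derivative-+ (derivative-const x z) (derivative-neg (exp-derivative z)))
            (0<-difference exp-s<x)
            (<-by (solve 2 (λ x e → con 0ℚ :- (x :- e) := e :- x) refl x (exp x))
              (0<-difference x<exp))
      in y , sym (difference≈0⇒≈ root)
      where
      *-monoʳ′ : ∀ {a x y} → 0# < a → x < y → x * a < y * a
      *-monoʳ′ {a} {x} {y} 0<a x<y = <-resp-≈ (*-comm a x) (*-comm a y) (*-monoˡ-< 0<a x<y)

    partialSum-surjective : ∀ {x} → 0# < x → ∃[ y ] partialSum y ⟶ x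
    partialSum-surjective 0<x = let y , eq = exp-surjective 0<x in
      y , ⟶-resp-≈ (λ _ → refl) eq (⟶exp y)

    -- Let `h` and `k` be the increments of `log` and of its argument, so that the error is
    -- `D = k / x - h` up to sign. The inequality `1 + y ≤ exp y` gives `0 ≤ D` at `y = h` and
    -- `z * D ≤ k² / x` at `y = -h`. The radius `x / 2` keeps `z ≥ x / 2`, whence `D ≤ 2 k² / x²`.
    log-derivative : (log : Carrier → Carrier) →
      (∀ {x} → 0# < x → partialSum (log x) ⟶ x) →
      ∀ {x i} → 0# < x → x * i ≈ 1# → HasDerivative log x i
    log-derivative log log-spec {x} {i} 0<x xi≈1 = record
      { error = 2# * (i * i) ; radius = 2⁻¹ * x
      ; 0≤error = *-nonneg (<⇒≤ 0<2) (*-nonneg (<⇒≤ 0<i) (<⇒≤ 0<i))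
      ; 0<radius = half 0<x
      ; expansion = λ {z} {e} e≤x/2 near →
          let x/2≤z : 2⁻¹ * x ≤ z
              x/2≤z = ≤-by
                (solve 3 (λ z x e → z :- con ½ :* x := (e :+ (z :- x)) :+ (con ½ :* x :- e))
                  refl z x e)
                (+-nonneg (∣∣≤-upper near) (0≤-difference e≤x/2))
              0<z : 0# < z
              0<z = <-≤-trans (half 0<x) x/2≤z
              h = log z - log x
              k = z - x
              D = k * i - h
              xexp≈z : exp h * x ≈ z
              xexp≈z = trans (*-congˡ (sym (exp-log 0<x))) (trans (sym (exp-+ h (log x)))
                (trans (exp-cong (solve 2 (λ u v → (u :- v) :+ v := u) refl (log z) (log x)))
                  (exp-log 0<z)))
              zexp≈x : exp (- h) * z ≈ x
              zexp≈x = trans (*-congˡ (sym (exp-log 0<z))) (trans (sym (exp-+ (- h) (log z)))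
                (trans (exp-cong (solve 2 (λ u v → :- (u :- v) :+ u := v) refl (log z) (log x)))
                  (exp-log 0<x)))
              xD≥0 : 0# ≤ x * D
              xD≥0 = 0≤-≈ (begin
                (exp h - (1# + h)) * x
                  ≈⟨ solve 3 (λ E h x → (E :- (con 1ℚ :+ h)) :* x := E :* x :- x :- x :* h)
                       refl (exp h) h x ⟩
                exp h * x - x - x * h     ≈⟨ +-congʳ (+-congʳ xexp≈z) ⟩
                k - x * h                 ≈⟨ +-congʳ (*-identityˡ k) ⟨
                1# * k - x * h            ≈⟨ +-congʳ (*-congʳ xi≈1) ⟨
                x * i * k - x * h
                  ≈⟨ solve 4 (λ x i k h → x :* i :* k :- x :* h := x :* (k :* i :- h))
                       refl x i k h ⟩
                x * D                     ∎)
                (*-nonneg (0≤-difference (1+y≤exp h)) (<⇒≤ 0<x))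
              0≤D : 0# ≤ D
              0≤D = *-cancelˡ-≤ 0<x (≤-resp-≈ (sym (zeroʳ x)) refl xD≥0)
              zD≤ : z * D ≤ i * (k * k)
              zD≤ = ≤-by (begin
                i * (k * k) - z * (k * i - h)
                  ≈⟨ solve 4 (λ i x z h → let k = z :- x in
                       i :* (k :* k) :- z :* (k :* i :- h) := z :* h :- (x :* i) :* k)
                       refl i x z h ⟩
                z * h - (x * i) * k        ≈⟨ +-congˡ (-‿cong (*-congʳ xi≈1)) ⟩
                z * h - 1# * (z - x)
                  ≈⟨ solve 3 (λ z h x → z :* h :- con 1ℚ :* (z :- x) :=
                       x :- (con 1ℚ :- h) :* z) refl z h x ⟩
                x - (1# - h) * z            ≈⟨ +-congʳ zexp≈x ⟨
                exp (- h) * z - (1# - h) * z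
                  ≈⟨ solve 3 (λ E h z → E :* z :- (con 1ℚ :- h) :* z :=
                       (E :- (con 1ℚ :- h)) :* z) refl (exp (- h)) h z ⟩
                (exp (- h) - (1# - h)) * z  ∎)
                (*-nonneg (0≤-difference (1+y≤exp (- h))) (<⇒≤ 0<z))
              D≤ : D ≤ 2# * (i * i) * (e * e)
              D≤ = *-cancelˡ-≤ (half 0<x) (≤-trans
                (≤-trans (*-mono-≤ (<⇒≤ (half 0<x)) 0≤D x/2≤z ≤-refl) zD≤)
                (≤-trans (*-monoˡ-≤ (<⇒≤ 0<i) (proj₁ (∣∣≤-* near near)))
                  (≤-reflexive (begin
                    i * (e * e)               ≈⟨ *-identityˡ _ ⟨
                    1# * (i * (e * e))        ≈⟨ *-congʳ xi≈1 ⟨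
                    x * i * (i * (e * e))
                      ≈⟨ solve 3 (λ x i e → x :* i :* (i :* (e :* e)) :=
                           con ½ :* x :* ((con 1ℚ :+ con 1ℚ) :* (i :* i) :* (e :* e)))
                           refl x i e ⟩
                    2⁻¹ * x * (2# * (i * i) * (e * e)) ∎))))
          in ∣∣≤-resp-≈
               (solve 3 (λ h k i → :- (k :* i :- h) := h :- i :* k) refl h k i) refl
               (∣∣≤-neg (∣∣≤-weaken D≤ (∣∣≤-self 0≤D)))
      }
      where
      0<i : 0# < i
      0<i = reciprocal-pos 0<x xi≈1

      exp-log : ∀ {z} → 0# < z → exp (log z) ≈ z
      exp-log {z} 0<z = ⟶-unique (⟶exp (log z)) (log-spec 0<z)

  -- Finite sets of zeros

  FinitelyMany : (Carrier → Set) → Set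
  FinitelyMany P = ∃[ zs ] ∀ x → P x → Any (x ≈_) zs

  -- With no separators left, two distinct points are impossible. Otherwise an interval lying
  -- strictly on one side of `c` avoids `c`, so the points below `c` and those above it are each
  -- separated by `cs` alone; `c` itself may be one more point.
  separated⇒finite : ∀ zs (P : Carrier → Set) →
    (∀ {x y} → x < y → P x → P y → Any (λ c → x ≤ c × c ≤ y) zs) → FinitelyMany P
  separated⇒finite [] P separated with em {∃ P}
  ... | no  none     = [] , λ x Px → contradiction (x , Px) none
  ... | yes (z , Pz) = z ∷ [] , λ x Px → here (≈z x Px)
    where
    ≈z : ∀ x → P x → x ≈ z
    ≈z x Px with <-cmp x z
    ... | inj₁ x<z        = contradiction (separated x<z Px Pz) λ ()
    ... | inj₂ (inj₁ x≈z) = x≈z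
    ... | inj₂ (inj₂ z<x) = contradiction (separated z<x Pz Px) λ ()
  separated⇒finite (c ∷ cs) P separated =
    let below , covers-below = separated⇒finite cs (λ x → P x × x < c)
          λ { x<y (Px , _) (Py , y<c) → drop (λ { (_ , c≤y) → c≤y y<c })
                (separated x<y Px Py) }
        above , covers-above = separated⇒finite cs (λ x → P x × c < x)
          λ { x<y (Px , c<x) (Py , _) → drop (λ { (x≤c , _) → x≤c c<x })
                (separated x<y Px Py) }
        cover : ∀ x → P x → x < c ⊎ x ≈ c ⊎ c < x → Any (x ≈_) (below ++ c ∷ above)
        cover x Px = λ where
          (inj₁ x<c)        → ++⁺ˡ (covers-below x (Px , x<c))
          (inj₂ (inj₁ x≈c)) → ++⁺ʳ below (here x≈c)
          (inj₂ (inj₂ c<x)) → ++⁺ʳ below (there (covers-above x (Px , c<x)))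
    in below ++ c ∷ above , λ x Px → cover x Px (<-cmp x c)
    where
    drop : ∀ {Q : Carrier → Set} → ¬ Q c → Any Q (c ∷ cs) → Any Q cs
    drop ¬Qc (here Qc)   = contradiction Qc ¬Qc
    drop ¬Qc (there any) = any

  finite-⊆ : ∀ {P Q : Carrier → Set} → (∀ x → P x → Q x) → FinitelyMany Q → FinitelyMany P
  finite-⊆ P⊆Q (zs , covers) = zs , λ x Px → covers x (P⊆Q x Px)

  ν-escapes : ∀ zs → ∃[ N ] ∀ n → N ℕ.≤ n → ¬ Any (ν n ≈_) zs
  ν-escapes []       = 0 , λ _ _ ()
  ν-escapes (z ∷ zs) =
    let M , z≤M = archimedean-ℕ z
        N , escapes = ν-escapes zs
    -- `suc M` instead of `M` makes `ν n` strictly larger than `z`.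
    in suc M ℕ.⊔ N , λ where
      n p (here νn≈z) → ≤-trans (≤-trans (ν-mono-≤ (ℕ.≤-trans (ℕ.m≤m⊔n (suc M) N) p))
          (≤-reflexive νn≈z)) z≤M
        (<-by (trans (+-congʳ (ν-suc M))
          (solve 1 (λ k → con 1ℚ :+ k :- k := con 1ℚ) refl (ν M))) 0<1)
      n p (there any) → escapes n (ℕ.≤-trans (ℕ.m≤n⊔m (suc M) N) p) any

  finite⇒¬all-ν : ∀ {P} → FinitelyMany P → ¬ (∀ n → P (ν (suc n)))
  finite⇒¬all-ν (zs , covers) all =
    let N , escapes = ν-escapes zs
    in escapes (suc N) (ℕ.n≤1+n N) (covers (ν (suc N)) (all N))

  -- Polynomials, their roots and their derivatives

  open Polynomial rawRing

  -- Synthetic division by `X - z`: the coefficients of the quotient are the values at `z` of the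
  -- proper tails of the coefficient list.
  divide : Carrier → Poly → Poly
  divide z []          = []
  divide z (a ∷ [])    = []
  divide z (a ∷ b ∷ p) = eval (b ∷ p) z ∷ divide z (b ∷ p)

  eval-divide : ∀ z p x → eval p x ≈ (x - z) * eval (divide z p) x + eval p z
  eval-divide z [] x = solve 2 (λ x z → con 0ℚ := (x :- z) :* con 0ℚ :+ con 0ℚ) refl x z
  eval-divide z (a ∷ []) x = solve 3 (λ a x z →
    a :+ x :* con 0ℚ := (x :- z) :* con 0ℚ :+ (a :+ z :* con 0ℚ)) refl a x z
  eval-divide z (a ∷ b ∷ p) x = trans
    (+-congˡ (*-congˡ (eval-divide z (b ∷ p) x)))
    (solve 5 (λ a x z q r → a :+ x :* ((x :- z) :* q :+ r) :=
      (x :- z) :* (r :+ x :* q) :+ (a :+ z :* r)) refl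
      a x z (eval (divide z (b ∷ p)) x) (eval (b ∷ p) z))

  length-divide : ∀ z p {n} → length p ℕ.≤ suc n → length (divide z p) ℕ.≤ n
  length-divide z []          _         = ℕ.z≤n
  length-divide z (a ∷ [])    _         = ℕ.z≤n
  length-divide z (a ∷ b ∷ p) {suc n} (ℕ.s≤s le) = ℕ.s≤s (length-divide z (b ∷ p) le)
  length-divide z (a ∷ b ∷ p) {zero} (ℕ.s≤s ())

  eval-root : ∀ {z} p → eval p z ≈ 0# → ∀ x → eval p x ≈ (x - z) * eval (divide z p) x
  eval-root {z} p pz≈0 x = trans (eval-divide z p x) (trans (+-congˡ pz≈0) (+-identityʳ _))

  -- A point with nonzero value passes directly to the quotient by a linear factor, which a nonzero
  -- coefficient does not.
  NonVanishing : Poly → Set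
  NonVanishing p = ∃[ w ] ¬ eval p w ≈ 0#

  finitely-many-roots : ∀ n p → length p ℕ.≤ n → NonVanishing p →
    FinitelyMany (λ x → eval p x ≈ 0#)
  finitely-many-roots zero    [] _  (_ , pw≉0) = contradiction refl pw≉0
  finitely-many-roots (suc n) p  le (w , pw≉0) with em {∃[ z ] eval p z ≈ 0#}
  ... | no  none       = [] , λ x px≈0 → contradiction (x , px≈0) none
  ... | yes (z , pz≈0) =
    let zs , covers = finitely-many-roots n (divide z p) (length-divide z p le)
          (w , λ qw≈0 → pw≉0 (trans (eval-root p pz≈0 w) (trans (*-congˡ qw≈0) (zeroʳ _))))
        cover : ∀ x → x - z ≈ 0# ⊎ eval (divide z p) x ≈ 0# → Any (x ≈_) (z ∷ zs)
        cover x = λ where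
          (inj₁ x-z≈0) → here (difference≈0⇒≈ x-z≈0)
          (inj₂ qx≈0)  → there (covers x qx≈0)
    in z ∷ zs , λ x px≈0 →
         cover x (x*y≈0⇒x≈0∨y≈0 (trans (sym (eval-root p pz≈0 x)) px≈0))

  -- The constant coefficient is the value at `0`. The remaining factor then vanishes at all
  -- positive integers, too many roots unless it vanishes everywhere.
  vanishing⇒IsZero : ∀ p → (∀ x → eval p x ≈ 0#) → IsZero p
  vanishing⇒IsZero []      _       = []
  vanishing⇒IsZero (a ∷ p) vanish = a≈0 ∷ vanishing⇒IsZero p p-vanishes
    where
    a≈0 : a ≈ 0#
    a≈0 = trans (solve 2 (λ a v → a := a :+ con 0ℚ :* v) refl a (eval p 0#)) (vanish 0#)

    p-ν≈0 : ∀ n → eval p (ν (suc n)) ≈ 0#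
    p-ν≈0 n = *-cancelˡ-≈ (ν-suc-pos n) (trans
      (trans (solve 2 (λ a v → v := (a :+ v) :- a) refl a _)
        (trans (+-cong (vanish (ν (suc n))) (-‿cong a≈0)) (-‿inverseʳ 0#)))
      (sym (zeroʳ (ν (suc n)))))

    p-vanishes : ∀ x → eval p x ≈ 0#
    p-vanishes x with em {eval p x ≈ 0#}
    ... | yes px≈0 = px≈0
    ... | no  px≉0 = contradiction p-ν≈0
      (finite⇒¬all-ν (finitely-many-roots (length p) p ℕ.≤-refl (x , px≉0)))

  ¬IsZero⇒NonVanishing : ∀ p → ¬ IsZero p → NonVanishing p
  ¬IsZero⇒NonVanishing p p≢0 with em {NonVanishing p}
  ... | yes nonVanishing = nonVanishing
  ... | no  none         = contradiction (vanishing⇒IsZero p vanish) p≢0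
    where
    vanish : ∀ x → eval p x ≈ 0#
    vanish x with em {eval p x ≈ 0#}
    ... | yes px≈0 = px≈0
    ... | no  px≉0 = contradiction (x , px≉0) none

  infixl 6 _⊞_
  _⊞_ : Poly → Poly → Poly
  []      ⊞ q       = q
  (a ∷ p) ⊞ []      = a ∷ p
  (a ∷ p) ⊞ (b ∷ q) = a + b ∷ p ⊞ q

  eval-⊞ : ∀ p q x → eval (p ⊞ q) x ≈ eval p x + eval q x
  eval-⊞ []      q       x = sym (+-identityˡ _)
  eval-⊞ (a ∷ p) []      x = sym (+-identityʳ _)
  eval-⊞ (a ∷ p) (b ∷ q) x = trans (+-congˡ (*-congˡ (eval-⊞ p q x)))
    (solve 5 (λ a b x u v → (a :+ b) :+ x :* (u :+ v) := (a :+ x :* u) :+ (b :+ x :* v))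
      refl a b x (eval p x) (eval q x))

  length-⊞ : ∀ p q {n} → length p ℕ.≤ n → length q ℕ.≤ n → length (p ⊞ q) ℕ.≤ n
  length-⊞ []      q       _          le         = le
  length-⊞ (a ∷ p) []      le         _          = le
  length-⊞ (a ∷ p) (b ∷ q) (ℕ.s≤s le) (ℕ.s≤s le′) = ℕ.s≤s (length-⊞ p q le le′)

  scale : Carrier → Poly → Poly
  scale c = map (c *_)

  eval-scale : ∀ c p x → eval (scale c p) x ≈ c * eval p x
  eval-scale c []      x = sym (zeroʳ c)
  eval-scale c (a ∷ p) x = trans (+-congˡ (*-congˡ (eval-scale c p x)))
    (solve 4 (λ c a x v → c :* a :+ x :* (c :* v) := c :* (a :+ x :* v))
      refl c a x (eval p x))

  infixl 7 _⊠_
  _⊠_ : Poly → Poly → Poly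
  []      ⊠ q = []
  (a ∷ p) ⊠ q = scale a q ⊞ (0# ∷ p ⊠ q)

  eval-⊠ : ∀ p q x → eval (p ⊠ q) x ≈ eval p x * eval q x
  eval-⊠ []      q x = sym (zeroˡ _)
  eval-⊠ (a ∷ p) q x = trans (eval-⊞ (scale a q) (0# ∷ p ⊠ q) x)
    (trans (+-cong (eval-scale a q x) (+-congˡ (*-congˡ (eval-⊠ p q x))))
      (solve 4 (λ a x u v → a :* v :+ (con 0ℚ :+ x :* (u :* v)) := (a :+ x :* u) :* v)
        refl a x (eval p x) (eval q x)))

  derivative : Poly → Poly
  derivative []          = []
  derivative (a ∷ [])    = []
  derivative (a ∷ b ∷ p) = (b ∷ p) ⊞ (0# ∷ derivative (b ∷ p))

  length-derivative : ∀ p {n} → length p ℕ.≤ suc n → length (derivative p) ℕ.≤ n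
  length-derivative []          _ = ℕ.z≤n
  length-derivative (a ∷ [])    _ = ℕ.z≤n
  length-derivative (a ∷ b ∷ p) {suc n} (ℕ.s≤s le) =
    length-⊞ (b ∷ p) (0# ∷ derivative (b ∷ p)) le
      (ℕ.s≤s (length-derivative (b ∷ p) le))
  length-derivative (a ∷ b ∷ p) {zero} (ℕ.s≤s ())

  eval-derivative : ∀ p y → HasDerivative (eval p) y (eval (derivative p) y)
  eval-derivative []          y = derivative-const 0# y
  eval-derivative (a ∷ [])    y = derivative-resp-≈
    (λ x → sym (trans (+-congˡ (zeroʳ x)) (+-identityʳ a))) refl (derivative-const a y)
  eval-derivative (a ∷ b ∷ p) y = derivative-resp-≈ (λ _ → refl)
    (trans (solve 3 (λ u v y → con 0ℚ :+ (con 1ℚ :* u :+ y :* v) :=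
        u :+ (con 0ℚ :+ y :* v)) refl (eval (b ∷ p) y) (eval (derivative (b ∷ p)) y) y)
      (sym (eval-⊞ (b ∷ p) (0# ∷ derivative (b ∷ p)) y)))
    (derivative-+ (derivative-const a y)
      (derivative-* (derivative-id y) (eval-derivative (b ∷ p) y)))

  -- If the derivative vanished everywhere, `p` would be constant, hence equal to its value zero at
  -- the root `z`.
  derivative-NonVanishing : ∀ p {z} → eval p z ≈ 0# → NonVanishing p →
    NonVanishing (derivative p)
  derivative-NonVanishing p {z} pz≈0 (w , pw≉0) with em {NonVanishing (derivative p)}
  ... | yes nonVanishing = nonVanishing
  ... | no  none         = contradiction
    (trans (zero-derivative⇒constant p′≈0 w z) pz≈0) pw≉0
    where
    p′≈0 : ∀ y → HasDerivative (eval p) y 0#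
    p′≈0 y with em {eval (derivative p) y ≈ 0#}
    ... | yes p′y≈0 = derivative-resp-≈ (λ _ → refl) p′y≈0 (eval-derivative p y)
    ... | no  p′y≉0 = contradiction (y , p′y≉0) none

  -- Unlike coefficient lists, expressions have values and formal derivatives
  -- that compute, which leaves polynomial identities to the ring solver.
  infixl 6 _⊕_
  infixl 7 _⊗_
  data Expr : Set where
    poly    : Poly → Expr
    const   : Carrier → Expr
    X+_     : Carrier → Expr
    _⊕_ _⊗_ : Expr → Expr → Expr

  ⟦_⟧ : Expr → Carrier → Carrier
  ⟦ poly p  ⟧ x = eval p x
  ⟦ const a ⟧ x = a
  ⟦ X+ b    ⟧ x = x + b
  ⟦ P ⊕ Q   ⟧ x = ⟦ P ⟧ x + ⟦ Q ⟧ x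
  ⟦ P ⊗ Q   ⟧ x = ⟦ P ⟧ x * ⟦ Q ⟧ x

  ∂ : Expr → Expr
  ∂ (poly p)  = poly (derivative p)
  ∂ (const a) = const 0#
  ∂ (X+ b)    = const 1#
  ∂ (P ⊕ Q)   = ∂ P ⊕ ∂ Q
  ∂ (P ⊗ Q)   = (∂ P ⊗ Q) ⊕ (P ⊗ ∂ Q)

  ∂-derivative : ∀ P y → HasDerivative ⟦ P ⟧ y (⟦ ∂ P ⟧ y)
  ∂-derivative (poly p)  y = eval-derivative p y
  ∂-derivative (const a) y = derivative-const a y
  ∂-derivative (X+ b)    y = derivative-resp-≈ (λ _ → refl) (+-identityʳ 1#)
    (derivative-+ (derivative-id y) (derivative-const b y))
  ∂-derivative (P ⊕ Q)   y = derivative-+ (∂-derivative P y) (∂-derivative Q y)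
  ∂-derivative (P ⊗ Q)   y = derivative-* (∂-derivative P y) (∂-derivative Q y)

  coefficients : Expr → Poly
  coefficients (poly p)  = p
  coefficients (const a) = a ∷ []
  coefficients (X+ b)    = b ∷ 1# ∷ []
  coefficients (P ⊕ Q)   = coefficients P ⊞ coefficients Q
  coefficients (P ⊗ Q)   = coefficients P ⊠ coefficients Q

  eval-coefficients : ∀ P x → eval (coefficients P) x ≈ ⟦ P ⟧ x
  eval-coefficients (poly p)  x = refl
  eval-coefficients (const a) x = trans (+-congˡ (zeroʳ x)) (+-identityʳ a)
  eval-coefficients (X+ b)    x = solve 2 (λ b x →
    b :+ x :* (con 1ℚ :+ x :* con 0ℚ) := x :+ b) refl b x
  eval-coefficients (P ⊕ Q)   x = trans (eval-⊞ (coefficients P) (coefficients Q) x)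
    (+-cong (eval-coefficients P x) (eval-coefficients Q x))
  eval-coefficients (P ⊗ Q)   x = trans (eval-⊠ (coefficients P) (coefficients Q) x)
    (*-cong (eval-coefficients P x) (eval-coefficients Q x))

  ⟦⟧-finitely-many-roots : ∀ P {w} → ¬ ⟦ P ⟧ w ≈ 0# → FinitelyMany (λ x → ⟦ P ⟧ x ≈ 0#)
  ⟦⟧-finitely-many-roots P {w} Pw≉0 = finite-⊆
    (λ x Px≈0 → trans (eval-coefficients P x) Px≈0)
    (finitely-many-roots (length (coefficients P)) (coefficients P) ℕ.≤-refl
      (w , λ pw≈0 → Pw≉0 (trans (sym (eval-coefficients P w)) pw≈0)))

  derivative-shift : ∀ {f y a} c → HasDerivative f (y + c) a →
    HasDerivative (λ x → f (x + c)) y a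
  derivative-shift {f} {y} {a} c D = record
    { error = error D ; radius = radius D
    ; 0≤error = 0≤error D ; 0<radius = 0<radius D
    ; expansion = λ {x} e≤δ near → ∣∣≤-resp-≈ (+-congˡ (-‿cong (*-congˡ (difference x)))) refl
        (expansion D e≤δ (∣∣≤-resp-≈ (sym (difference x)) refl near))
    }
    where
    difference : ∀ x → (x + c) - (y + c) ≈ x - y
    difference x = solve 3 (λ x y c → (x :+ c) :- (y :+ c) := x :- y) refl x y c

  rolle-finite : ∀ H G Z →
    FinitelyMany (λ x → 0# < x × Z x ≈ 0#) →
    (∀ {c} → 0# < c → 0# < G c) →
    (∀ {c} → 0# < c → Differentiable Z c) →
    (∀ {c} → 0# < c → WronskianSign H G Z c) →
    FinitelyMany (λ x → 0# < x × H x ≈ 0#)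
  rolle-finite H G Z (zs , covers) 0<G Z′ W =
    separated⇒finite zs _ λ { {x} {y} x<y (0<x , Hx≈0) (0<y , Hy≈0) →
      let 0<inside : ∀ {c} → Inside x y c → 0# < c
          0<inside = λ { (x≤c , _) → <-≤-trans 0<x x≤c }
          c , x≤c , c≤y , Zc≈0 = rolle H G Z x<y Hx≈0 Hy≈0
            (λ i → 0<G (0<inside i)) (λ i → Z′ (0<inside i)) (λ i → W (0<inside i))
      in Any.map (λ c≈z → ≤-resp-≈ refl c≈z x≤c , ≤-resp-≈ c≈z refl c≤y)
           (covers c (<-≤-trans 0<x x≤c , Zc≈0)) }

  -- Zeros of logarithmic sums

  module LogarithmicSums (log : Carrier → Carrier)
    (log′ : ∀ {x i} → 0# < x → x * i ≈ 1# → HasDerivative log x i) where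

    logSum : ∀ {n} → (Fin n → Poly) → (Fin n → Carrier) → Carrier → Carrier
    logSum p β x = sum λ i → eval (p i) x * log (x + β i)

    -- F = Σ pᵢ log(x + βᵢ), with one summand p₀ log(x + b) singled out, occurs in
    -- the form F + N / (tᵏ E) = H / (tᵏ E), where t = x + b. The derivative of
    -- this function is H̃ / (tᵏ⁺¹ Ẽ) with H̃ = Ñ + tᵏ⁺¹ Ẽ Σ pᵢ′ log(x + βᵢ), so that
    -- all pᵢ are differentiated away while the pole of N / (tᵏ E) at t = 0 deepens.
    module _ {m : ℕ} (b : Carrier) (β : Fin m → Carrier) (0≤b : 0# ≤ b)
      (0≤β : ∀ j → 0# ≤ β j) (β≉b : ∀ j → ¬ β j ≈ b) where

      -- Common denominator of the fractions `1 / (X + β j)`; it is positive for `x > 0` and nonzero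
      -- at `-b`.
      V : ∀ {n} → (Fin n → Carrier) → Expr
      V {zero}  β = const 1#
      V {suc n} β = (X+ β zero) ⊗ V (λ j → β (suc j))

      -- Numerator of `Σ pⱼ / (X + βⱼ)` over the common denominator `V β`.
      Y : ∀ {n} → (Fin n → Carrier) → (Fin n → Poly) → Expr
      Y {zero}  β p = const 0#
      Y {suc n} β p = (poly (p zero) ⊗ V (λ j → β (suc j)))
                    ⊕ ((X+ β zero) ⊗ Y (λ j → β (suc j)) (λ j → p (suc j)))

      V-pos : ∀ {n} (β : Fin n → Carrier) → (∀ j → 0# ≤ β j) → ∀ {x} → 0# < x →
        0# < ⟦ V β ⟧ x
      V-pos {zero}  β 0≤β 0<x = 0<1
      V-pos {suc n} β 0≤β 0<x = *-pos (pos+nonneg 0<x (0≤β zero))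
        (V-pos (λ j → β (suc j)) (λ j → 0≤β (suc j)) 0<x)

      V-nonzero : ∀ {n} (β : Fin n → Carrier) → (∀ j → ¬ β j ≈ b) → ¬ ⟦ V β ⟧ (- b) ≈ 0#
      V-nonzero {zero}  β β≉b 1≈0 = <-irrefl (<-resp-≈ refl 1≈0 0<1)
      V-nonzero {suc n} β β≉b = *-nonzero
        (λ eq → β≉b zero (difference≈0⇒≈ (trans (+-comm _ _) eq)))
        (V-nonzero (λ j → β (suc j)) λ j → β≉b (suc j))

      V*Σ≈Y : ∀ {n} (β : Fin n → Carrier) (p : Fin n → Poly) (i : Fin n → Carrier) x →
        (∀ j → (x + β j) * i j ≈ 1#) →
        ⟦ V β ⟧ x * sum (λ j → eval (p j) x * i j) ≈ ⟦ Y β p ⟧ x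
      V*Σ≈Y {zero}  β p i x inv = zeroʳ 1#
      V*Σ≈Y {suc n} β p i x inv = begin
        t * v * (e * j + s)
          ≈⟨ solve 5 (λ t v e j s → t :* v :* (e :* j :+ s) :=
               (t :* j) :* (e :* v) :+ t :* (v :* s)) refl t v e j s ⟩
        (t * j) * (e * v) + t * (v * s)
          ≈⟨ +-cong (trans (*-congʳ (inv zero)) (*-identityˡ _))
               (*-congˡ (V*Σ≈Y (λ j → β (suc j)) (λ j → p (suc j)) (λ j → i (suc j)) x
                 λ j → inv (suc j))) ⟩
        e * v + t * ⟦ Y (λ j → β (suc j)) (λ j → p (suc j)) ⟧ x ∎
        where
        t v e j s : Carrier
        t = x + β zero
        v = ⟦ V (λ j → β (suc j)) ⟧ x
        e = eval (p zero) x
        j = i zero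
        s = sum λ j → eval (p (suc j)) x * i (suc j)

      logSum-derivative : ∀ {n} (p : Fin n → Poly) (β i : Fin n → Carrier) {x} →
        (∀ j → 0# < x + β j) → (∀ j → (x + β j) * i j ≈ 1#) →
        HasDerivative (logSum p β) x
          (logSum (λ j → derivative (p j)) β x + sum (λ j → eval (p j) x * i j))
      logSum-derivative {n} p β i {x} 0<x+β inv = derivative-resp-≈ (λ _ → refl)
        (∑-distrib-+ {n} (λ j → eval (derivative (p j)) x * log (x + β j))
          (λ j → eval (p j) x * i j))
        (derivative-sum {n} (λ j x → eval (p j) x * log (x + β j)) _ λ j →
          derivative-* (eval-derivative (p j) x)
            (derivative-shift (β j) (log′ (0<x+β j) (inv j))))

      t : Expr
      t = X+ b

      t^ : ℕ → Expr
      t^ zero    = const 1#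
      t^ (suc k) = t ⊗ t^ k

      t-pos : ∀ {x} → 0# < x → 0# < ⟦ t ⟧ x
      t-pos 0<x = pos+nonneg 0<x 0≤b

      t^-pos : ∀ k {x} → 0# < x → 0# < ⟦ t^ k ⟧ x
      t^-pos zero    0<x = 0<1
      t^-pos (suc k) 0<x = *-pos (t-pos 0<x) (t^-pos k 0<x)

      -- The extra factor `t` avoids the exponent `k - 1`, so `k = 0` needs no separate form.
      t*∂t^ : ∀ k x → ⟦ t ⟧ x * ⟦ ∂ (t^ k) ⟧ x ≈ ν k * ⟦ t^ k ⟧ x
      t*∂t^ zero    x = trans (zeroʳ _) (sym (trans (*-congʳ ι-0) (zeroˡ _)))
      t*∂t^ (suc k) x = begin
        s * (1# * τ + s * τ′) ≈⟨ solve 3 (λ s τ σ → s :* (con 1ℚ :* τ :+ σ) := s :* τ :+ s :* σ)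
                                   refl s τ (s * τ′) ⟩
        s * τ + s * (s * τ′)  ≈⟨ +-congˡ (*-congˡ (t*∂t^ k x)) ⟩
        s * τ + s * (ν k * τ) ≈⟨ solve 3 (λ s τ n → s :* τ :+ s :* (n :* τ) :=
                                   (con 1ℚ :+ n) :* (s :* τ)) refl s τ (ν k) ⟩
        (1# + ν k) * (s * τ)  ≈⟨ *-congʳ (ν-suc k) ⟨
        ν (suc k) * (s * τ)   ∎
        where
        s τ τ′ : Carrier
        s  = ⟦ t ⟧ x
        τ  = ⟦ t^ k ⟧ x
        τ′ = ⟦ ∂ (t^ k) ⟧ x

      F : Poly → (Fin m → Poly) → Carrier → Carrier
      F p₀ p x = eval p₀ x * log (x + b) + logSum p β x

      H : ℕ → Expr → Expr → Poly → (Fin m → Poly) → Carrier → Carrier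
      H k N E p₀ p x = ⟦ N ⟧ x + ⟦ t^ k ⊗ E ⟧ x * F p₀ p x

      -- The logarithm-free part of the derivative, namely
      -- `(N / (tᵏ E))′ + p₀ / t + Σ pⱼ / (X + βⱼ)`, as a numerator over `tᵏ⁺¹ E² V`.
      Ñ : ℕ → Expr → Expr → Poly → (Fin m → Poly) → Expr
      Ñ k N E p₀ p =
        (V β ⊗ (((t ⊗ (∂ N ⊗ E)) ⊕ (const (- ν k) ⊗ (N ⊗ E))) ⊕ (const (- 1#) ⊗ (t ⊗ (N ⊗ ∂ E)))))
        ⊕ ((t^ k ⊗ (E ⊗ E)) ⊗ ((V β ⊗ poly p₀) ⊕ (t ⊗ Y β p)))

      Ẽ : Expr → Expr
      Ẽ E = (E ⊗ E) ⊗ V β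

      derivatives : (Fin m → Poly) → Fin m → Poly
      derivatives p j = derivative (p j)

      Zeros : (Carrier → Carrier) → Carrier → Set
      Zeros f x = 0# < x × f x ≈ 0#

      -- Inverses are known only to exist, so those of the linear factors at `x` travel together
      -- with their equations.
      record Reciprocals (x : Carrier) : Set where
        field
          i₀  : Carrier
          inv₀ : (x + b) * i₀ ≈ 1#
          i   : Fin m → Carrier
          inv : ∀ j → (x + β j) * i j ≈ 1#

      reciprocals : ∀ {x} → 0# < x → Reciprocals x
      reciprocals 0<x = record
        { i₀ = proj₁ (reciprocal (t-pos 0<x)) ; inv₀ = proj₂ (reciprocal (t-pos 0<x))
        ; i = λ j → proj₁ (reciprocal (pos+nonneg 0<x (0≤β j)))
        ; inv = λ j → proj₂ (reciprocal (pos+nonneg 0<x (0≤β j)))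
        }

      F-derivative : ∀ p₀ p {x} → 0# < x → (R : Reciprocals x) → let open Reciprocals R in
        HasDerivative (F p₀ p) x
          (F (derivative p₀) (derivatives p) x
            + (eval p₀ x * i₀ + sum λ j → eval (p j) x * i j))
      F-derivative p₀ p {x} 0<x R = derivative-resp-≈ (λ _ → refl)
        (solve 4 (λ a b c d → (a :+ b) :+ (c :+ d) := (a :+ c) :+ (b :+ d)) refl
          _ _ _ _)
        (derivative-+
          (derivative-* (eval-derivative p₀ x) (derivative-shift b (log′ (t-pos 0<x) inv₀)))
          (logSum-derivative p β i (λ j → pos+nonneg 0<x (0≤β j)) inv))
        where open Reciprocals R

      H-derivative : ∀ k N E p₀ p {x a} → HasDerivative (F p₀ p) x a →
        HasDerivative (H k N E p₀ p) x
          (⟦ ∂ N ⟧ x + (⟦ ∂ (t^ k ⊗ E) ⟧ x * F p₀ p x + ⟦ t^ k ⊗ E ⟧ x * a))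
      H-derivative k N E p₀ p {x} D = derivative-+ (∂-derivative N x)
        (derivative-* (∂-derivative (t^ k ⊗ E) x) D)

      -- In the Wronskian the terms containing `S` itself cancel, leaving `S′`, in which the
      -- logarithms carry the differentiated polynomials. Multiplication by `t * V β` clears the
      -- reciprocals in `S′`, and a factor `tᵏ` comes out.
      wronskian-identity : ∀ k N E p₀ p {x} (R : Reciprocals x) → let open Reciprocals R in
        let G  = ⟦ t^ k ⊗ E ⟧ x
            G′ = ⟦ ∂ (t^ k ⊗ E) ⟧ x
            S  = F p₀ p x
            S′ = F (derivative p₀) (derivatives p) x
                   + (eval p₀ x * i₀ + sum λ j → eval (p j) x * i j)
        in (⟦ t ⟧ x * ⟦ V β ⟧ x) * ((⟦ ∂ N ⟧ x + (G′ * S + G * S′)) * G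
                                       - (⟦ N ⟧ x + G * S) * G′)
           ≈ ⟦ t^ k ⟧ x * H (suc k) (Ñ k N E p₀ p) (Ẽ E) (derivative p₀) (derivatives p) x
      wronskian-identity k N E p₀ p {x} R = begin
        (s * v) * ((n′ + (G′ * S + G * S′)) * G - (n + G * S) * G′)
          ≈⟨ solve 8 (λ s v n n′ g g′ S S′ →
               (s :* v) :* ((n′ :+ (g′ :* S :+ g :* S′)) :* g :- (n :+ g :* S) :* g′) :=
               (s :* v) :* (n′ :* g :- n :* g′ :+ g :* g :* S′))
               refl s v n n′ G G′ S S′ ⟩
        (s * v) * (n′ * G - n * G′ + G * G * S′)
          ≈⟨ solve 12 (λ s v n n′ τ τ′ e e′ L P i Σ →
               (s :* v) :* (n′ :* (τ :* e) :- n :* (τ′ :* e :+ τ :* e′)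
                 :+ τ :* e :* (τ :* e) :* (L :+ (P :* i :+ Σ))) :=
               s :* v :* n′ :* τ :* e :- v :* n :* e :* (s :* τ′) :- s :* v :* n :* τ :* e′
                 :+ τ :* e :* (τ :* e) :* (s :* v :* L :+ v :* P :* (s :* i) :+ s :* (v :* Σ)))
               refl s v n n′ τ τ′ e e′ L P i₀ Σ ⟩
        s * v * n′ * τ * e - v * n * e * (s * τ′) - s * v * n * τ * e′
          + τ * e * (τ * e) * (s * v * L + v * P * (s * i₀) + s * (v * Σ))
          ≈⟨ +-cong (+-congʳ (+-congˡ (-‿cong (*-congˡ (t*∂t^ k x)))))
               (*-congˡ (+-cong (+-congˡ (*-congˡ inv₀))
                 (*-congˡ (V*Σ≈Y β p i x inv)))) ⟩
        s * v * n′ * τ * e - v * n * e * (κ * τ) - s * v * n * τ * e′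
          + τ * e * (τ * e) * (s * v * L + v * P * 1# + s * y)
          ≈⟨ solve 11 (λ s v n n′ τ e e′ L P y κ →
               s :* v :* n′ :* τ :* e :- v :* n :* e :* (κ :* τ) :- s :* v :* n :* τ :* e′
                 :+ τ :* e :* (τ :* e) :* (s :* v :* L :+ v :* P :* con 1ℚ :+ s :* y) :=
               τ :* ((v :* ((s :* (n′ :* e) :+ (:- κ) :* (n :* e))
                               :+ (:- con 1ℚ) :* (s :* (n :* e′)))
                       :+ (τ :* (e :* e)) :* (v :* P :+ s :* y))
                     :+ (s :* τ) :* (e :* e :* v) :* L))
               refl s v n n′ τ e e′ L P y κ ⟩
        τ * H (suc k) (Ñ k N E p₀ p) (Ẽ E) (derivative p₀) (derivatives p) x ∎
        where
        open Reciprocals R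
        s v n n′ τ τ′ e e′ L P Σ y κ G G′ S S′ : Carrier
        s  = ⟦ t ⟧ x
        v  = ⟦ V β ⟧ x
        n  = ⟦ N ⟧ x
        n′ = ⟦ ∂ N ⟧ x
        τ  = ⟦ t^ k ⟧ x
        τ′ = ⟦ ∂ (t^ k) ⟧ x
        e  = ⟦ E ⟧ x
        e′ = ⟦ ∂ E ⟧ x
        L  = F (derivative p₀) (derivatives p) x
        P  = eval p₀ x
        Σ  = sum λ j → eval (p j) x * i j
        y  = ⟦ Y β p ⟧ x
        κ  = ν k
        G  = ⟦ t^ k ⊗ E ⟧ x
        G′ = ⟦ ∂ (t^ k ⊗ E) ⟧ x
        S  = F p₀ p x
        S′ = L + (P * i₀ + Σ)

      Positive : Expr → Set
      Positive E = ∀ {x} → 0# < x → 0# < ⟦ E ⟧ x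

      Ẽ-positive : ∀ {E} → Positive E → Positive (Ẽ E)
      Ẽ-positive 0<E 0<x = *-pos (*-pos (0<E 0<x) (0<E 0<x)) (V-pos β 0≤β 0<x)

      Ẽ-nonzero : ∀ {E} → ¬ ⟦ E ⟧ (- b) ≈ 0# → ¬ ⟦ Ẽ E ⟧ (- b) ≈ 0#
      Ẽ-nonzero E≉0 = *-nonzero (*-nonzero E≉0 E≉0) (V-nonzero β β≉b)

      -- One application of Rolle's theorem to `H / (tᵏ E)`, whose denominator is positive on the
      -- half-line; the new numerator plays the part of `Z`.
      differentiate : ∀ k N E p₀ p → Positive E →
        FinitelyMany
          (Zeros (H (suc k) (Ñ k N E p₀ p) (Ẽ E) (derivative p₀) (derivatives p))) →
        FinitelyMany (Zeros (H k N E p₀ p))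
      differentiate k N E p₀ p 0<E finite = rolle-finite _ ⟦ t^ k ⊗ E ⟧ _ finite
        (λ 0<c → *-pos (t^-pos k 0<c) (0<E 0<c))
        (λ 0<c → _ , H-derivative (suc k) (Ñ k N E p₀ p) (Ẽ E) (derivative p₀) (derivatives p)
          (F-derivative (derivative p₀) (derivatives p) 0<c (reciprocals 0<c)))
        (λ {c} 0<c → record
          { H′ = H-derivative k N E p₀ p (F-derivative p₀ p 0<c (reciprocals 0<c))
          ; G′ = ∂-derivative (t^ k ⊗ E) c
          ; 0<r = *-pos (t-pos 0<c) (V-pos β 0≤β 0<c)
          ; 0<s = t^-pos k 0<c
          ; wronskian = wronskian-identity k N E p₀ p (reciprocals 0<c)
          })

      at-pole : ⟦ t ⟧ (- b) ≈ 0#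
      at-pole = -‿inverseˡ b

      ≤0⇒eval≈0 : ∀ p x → length p ℕ.≤ 0 → eval p x ≈ 0#
      ≤0⇒eval≈0 [] x _ = refl

      logSum≈0 : ∀ {n} (p : Fin n → Poly) β x → (∀ j → eval (p j) x ≈ 0#) → logSum p β x ≈ 0#
      logSum≈0 {zero}  p β x p≈0 = refl
      logSum≈0 {suc n} p β x p≈0 = trans
        (+-cong (trans (*-congʳ (p≈0 zero)) (zeroˡ _))
          (logSum≈0 (λ j → p (suc j)) (λ j → β (suc j)) x (λ j → p≈0 (suc j))))
        (+-identityʳ 0#)

      -- As `N` and `E` are nonzero at `-b`, the fraction `N / (tᵏ⁺¹ E)` has a genuine pole there,
      -- and this persists under differentiation. Meanwhile every coefficient list gets shorter. At
      -- `n = 0` all the lists are empty, `H` reduces to `N`, and `N` has finitely many roots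
      -- because of its nonzero value at `-b`.
      finite-pole : ∀ n k N E p₀ p →
        length p₀ ℕ.≤ n → (∀ j → length (p j) ℕ.≤ n) →
        ¬ ⟦ N ⟧ (- b) ≈ 0# → ¬ ⟦ E ⟧ (- b) ≈ 0# → Positive E →
        FinitelyMany (Zeros (H (suc k) N E p₀ p))
      finite-pole zero k N E p₀ p le₀ le N≉0 E≉0 0<E = finite-⊆
        (λ { x (_ , Hx≈0) → trans (sym (trans
          (+-congˡ (trans (*-congˡ (trans
            (+-cong (trans (*-congʳ (≤0⇒eval≈0 p₀ x le₀)) (zeroˡ _))
              (logSum≈0 p β x (λ j → ≤0⇒eval≈0 (p j) x (le j))))
            (+-identityʳ 0#))) (zeroʳ _)))
          (+-identityʳ _))) Hx≈0 })
        (⟦⟧-finitely-many-roots N N≉0)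
      finite-pole (suc n) k N E p₀ p le₀ le N≉0 E≉0 0<E =
        differentiate (suc k) N E p₀ p 0<E
          (finite-pole n (suc k) (Ñ (suc k) N E p₀ p) (Ẽ E) (derivative p₀) (derivatives p)
            (length-derivative p₀ le₀) (λ j → length-derivative (p j) (le j))
            (λ Ñ≈0 → Ñ-nonzero (trans (sym Ñ-at-pole) Ñ≈0)) (Ẽ-nonzero {E} E≉0)
            (λ {x} → Ẽ-positive {E} 0<E {x}))
        where
        z v n₀ n′ e e′ τ P y κ : Carrier
        z  = - b
        v  = ⟦ V β ⟧ z
        n₀ = ⟦ N ⟧ z
        n′ = ⟦ ∂ N ⟧ z
        e  = ⟦ E ⟧ z
        e′ = ⟦ ∂ E ⟧ z
        τ  = ⟦ t^ k ⟧ z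
        P  = eval p₀ z
        y  = ⟦ Y β p ⟧ z
        κ  = ν (suc k)

        -- Every term has a factor `t` except the one from differentiating the power of `t` in the
        -- denominator. Its coefficient `-κ` is nonzero since the order of the pole is at least one.
        Ñ-at-pole : ⟦ Ñ (suc k) N E p₀ p ⟧ z ≈ v * (- κ * (n₀ * e))
        Ñ-at-pole = begin
          ⟦ Ñ (suc k) N E p₀ p ⟧ z
            ≈⟨ solve 10 (λ s v n n′ e e′ τ P y κ →
                 v :* ((s :* (n′ :* e) :+ (:- κ) :* (n :* e)) :+ (:- con 1ℚ) :* (s :* (n :* e′)))
                   :+ (s :* τ) :* (e :* e) :* (v :* P :+ s :* y) :=
                 v :* ((:- κ) :* (n :* e)) :+ s :* (v :* (n′ :* e :- n :* e′)
                   :+ τ :* (e :* e) :* (v :* P :+ s :* y)))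
                 refl (⟦ t ⟧ z) v n₀ n′ e e′ τ P y κ ⟩
          v * (- κ * (n₀ * e)) + ⟦ t ⟧ z * (v * (n′ * e - n₀ * e′)
             + τ * (e * e) * (v * P + ⟦ t ⟧ z * y))
            ≈⟨ +-congˡ (trans (*-congʳ at-pole) (zeroˡ _)) ⟩
          v * (- κ * (n₀ * e)) + 0#   ≈⟨ +-identityʳ _ ⟩
          v * (- κ * (n₀ * e))        ∎

        Ñ-nonzero : ¬ v * (- κ * (n₀ * e)) ≈ 0#
        Ñ-nonzero = *-nonzero (V-nonzero β β≉b) (*-nonzero
          (λ -κ≈0 → <-irrefl (<-resp-≈ refl
            (trans (solve 1 (λ k → k := con 0ℚ :- (:- k)) refl κ)
              (≈⇒difference≈0 (sym -κ≈0)))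
            (ν-suc-pos k)))
          (*-nonzero N≉0 E≉0))

      -- The case `k = 0`, where no pole has been produced yet. If `p₀` is nonzero at `-b`,
      -- differentiating its logarithm creates a simple pole and `finite-pole` takes over. If `p₀`
      -- vanishes there, `p₀ / t` is a polynomial, `t` cancels from the new numerator, and the
      -- derivative of `p₀` is still nonzero. This cannot continue down to `n = 0`, where `p₀` would
      -- be empty.
      finite-regular : ∀ n N E p₀ p →
        length p₀ ℕ.≤ n → (∀ j → length (p j) ℕ.≤ n) → NonVanishing p₀ →
        ¬ ⟦ E ⟧ (- b) ≈ 0# → Positive E →
        FinitelyMany (Zeros (H 0 N E p₀ p))
      finite-regular zero N E [] p _ _ (_ , p₀≉0) _ _ = contradiction refl p₀≉0
      finite-regular (suc n) N E p₀ p le₀ le p₀≢0 E≉0 0<E with em {eval p₀ (- b) ≈ 0#}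
      ... | no P≉0 = differentiate 0 N E p₀ p 0<E
        (finite-pole n 0 (Ñ 0 N E p₀ p) (Ẽ E) (derivative p₀) (derivatives p)
          (length-derivative p₀ le₀) (λ j → length-derivative (p j) (le j))
          (λ Ñ≈0 → *-nonzero (*-nonzero E≉0 E≉0) (*-nonzero (V-nonzero β β≉b) P≉0)
            (trans (sym Ñ-at-pole) Ñ≈0))
          (Ẽ-nonzero {E} E≉0) (λ {x} → Ẽ-positive {E} 0<E {x}))
        where
        z v n₀ n′ e e′ P y κ : Carrier
        z  = - b
        v  = ⟦ V β ⟧ z
        n₀ = ⟦ N ⟧ z
        n′ = ⟦ ∂ N ⟧ z
        e  = ⟦ E ⟧ z
        e′ = ⟦ ∂ E ⟧ z
        P  = eval p₀ z
        y  = ⟦ Y β p ⟧ z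
        κ  = ν 0

        -- With `ν 0 ≈ 0` and `t` vanishing at `z`, the only surviving contribution is that of
        -- `p₀ / t`.
        Ñ-at-pole : ⟦ Ñ 0 N E p₀ p ⟧ z ≈ e * e * (v * P)
        Ñ-at-pole = begin
          ⟦ Ñ 0 N E p₀ p ⟧ z
            ≈⟨ solve 9 (λ s v n n′ e e′ P y κ →
                 v :* ((s :* (n′ :* e) :+ (:- κ) :* (n :* e)) :+ (:- con 1ℚ) :* (s :* (n :* e′)))
                   :+ con 1ℚ :* (e :* e) :* (v :* P :+ s :* y) :=
                 e :* e :* (v :* P) :+ (s :* (v :* (n′ :* e :- n :* e′)
                   :+ e :* e :* y) :- κ :* (v :* (n :* e))))
                 refl (⟦ t ⟧ z) v n₀ n′ e e′ P y κ ⟩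
          e * e * (v * P) + (⟦ t ⟧ z * (v * (n′ * e - n₀ * e′) + e * e * y)
                               - κ * (v * (n₀ * e)))
            ≈⟨ +-congˡ (+-cong (trans (*-congʳ at-pole) (zeroˡ _))
                 (-‿cong (trans (*-congʳ ι-0) (zeroˡ _)))) ⟩
          e * e * (v * P) + (0# - 0#)
            ≈⟨ solve 1 (λ w → w :+ (con 0ℚ :- con 0ℚ) := w) refl _ ⟩
          e * e * (v * P) ∎
      ... | yes P≈0 = differentiate 0 N E p₀ p 0<E
        (finite-⊆ (λ { x (0<x , H≈0) → 0<x ,
            *-cancelˡ-≈ (t-pos 0<x) (trans (sym (factored x)) (trans H≈0 (sym (zeroʳ _)))) })
          (finite-regular n M (Ẽ E) (derivative p₀) (derivatives p)
            (length-derivative p₀ le₀) (λ j → length-derivative (p j) (le j))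
            (derivative-NonVanishing p₀ P≈0 p₀≢0)
            (Ẽ-nonzero {E} E≉0) (λ {x} → Ẽ-positive {E} 0<E {x})))
        where
        q : Poly
        q = divide (- b) p₀

        -- `Ñ 0 N E p₀ p` with its factor `t` removed: `q` stands for `p₀ / t`, and the term with
        -- coefficient `ν 0` is gone.
        M : Expr
        M = (V β ⊗ ((∂ N ⊗ E) ⊕ (const (- 1#) ⊗ (N ⊗ ∂ E))))
          ⊕ ((E ⊗ E) ⊗ ((V β ⊗ poly q) ⊕ Y β p))

        factored : ∀ x → H 1 (Ñ 0 N E p₀ p) (Ẽ E) (derivative p₀) (derivatives p) x
                       ≈ ⟦ t ⟧ x * H 0 M (Ẽ E) (derivative p₀) (derivatives p) x
        factored x = begin
          H 1 (Ñ 0 N E p₀ p) (Ẽ E) (derivative p₀) (derivatives p) x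
            ≈⟨ +-congʳ (+-cong
                 (*-congˡ (+-congʳ (+-congˡ (*-congʳ (-‿cong ι-0)))))
                 (*-congˡ (+-congʳ (*-congˡ (eval-root p₀ P≈0 x))))) ⟩
          (v * ((s * (n′ * e) + - 0# * (n₀ * e)) + - 1# * (s * (n₀ * e′)))
            + 1# * (e * e) * (v * ((x - - b) * Q) + s * y))
            + (s * 1#) * (e * e * v) * L
            ≈⟨ solve 11 (λ x b v n n′ e e′ Q y L s →
                 (v :* (((x :+ b) :* (n′ :* e) :+ (:- con 0ℚ) :* (n :* e))
                     :+ (:- con 1ℚ) :* ((x :+ b) :* (n :* e′)))
                   :+ con 1ℚ :* (e :* e) :* (v :* ((x :- :- b) :* Q) :+ (x :+ b) :* y))
                   :+ ((x :+ b) :* con 1ℚ) :* (e :* e :* v) :* L :=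
                 (x :+ b) :* ((v :* (n′ :* e :+ (:- con 1ℚ) :* (n :* e′))
                     :+ e :* e :* (v :* Q :+ y)) :+ con 1ℚ :* (e :* e :* v) :* L))
                 refl x b v n₀ n′ e e′ Q y L s ⟩
          s * H 0 M (Ẽ E) (derivative p₀) (derivatives p) x ∎
          where
          s v n₀ n′ e e′ Q y L : Carrier
          s  = ⟦ t ⟧ x
          v  = ⟦ V β ⟧ x
          n₀ = ⟦ N ⟧ x
          n′ = ⟦ ∂ N ⟧ x
          e  = ⟦ E ⟧ x
          e′ = ⟦ ∂ E ⟧ x
          Q  = eval q x
          y  = ⟦ Y β p ⟧ x
          L  = F (derivative p₀) (derivatives p) x

    -- A nonzero `p i` is singled out and the other summands are indexed through `punchIn i`. With
    -- `k = 0`, `N = 0` and `E = 1` the numerator `H` is the sum itself. The ordering from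
    -- `b zero ≈ 0#` upwards makes the shifts nonnegative and distinct.
    logSum-finitely-many-zeros : ∀ {d} (b : Fin (suc d) → Carrier) (p : Fin (suc d) → Poly) →
      b zero ≈ 0# → (∀ i j → i Fin.< j → b i < b j) → ¬ (∀ i → IsZero (p i)) →
      FinitelyMany (λ x → 0# < x × logSum p b x ≈ 0#)
    logSum-finitely-many-zeros {d} b p b₀≈0 b-mono p≢0 with em {∃[ i ] ¬ IsZero (p i)}
    ... | no none = contradiction all-zero p≢0
      where
      all-zero : ∀ i → IsZero (p i)
      all-zero i with em {IsZero (p i)}
      ... | yes pᵢ≡0 = pᵢ≡0
      ... | no  pᵢ≢0 = contradiction (i , pᵢ≢0) none
    ... | yes (i , pᵢ≢0) = finite-⊆
      (λ { x (0<x , sum≈0) → 0<x , trans (trans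
        (solve 1 (λ w → con 0ℚ :+ con 1ℚ :* con 1ℚ :* w := w) refl _)
        (sym (sum-remove {i = i} (λ j → eval (p j) x * log (x + b j))))) sum≈0 })
      (finite-regular (b i) (λ j → b (Fin.punchIn i j)) (0≤b i)
        (λ j → 0≤b (Fin.punchIn i j)) b-distinct
        (proj₁ bound) (const 0#) (const 1#) (p i) (λ j → p (Fin.punchIn i j))
        (proj₂ bound i) (λ j → proj₂ bound (Fin.punchIn i j))
        (¬IsZero⇒NonVanishing (p i) pᵢ≢0)
        (λ 1≈0 → <-irrefl (<-resp-≈ refl 1≈0 0<1)) (λ _ → 0<1))
      where
      0≤b : ∀ i → 0# ≤ b i
      0≤b zero    = ≤-reflexive (sym b₀≈0)
      0≤b (suc i) = <⇒≤ (<-resp-≈ b₀≈0 refl (b-mono zero (suc i) (ℕ.s≤s ℕ.z≤n)))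

      b-distinct : ∀ j → ¬ b (Fin.punchIn i j) ≈ b i
      b-distinct j eq with Fin.<-cmp (Fin.punchIn i j) i
      ... | tri< lt _ _ = <-irrefl (<-resp-≈ eq refl (b-mono _ _ lt))
      ... | tri≈ _ same _ = Fin.punchInᵢ≢i i j same
      ... | tri> _ _ gt = <-irrefl (<-resp-≈ refl eq (b-mono _ _ gt))

      length-bound : ∀ {n} (p : Fin n → Poly) → ∃[ l ] ∀ j → length (p j) ℕ.≤ l
      length-bound {zero}  p = 0 , λ ()
      length-bound {suc n} p =
        let l , le = length-bound (λ j → p (suc j))
        in length (p zero) ℕ.⊔ l , λ where
             zero    → ℕ.m≤m⊔n _ _
             (suc j) → ℕ.≤-trans (le j) (ℕ.m≤n⊔m (length (p zero)) l)

      bound : ∃[ l ] ∀ j → length (p j) ℕ.≤ l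
      bound = length-bound p

    ν-+ : ∀ m n → ν (m ℕ.+ n) ≈ ν m + ν n
    ν-+ m n = trans (reflexive (≡.cong ι (fromℕℚ-+ m n))) (ι-+ (fromℕℚ m) (fromℕℚ n))

    ν-mono-< : ∀ {m n} → m ℕ.< n → ν m < ν n
    ν-mono-< {m} m<n = <-≤-trans (<-by (trans (+-congʳ (ν-suc m))
      (solve 1 (λ k → con 1ℚ :+ k :- k := con 1ℚ) refl (ν m))) 0<1) (ν-mono-≤ m<n)

    -- For the shifts `b i = i`, the relation exhibits every positive integer as a zero of a
    -- logarithmic sum, which would have only finitely many if some `p i` were nonzero.
    log-ν-independent : ∀ {d} (p : Fin (suc d) → Poly) →
      (∀ n → sum (λ i → eval (p i) (ν (suc n)) * log (ν (suc n ℕ.+ toℕ i))) ≈ 0#) →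
      ∀ i → IsZero (p i)
    log-ν-independent {d} p annihilates with em {∀ i → IsZero (p i)}
    ... | yes p≡0 = p≡0
    ... | no  p≢0 = contradiction
      (λ n → ν-suc-pos n , trans
        (sum-cong-≋ {suc d} λ i → *-congˡ {x = eval (p i) (ν (suc n))} (log-cong n i))
        (annihilates n))
      (finite⇒¬all-ν (logSum-finitely-many-zeros (λ i → ν (toℕ i)) p ι-0
        (λ _ _ → ν-mono-<) p≢0))
      where
      -- The two arguments agree only up to `≈`, which `log` respects at positive points because it
      -- is differentiable there.
      log-cong : ∀ n (i : Fin (suc d)) →
        log (ν (suc n) + ν (toℕ i)) ≈ log (ν (suc n ℕ.+ toℕ i))
      log-cong n i = derivative-cong
        (log′ (ν-suc-pos (n ℕ.+ toℕ i)) (proj₂ (reciprocal (ν-suc-pos (n ℕ.+ toℕ i)))))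
        (sym (ν-+ (suc n) (toℕ i)))

-- Cauchy sequences of rationals as a complete ordered field

open Defs

1/m*m≡1 : ∀ m .{{_ : ℕ.NonZero m}} → (+ 1 ℚ./ m) ℚ.* fromℕℚ m ≡ 1ℚ
1/m*m≡1 m@(suc k) = ℚ.toℚᵘ-injective (begin
  ℚ.toℚᵘ ((+ 1 ℚ./ m) ℚ.* fromℕℚ m)
    ≈⟨ ℚ.toℚᵘ-homo-* (+ 1 ℚ./ m) (fromℕℚ m) ⟩
  ℚ.toℚᵘ (+ 1 ℚ./ m) ℚᵘ.* ℚ.toℚᵘ (fromℕℚ m)
    ≈⟨ ℚᵘ.*-cong (ℚ.toℚᵘ-fromℚᵘ (mkℚᵘ (+ 1) k)) (toℚᵘ-fromℕℚ m) ⟩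
  mkℚᵘ (+ 1) k ℚᵘ.* mkℚᵘ (+ m) 0
    ≈⟨ ℚᵘ.*≡* (≡.trans (ℤ.*-identityʳ (+ 1 ℤ.* + m)) (≡.cong (λ j → + 1 ℤ.* + j)
         (≡.sym (ℕ.*-identityʳ m)))) ⟩
  ℚ.toℚᵘ 1ℚ ∎)
  where open ℚᵘ.≃-Reasoning

module ℚ-Solver = ℚSolver.+-*-Solver

<-sum : ∀ {p q r s} c {u v} → p ℚ.< q → r ℚ.< s →
  p ℚ.+ r ℚ.+ c ≡ u → q ℚ.+ s ℚ.+ c ≡ v → u ℚ.< v
<-sum c p<q r<s ≡.refl ≡.refl = ℚ.+-monoˡ-< c (ℚ.+-mono-< p<q r<s)

-- `x ≈ y` unfolds to `Null` of the termwise difference, so the laws of `≈` become closure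
-- properties of null sequences.
Null : (ℕ → ℚ) → Set
Null s = ∀ ε → 0ℚ ℚ.< ε → ∃[ N ] ∀ n → N ℕ.≤ n → ℚ.∣ s n ∣ ℚ.< ε

null-resp : ∀ {s t} → (∀ n → s n ≡ t n) → Null s → Null t
null-resp s≡t null ε 0<ε =
  let N , small = null ε 0<ε
  in N , λ n p → ≡.subst (λ q → ℚ.∣ q ∣ ℚ.< ε) (s≡t n) (small n p)

null-0 : Null (λ _ → 0ℚ)
null-0 ε 0<ε = 0 , λ _ _ → 0<ε

null-+ : ∀ {s t} → Null s → Null t → Null (λ n → s n ℚ.+ t n)
null-+ {s} {t} null-s null-t ε 0<ε =
  let M , small-s = null-s (½ ℚ.* ε) (0<half 0<ε)
      N , small-t = null-t (½ ℚ.* ε) (0<half 0<ε)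
  in M ℕ.⊔ N , λ n p → ℚ.≤-<-trans (ℚ.∣p+q∣≤∣p∣+∣q∣ (s n) (t n))
       (≡.subst (ℚ.∣ s n ∣ ℚ.+ ℚ.∣ t n ∣ ℚ.<_) (half+half ε)
         (ℚ.+-mono-< (small-s n (⊔≤ˡ p)) (small-t n (⊔≤ʳ {M} p))))

null-neg : ∀ {s} → Null s → Null (λ n → ℚ.- s n)
null-neg {s} null ε 0<ε =
  let N , small = null ε 0<ε
  in N , λ n p → ≡.subst (ℚ._< ε) (≡.sym (ℚ.∣-p∣≡∣p∣ (s n))) (small n p)

cauchy*null : ∀ {s t} → IsCauchy s → Null t → Null (λ n → s n ℚ.* t n)
cauchy*null {s} {t} cs null ε 0<ε =
  let B , 0<B , M , bounded = bounded-tail cs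
      δ , 0<δ , Bδ≡ε = divide B 0<B ε 0<ε
      N , small = null δ 0<δ
  in M ℕ.⊔ N , λ n p → ≡.subst (ℚ.∣ s n ℚ.* t n ∣ ℚ.<_) Bδ≡ε
       (*-mono-bound (s n) (t n) 0<B (bounded n (⊔≤ˡ p)) (small n (⊔≤ʳ {M} p)))

pointwise : ∀ x y → (∀ n → seq x n ≡ seq y n) → x ≈ y
pointwise x y eq = null-resp
  (λ n → ≡.sym (≡.trans (≡.cong (ℚ._- seq y n) (eq n)) (ℚ.+-inverseʳ (seq y n)))) null-0

≈-isEquivalence : IsEquivalence _≈_
≈-isEquivalence = record
  { refl  = λ {x} → pointwise x x λ _ → ≡.refl
  ; sym   = λ {x} {y} x≈y → null-resp
      (λ n → solve 2 (λ a b → :- (a :- b) := b :- a) ≡.refl (seq x n) (seq y n))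
      (null-neg x≈y)
  ; trans = λ {x} {y} {z} x≈y y≈z → null-resp
      (λ n → solve 3 (λ a b c → (a :- b) :+ (b :- c) := a :- c) ≡.refl
        (seq x n) (seq y n) (seq z n))
      (null-+ x≈y y≈z)
  }
  where open ℚ-Solver

ℝ-commutativeRing : CommutativeRing 0ℓ 0ℓ
ℝ-commutativeRing = record
  { Carrier = ℝ ; _≈_ = _≈_ ; _+_ = _+_ ; _*_ = _*_ ; -_ = -_ ; 0# = 0ℝ ; 1# = 1ℝ
  ; isCommutativeRing = record
    { isRing = record
      { +-isAbelianGroup = record
        { isGroup = record
          { isMonoid = record
            { isSemigroup = record
              { isMagma = record
                { isEquivalence = ≈-isEquivalence
                ; ∙-cong = λ {x} {y} {u} {v} x≈y u≈v → null-resp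
                    (λ n → solve 4 (λ a b c d → (a :- b) :+ (c :- d) := (a :+ c) :- (b :+ d))
                      ≡.refl (seq x n) (seq y n) (seq u n) (seq v n))
                    (null-+ x≈y u≈v)
                }
              ; assoc = λ x y z → pointwise ((x + y) + z) (x + (y + z))
                  λ n → ℚ.+-assoc (seq x n) (seq y n) (seq z n)
              }
            ; identity = (λ x → pointwise (0ℝ + x) x λ n → ℚ.+-identityˡ (seq x n)) ,
                         (λ x → pointwise (x + 0ℝ) x λ n → ℚ.+-identityʳ (seq x n))
            }
          ; inverse = (λ x → pointwise (- x + x) 0ℝ λ n → ℚ.+-inverseˡ (seq x n)) ,
                      (λ x → pointwise (x + - x) 0ℝ λ n → ℚ.+-inverseʳ (seq x n))
          ; ⁻¹-cong = λ {x} {y} x≈y → null-resp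
              (λ n → solve 2 (λ a b → :- (a :- b) := (:- a) :- (:- b)) ≡.refl
                (seq x n) (seq y n))
              (null-neg x≈y)
          }
        ; comm = λ x y → pointwise (x + y) (y + x) λ n → ℚ.+-comm (seq x n) (seq y n)
        }
      ; *-cong = λ {x} {y} {u} {v} x≈y u≈v → null-resp
          (λ n → solve 4 (λ a b c d → a :* (c :- d) :+ d :* (a :- b) := a :* c :- b :* d)
            ≡.refl (seq x n) (seq y n) (seq u n) (seq v n))
          (null-+ {λ n → seq x n ℚ.* (seq u n ℚ.- seq v n)}
                  {λ n → seq v n ℚ.* (seq x n ℚ.- seq y n)}
            (cauchy*null {seq x} (cauchy x) u≈v) (cauchy*null {seq v} (cauchy v) x≈y))
      ; *-assoc = λ x y z → pointwise ((x * y) * z) (x * (y * z))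
          λ n → ℚ.*-assoc (seq x n) (seq y n) (seq z n)
      ; *-identity = (λ x → pointwise (1ℝ * x) x λ n → ℚ.*-identityˡ (seq x n)) ,
                     (λ x → pointwise (x * 1ℝ) x λ n → ℚ.*-identityʳ (seq x n))
      ; distrib =
          (λ x y z → pointwise (x * (y + z)) (x * y + x * z)
            λ n → ℚ.*-distribˡ-+ (seq x n) (seq y n) (seq z n)) ,
          (λ x y z → pointwise ((y + z) * x) (y * x + z * x)
            λ n → ℚ.*-distribʳ-+ (seq x n) (seq y n) (seq z n))
      }
    ; *-comm = λ x y → pointwise (x * y) (y * x) λ n → ℚ.*-comm (seq x n) (seq y n)
    }
  }
  where open ℚ-Solver

∣∣<⇒< : ∀ {p ε} → ℚ.∣ p ∣ ℚ.< ε → p ℚ.< ε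
∣∣<⇒< {p} = ℚ.≤-<-trans (p≤∣p∣ p)
  where
  p≤∣p∣ : ∀ p → p ℚ.≤ ℚ.∣ p ∣
  p≤∣p∣ p with ℚ.∣p∣≡p∨∣p∣≡-p p | ℚ.≤-total 0ℚ p
  ... | inj₁ eq | _        = ℚ.≤-reflexive (≡.sym eq)
  ... | inj₂ _  | inj₁ 0≤p = ℚ.≤-reflexive (≡.sym (ℚ.0≤p⇒∣p∣≡p 0≤p))
  ... | inj₂ _  | inj₂ p≤0 = ℚ.≤-trans p≤0 (ℚ.0≤∣p∣ p)

∣∣<⇒-< : ∀ {p ε} → ℚ.∣ p ∣ ℚ.< ε → ℚ.- p ℚ.< ε
∣∣<⇒-< {p} {ε} ∣p∣<ε = ∣∣<⇒< (≡.subst (ℚ._< ε) (≡.sym (ℚ.∣-p∣≡∣p∣ p)) ∣p∣<ε)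

<-respʳ-≈ : ∀ {x y y′} → y ≈ y′ → x < y → x < y′
<-respʳ-≈ {x} {y} {y′} y≈y′ (ε , 0<ε , M , gap) =
  let N , close = y≈y′ (½ ℚ.* ε) (0<half 0<ε)
  in ½ ℚ.* ε , 0<half 0<ε , M ℕ.⊔ N , λ n p →
       <-sum (seq y′ n ℚ.- seq y n ℚ.- ½ ℚ.* ε) (gap n (⊔≤ˡ p)) (∣∣<⇒< (close n (⊔≤ʳ {M} p)))
         (solve 4 (λ x y z e → x :+ e :+ (y :- z) :+ (z :- y :- con ½ :* e) :=
             x :+ con ½ :* e) ≡.refl (seq x n) (seq y n) (seq y′ n) ε)
         (solve 3 (λ y z e → y :+ con ½ :* e :+ (z :- y :- con ½ :* e) := z) ≡.refl
           (seq y n) (seq y′ n) ε)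
  where open ℚ-Solver

<-respˡ-≈ : ∀ {x x′ y} → x ≈ x′ → x < y → x′ < y
<-respˡ-≈ {x} {x′} {y} x≈x′ (ε , 0<ε , M , gap) =
  let N , close = x≈x′ (½ ℚ.* ε) (0<half 0<ε)
  in ½ ℚ.* ε , 0<half 0<ε , M ℕ.⊔ N , λ n p →
       <-sum (ℚ.- (½ ℚ.* ε)) (gap n (⊔≤ˡ p)) (∣∣<⇒-< (close n (⊔≤ʳ {M} p)))
         (solve 3 (λ x z e → x :+ e :+ (:- (x :- z)) :+ (:- (con ½ :* e)) :=
             z :+ con ½ :* e) ≡.refl (seq x n) (seq x′ n) ε)
         (solve 2 (λ y e → y :+ con ½ :* e :+ (:- (con ½ :* e)) := y) ≡.refl (seq y n) ε)
  where open ℚ-Solver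

p<p+ε : ∀ p {ε} → 0ℚ ℚ.< ε → p ℚ.< p ℚ.+ ε
p<p+ε p {ε} 0<ε = ≡.subst (ℚ._< p ℚ.+ ε) (ℚ.+-identityʳ p) (ℚ.+-monoʳ-< p 0<ε)

-- Each sequence moves by less than a quarter of `δ` away from its value at index `n`, so half of
-- the gap seen at that one index remains uniformly.
<-persists : ∀ u v δ → 0ℚ ℚ.< δ → ∀ n N →
  (∀ m → N ℕ.≤ m → ℚ.∣ seq u n ℚ.- seq u m ∣ ℚ.< ½ ℚ.* (½ ℚ.* δ)) →
  (∀ m → N ℕ.≤ m → ℚ.∣ seq v n ℚ.- seq v m ∣ ℚ.< ½ ℚ.* (½ ℚ.* δ)) →
  δ ℚ.< seq v n ℚ.- seq u n → u < v
<-persists u v δ 0<δ n N close-u close-v δ<v-u = ½ ℚ.* δ , 0<half 0<δ , N , λ m q →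
  <-sum (seq u n ℚ.- seq v n ℚ.+ seq v m ℚ.- ½ ℚ.* δ)
    (ℚ.+-mono-< (∣∣<⇒-< (close-u m q)) (∣∣<⇒< (close-v m q))) δ<v-u
    (solve 5 (λ a b c d e →
        (:- (a :- b)) :+ (c :- d) :+ e :+ (a :- c :+ d :- con ½ :* e) := b :+ con ½ :* e)
      ≡.refl (seq u n) (seq u m) (seq v n) (seq v m) δ)
    (solve 4 (λ a c d e → let q = con ½ :* (con ½ :* e) in
        q :+ q :+ (c :- a) :+ (a :- c :+ d :- con ½ :* e) := d)
      ≡.refl (seq u n) (seq v n) (seq v m) δ)
  where open ℚ-Solver

-- Excluded middle decides both strict inequalities. If neither holds, no late difference can exceed
-- half of `ε`, since `<-persists` would turn it into one of them; hence the difference is null.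
ℝ-<-cmp : ExcludedMiddle 0ℓ → ∀ x y → x < y ⊎ x ≈ y ⊎ y < x
ℝ-<-cmp em x y with em {x < y} | em {y < x}
... | yes x<y | _       = inj₁ x<y
... | no  _   | yes y<x = inj₂ (inj₂ y<x)
... | no  x≮y | no  y≮x = inj₂ (inj₁ x≈y)
  where
  x≈y : x ≈ y
  x≈y ε 0<ε =
    let δ   = ½ ℚ.* ε
        0<δ = 0<half 0<ε
        0<η = 0<half (0<half 0<δ)
        M , close-x = cauchy x _ 0<η
        N , close-y = cauchy y _ 0<η
        δ<ε = ≡.subst (δ ℚ.<_) (half+half ε) (p<p+ε δ 0<δ)
        late-x : ∀ n → M ℕ.⊔ N ℕ.≤ n → ∀ m → M ℕ.⊔ N ℕ.≤ m → _
        late-x = λ n p m q → close-x n m (⊔≤ˡ p) (⊔≤ˡ q)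
        late-y : ∀ n → M ℕ.⊔ N ℕ.≤ n → ∀ m → M ℕ.⊔ N ℕ.≤ m → _
        late-y = λ n p m q → close-y n m (⊔≤ʳ {M} p) (⊔≤ʳ {M} q)
    in M ℕ.⊔ N , λ n p → ∣∣<-intro
         (ℚ.≤-<-trans (ℚ.≮⇒≥ λ large →
           y≮x (<-persists y x δ 0<δ n (M ℕ.⊔ N) (late-y n p) (late-x n p) large)) δ<ε)
         (ℚ.≤-<-trans (ℚ.≮⇒≥ λ large →
           x≮y (<-persists x y δ 0<δ n (M ℕ.⊔ N) (late-x n p) (late-y n p)
             (≡.subst (δ ℚ.<_)
               (solve 2 (λ a b → :- (a :- b) := b :- a) ≡.refl (seq x n) (seq y n)) large)))
           δ<ε)
    where open ℚ-Solver

-- Total, with value `0` at `0`: the sequence of a positive real is bounded away from zero only from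
-- some index on, and earlier terms may vanish.
inverse : ℚ → ℚ
inverse p with p ℚ.≟ 0ℚ
... | yes _   = 0ℚ
... | no  p≢0 = (ℚ.1/ p) {{ℚ.≢-nonZero p≢0}}

*-inverse : ∀ {p} → 0ℚ ℚ.< p → p ℚ.* inverse p ≡ 1ℚ
*-inverse {p} 0<p with p ℚ.≟ 0ℚ
... | yes p≡0 = contradiction 0<p (ℚ.<-irrefl (≡.sym p≡0))
... | no  p≢0 = ℚ.*-inverseʳ p {{ℚ.≢-nonZero p≢0}}

inverse-pos : ∀ {p} → 0ℚ ℚ.< p → 0ℚ ℚ.< inverse p
inverse-pos {p} 0<p = ℚ.*-cancelˡ-<-nonNeg p {{ℚ.pos⇒nonNeg p {{ℚ.positive 0<p}}}}
  (≡.subst₂ ℚ._<_ (≡.sym (ℚ.*-zeroʳ p)) (≡.sym (*-inverse 0<p)) (ℚ.positive⁻¹ 1ℚ))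

inverse-antimono : ∀ {p q} → 0ℚ ℚ.< p → p ℚ.< q → inverse q ℚ.≤ inverse p
inverse-antimono {p} {q} 0<p p<q = ℚ.*-cancelˡ-≤-pos q {{ℚ.positive 0<q}}
  (≡.subst (ℚ._≤ q ℚ.* inverse p) (≡.trans (*-inverse 0<p) (≡.sym (*-inverse 0<q)))
    (ℚ.*-monoʳ-≤-nonNeg (inverse p)
      {{ℚ.pos⇒nonNeg (inverse p) {{ℚ.positive (inverse-pos 0<p)}}}} (ℚ.<⇒≤ p<q)))
  where
  0<q : 0ℚ ℚ.< q
  0<q = ℚ.<-trans 0<p p<q

inverse-difference : ∀ {p q} → 0ℚ ℚ.< p → 0ℚ ℚ.< q →
  (inverse p ℚ.* inverse q) ℚ.* (q ℚ.- p) ≡ inverse p ℚ.- inverse q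
inverse-difference {p} {q} 0<p 0<q = ≡.trans
  (solve 4 (λ p q i j → (i :* j) :* (q :- p) := (q :* j) :* i :- (p :* i) :* j)
    ≡.refl p q (inverse p) (inverse q))
  (≡.cong₂ ℚ._-_
    (≡.trans (≡.cong (ℚ._* inverse p) (*-inverse 0<q)) (ℚ.*-identityˡ (inverse p)))
    (≡.trans (≡.cong (ℚ._* inverse q) (*-inverse 0<p)) (ℚ.*-identityˡ (inverse q))))
  where open ℚ-Solver

drop-0+ : ∀ p {q} → 0ℚ ℚ.+ p ℚ.< q → p ℚ.< q
drop-0+ p {q} = ≡.subst (ℚ._< q) (ℚ.+-identityˡ p)

-- By `1/p - 1/q = (q - p) / (p q)`, inversion of terms above `δ` stretches distances by at most the
-- factor `K²` with `K = 1 / δ`.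
inverse-cauchy : ∀ s δ → 0ℚ ℚ.< δ → ∀ N → (∀ n → N ℕ.≤ n → δ ℚ.< s n) → IsCauchy s →
  IsCauchy (λ n → inverse (s n))
inverse-cauchy s δ 0<δ N δ<s cs ε 0<ε =
  let K = inverse δ
      0<K = ℚ.positive (inverse-pos 0<δ)
      K²>0 = ℚ.pos*pos⇒pos K {{0<K}} K {{0<K}}
      η , 0<η , K²η≡ε = divide (K ℚ.* K) K²>0 ε 0<ε
      M , close = cs η 0<η
      nonNeg : ∀ {n} → N ℕ.≤ n → ℚ.NonNegative (inverse (s n))
      nonNeg p = ℚ.nonNegative (ℚ.<⇒≤ (inverse-pos (ℚ.<-trans 0<δ (δ<s _ p))))
      bounded : ∀ {n} → N ℕ.≤ n → ℚ.∣ inverse (s n) ∣ ℚ.≤ K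
      bounded {n} p = ≡.subst (ℚ._≤ K)
        (≡.sym (ℚ.0≤p⇒∣p∣≡p (ℚ.nonNegative⁻¹ (inverse (s n)) {{nonNeg p}})))
        (inverse-antimono 0<δ (δ<s n p))
  in N ℕ.⊔ M , λ m n p q → ≡.subst₂ (λ a b → ℚ.∣ a ∣ ℚ.< b)
       (inverse-difference (ℚ.<-trans 0<δ (δ<s m (⊔≤ˡ p))) (ℚ.<-trans 0<δ (δ<s n (⊔≤ˡ q))))
       K²η≡ε
       (*-mono-bound (inverse (s m) ℚ.* inverse (s n)) (s n ℚ.- s m) K²>0
         (≡.subst (ℚ._≤ K ℚ.* K) (≡.sym (ℚ.∣p*q∣≡∣p∣*∣q∣ (inverse (s m)) (inverse (s n))))
           (ℚ.≤-trans
             (ℚ.*-monoʳ-≤-nonNeg ℚ.∣ inverse (s n) ∣ {{ℚ.∣-∣-nonNeg (inverse (s n))}}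
               (bounded (⊔≤ˡ p)))
             (ℚ.*-monoˡ-≤-nonNeg K {{ℚ.pos⇒nonNeg K {{0<K}}}} (bounded (⊔≤ˡ q)))))
         (close n m (⊔≤ʳ {N} q) (⊔≤ʳ {N} p)))

ℝ-reciprocal : ∀ {x} → 0ℝ < x → ∃[ y ] x * y ≈ 1ℝ
ℝ-reciprocal {x} (δ , 0<δ , N , δ<x) =
  mkℝ (λ n → inverse (seq x n))
    (inverse-cauchy (seq x) δ 0<δ N (λ n p → drop-0+ δ (δ<x n p)) (cauchy x)) ,
  λ ε 0<ε → N , λ n p → ≡.subst (λ q → ℚ.∣ q ∣ ℚ.< ε)
    (≡.sym (≡.trans
      (≡.cong (ℚ._- 1ℚ) (*-inverse (ℚ.<-trans 0<δ (drop-0+ δ (δ<x n p)))))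
      (ℚ.+-inverseʳ 1ℚ)))
    0<ε

+½<ε : ∀ {p ε} → p ℚ.< ½ ℚ.* ε → p ℚ.+ ½ ℚ.* ε ℚ.< ε
+½<ε {p} {ε} p<½ε =
  ≡.subst (p ℚ.+ ½ ℚ.* ε ℚ.<_) (half+half ε) (ℚ.+-monoˡ-< (½ ℚ.* ε) p<½ε)

ι-close : ∀ {x q ε} → 0ℚ ℚ.< ε → ∀ N →
  (∀ n → N ℕ.≤ n → ℚ.∣ seq x n ℚ.- q ∣ ℚ.< ½ ℚ.* ε) →
  x - ι q < ι ε × ι q - x < ι ε
ι-close {x} {q} {ε} 0<ε N close =
  (½ ℚ.* ε , 0<half 0<ε , N , λ n p → +½<ε (∣∣<⇒< (close n p))) ,
  (½ ℚ.* ε , 0<half 0<ε , N , λ n p → +½<ε (≡.subst (ℚ._< ½ ℚ.* ε)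
    (solve 2 (λ a b → :- (a :- b) := b :- a) ≡.refl (seq x n) q) (∣∣<⇒-< (close n p))))
  where open ℚ-Solver

ℝ-realField : ExcludedMiddle 0ℓ → RealField
ℝ-realField em = record
  { commutativeRing = ℝ-commutativeRing
  ; _<_ = _<_
  ; <-resp-≈ = λ {x} {x′} {y} {y′} x≈x′ y≈y′ x<y →
      <-respʳ-≈ {x′} {y} {y′} y≈y′ (<-respˡ-≈ {x} {x′} {y} x≈x′ x<y)
  ; <-irrefl = λ {x} → λ { (ε , 0<ε , N , gap) →
      ℚ.<-asym (gap N ℕ.≤-refl) (p<p+ε (seq x N) 0<ε) }
  ; <-trans = λ {x} {y} {z} → λ { (ε , 0<ε , M , gap) (η , 0<η , N , gap′) →
      ε , 0<ε , M ℕ.⊔ N , λ n p → ℚ.<-trans (gap n (⊔≤ˡ p))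
        (ℚ.<-trans (p<p+ε (seq y n) 0<η) (gap′ n (⊔≤ʳ {M} p))) }
  ; <-cmp = ℝ-<-cmp em
  ; +-monoʳ-< = λ z {x} {y} → λ { (ε , 0<ε , N , gap) → ε , 0<ε , N , λ n p →
      ≡.subst (ℚ._< seq z n ℚ.+ seq y n)
        (≡.sym (ℚ.+-assoc (seq z n) (seq x n) ε)) (ℚ.+-monoʳ-< (seq z n) (gap n p)) }
  ; *-pos = λ {x} {y} → λ { (ε , 0<ε , M , gap) (η , 0<η , N , gap′) →
      ε ℚ.* η ,
      ℚ.positive⁻¹ (ε ℚ.* η)
        {{ℚ.pos*pos⇒pos ε {{ℚ.positive 0<ε}} η {{ℚ.positive 0<η}}}} ,
      M ℕ.⊔ N , λ n p →
        let ε<x = drop-0+ ε (gap n (⊔≤ˡ p))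
            η<y = drop-0+ η (gap′ n (⊔≤ʳ {M} p))
        in ≡.subst (ℚ._< seq x n ℚ.* seq y n) (≡.sym (ℚ.+-identityˡ (ε ℚ.* η)))
          (ℚ.<-trans (ℚ.*-monoʳ-<-pos ε {{ℚ.positive 0<ε}} η<y)
            (ℚ.*-monoˡ-<-pos (seq y n) {{ℚ.positive (ℚ.<-trans 0<η η<y)}} ε<x)) }
  ; reciprocal = λ {x} → ℝ-reciprocal {x}
  ; ι = ι
  ; ι-+ = λ p q → pointwise (ι (p ℚ.+ q)) (ι p + ι q) λ _ → ≡.refl
  ; ι-* = λ p q → pointwise (ι (p ℚ.* q)) (ι p * ι q) λ _ → ≡.refl
  ; ι-neg = λ p → pointwise (ι (ℚ.- p)) (- ι p) λ _ → ≡.refl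
  ; ι-0 = pointwise (ι 0ℚ) 0ℝ λ _ → ≡.refl
  ; ι-1 = pointwise (ι 1ℚ) 1ℝ λ _ → ≡.refl
  -- The gap `ε` has to satisfy `p + ε < q` strictly, so it reaches only to an intermediate rational
  -- `m`.
  ; ι-< = λ {p} {q} p<q → let m , p<m , m<q = ℚ.<-dense p<q in
      m ℚ.- p ,
      ≡.subst (ℚ._< m ℚ.- p) (ℚ.+-inverseʳ p) (ℚ.+-monoˡ-< (ℚ.- p) p<m) ,
      0 , λ _ _ → ≡.subst (ℚ._< q)
        (solve 2 (λ m p → m := p :+ (m :- p)) ≡.refl m p) m<q
  ; archimedean = λ { (ε , 0<ε , N , gap) → ½ ℚ.* ε , 0<half 0<ε ,
      ½ ℚ.* ε , 0<half 0<ε , N , λ n p →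
        ≡.subst (ℚ._< _) (≡.sym (half+half ε)) (drop-0+ ε (gap n p)) }
  ; approximate = λ x ε 0<ε → let N , close = cauchy x (½ ℚ.* ε) (0<half 0<ε) in
      seq x N , ι-close {x} 0<ε N λ n p → close n N p ℕ.≤-refl
  -- A rational Cauchy sequence is itself a real number, and that number is its limit.
  ; complete = λ q q-cauchy → mkℝ q q-cauchy , λ ε 0<ε →
      let N , close = q-cauchy (½ ℚ.* ε) (0<half 0<ε)
      in N , λ n p →
        let above , below = ι-close {mkℝ q q-cauchy} {q n} 0<ε N λ m r → close m n r p
        in below , above
  }
  where open ℚ-Solver

-- The real logarithm and complex recurrences

1/k! : ℕ → ℚ
1/k! k = (+ 1 ℚ./ (k ℕ.!)) {{k ℕ.!≢0}}

1/k!-suc : ∀ k → fromℕℚ (suc k) ℚ.* 1/k! (suc k) ≡ 1/k! k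
1/k!-suc k = begin
  a ℚ.* h                  ≡⟨ ℚ.*-identityʳ (a ℚ.* h) ⟨
  a ℚ.* h ℚ.* 1ℚ           ≡⟨ ≡.cong (a ℚ.* h ℚ.*_) (1/m*m≡1 (k ℕ.!) {{k ℕ.!≢0}}) ⟨
  a ℚ.* h ℚ.* (g ℚ.* f)
    ≡⟨ solve 4 (λ a h g f → a :* h :* (g :* f) := g :* (h :* (a :* f))) ≡.refl a h g f ⟩
  g ℚ.* (h ℚ.* (a ℚ.* f))  ≡⟨ ≡.cong (λ e → g ℚ.* (h ℚ.* e)) (fromℕℚ-* (suc k) (k ℕ.!)) ⟨
  g ℚ.* (h ℚ.* fromℕℚ (suc k ℕ.!))
    ≡⟨ ≡.cong (g ℚ.*_) (1/m*m≡1 (suc k ℕ.!) {{suc k ℕ.!≢0}}) ⟩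
  g ℚ.* 1ℚ                 ≡⟨ ℚ.*-identityʳ g ⟩
  g                        ∎
  where
  open ≡.≡-Reasoning
  open ℚ-Solver
  a f g h : ℚ
  a = fromℕℚ (suc k)
  f = fromℕℚ (k ℕ.!)
  g = 1/k! k
  h = 1/k! (suc k)

valueOr0-satisfies : {P : ℝ → Set} (dec : Dec (∃ P)) → ∃ P → P (valueOr0 dec)
valueOr0-satisfies (yes (_ , Py)) _  = Py
valueOr0-satisfies (no  none)     ∃P = contradiction ∃P none

-- The imaginary part of the argument is the constant sequence zero, so Horner's rule never mixes
-- the two parts; the equality already holds term by term on representatives.
re-eval : ∀ p x n →
  seq (re (ℂ[x].eval p (ofReal x))) n ≡ seq (ℝ[x].eval (map re p) x) n
re-eval []      x n = ≡.refl
re-eval (a ∷ p) x n = ≡.cong (seq (re a) n ℚ.+_) (≡.trans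
  (solve 3 (λ x u v → x :* u :- con 0ℚ :* v := x :* u) ≡.refl (seq x n)
    (seq (re (ℂ[x].eval p (ofReal x))) n) (seq (im (ℂ[x].eval p (ofReal x))) n))
  (≡.cong (seq x n ℚ.*_) (re-eval p x n)))
  where open ℚ-Solver

im-eval : ∀ p x n →
  seq (im (ℂ[x].eval p (ofReal x))) n ≡ seq (ℝ[x].eval (map im p) x) n
im-eval []      x n = ≡.refl
im-eval (a ∷ p) x n = ≡.cong (seq (im a) n ℚ.+_) (≡.trans
  (solve 3 (λ x u v → x :* v :+ con 0ℚ :* u := x :* v) ≡.refl (seq x n)
    (seq (re (ℂ[x].eval p (ofReal x))) n) (seq (im (ℂ[x].eval p (ofReal x))) n))
  (≡.cong (seq x n ℚ.*_) (im-eval p x n)))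
  where open ℚ-Solver

module ℂ-raw = RawRing ℂ-rawRing
open RawSemiringDefs ℂ-raw.rawSemiring using () renaming (sum to sumℂ)

re-sum : ∀ {d} (p : Fin d → ℂ[x].Poly) x (L : Fin d → ℝ) n →
  seq (re (sumℂ λ i → ℂ[x].eval (p i) (ofReal x) ℂ-raw.* ofReal (L i))) n ≡
  seq (sum λ i → ℝ[x].eval (map re (p i)) x * L i) n
re-sum {zero}  p x L n = ≡.refl
re-sum {suc d} p x L n = ≡.cong₂ ℚ._+_
  (≡.trans
    (solve 3 (λ u v l → u :* l :- v :* con 0ℚ := u :* l) ≡.refl
      (seq (re (ℂ[x].eval (p zero) (ofReal x))) n)
      (seq (im (ℂ[x].eval (p zero) (ofReal x))) n) (seq (L zero) n))
    (≡.cong (ℚ._* seq (L zero) n) (re-eval (p zero) x n)))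
  (re-sum (λ i → p (suc i)) x (λ i → L (suc i)) n)
  where open ℚ-Solver

im-sum : ∀ {d} (p : Fin d → ℂ[x].Poly) x (L : Fin d → ℝ) n →
  seq (im (sumℂ λ i → ℂ[x].eval (p i) (ofReal x) ℂ-raw.* ofReal (L i))) n ≡
  seq (sum λ i → ℝ[x].eval (map im (p i)) x * L i) n
im-sum {zero}  p x L n = ≡.refl
im-sum {suc d} p x L n = ≡.cong₂ ℚ._+_
  (≡.trans
    (solve 3 (λ u v l → u :* con 0ℚ :+ v :* l := v :* l) ≡.refl
      (seq (re (ℂ[x].eval (p zero) (ofReal x))) n)
      (seq (im (ℂ[x].eval (p zero) (ofReal x))) n) (seq (L zero) n))
    (≡.cong (ℚ._* seq (L zero) n) (im-eval (p zero) x n)))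
  (im-sum (λ i → p (suc i)) x (λ i → L (suc i)) n)
  where open ℚ-Solver

pointwise-≈0 : ∀ x y → (∀ n → seq x n ≡ seq y n) → x ≈ 0ℝ → y ≈ 0ℝ
pointwise-≈0 x y eq = null-resp (λ n → ≡.cong (ℚ._- 0ℚ) (eq n))

module RealLogarithm (em : ExcludedMiddle 0ℓ) where

  open module Real = Analysis (ℝ-realField em) em
    using (module Exponential; module LogarithmicSums)

  open Exponential (λ k → ι (1/k! k)) (pointwise (ι (1/k! 0)) 1ℝ λ _ → ≡.refl)
    (λ k → pointwise (fromℕ (suc k) * ι (1/k! (suc k))) (ι (1/k! k)) λ _ → 1/k!-suc k)

  -- Surjectivity of the exponential onto the positive reals rules out the fallback value in
  -- `valueOr0`.
  log-exp : ∀ {x} → 0ℝ < x → ExpIs (log em x) x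
  log-exp {x} 0<x = valueOr0-satisfies (em {∃[ y ] ExpIs y x}) (partialSum-surjective {x} 0<x)

  open LogarithmicSums (log em) (log-derivative (log em) (λ {x} → log-exp {x})) public
    using (logSum-finitely-many-zeros; log-ν-independent)

  -- Since the logarithms are real, the real and the imaginary parts of the coefficients satisfy the
  -- recurrence separately. Both families then consist of zero polynomials, contrary to `p≢0`.
  log-not-holonomic : ¬ Holonomic (λ n → ofReal (log em (fromℕ n)))
  log-not-holonomic (d , p , p≢0 , annihilates) = p≢0 λ i → All.zip
    (map⁻ (log-ν-independent (λ i → map re (p i)) re-annihilates i) ,
     map⁻ (log-ν-independent (λ i → map im (p i)) im-annihilates i))
    where
    logs : ℕ → Fin (suc d) → ℝ
    logs n i = log em (fromℕ (suc n ℕ.+ toℕ i))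

    re-annihilates : ∀ n →
      sum (λ i → ℝ[x].eval (map re (p i)) (fromℕ (suc n)) * logs n i) ≈ 0ℝ
    re-annihilates n = pointwise-≈0
      (re (sumℂ λ i → ℂ[x].eval (p i) (ofReal (fromℕ (suc n))) ℂ-raw.* ofReal (logs n i)))
      (sum λ i → ℝ[x].eval (map re (p i)) (fromℕ (suc n)) * logs n i)
      (re-sum p (fromℕ (suc n)) (logs n)) (proj₁ (annihilates (suc n) (ℕ.s≤s ℕ.z≤n)))

    im-annihilates : ∀ n →
      sum (λ i → ℝ[x].eval (map im (p i)) (fromℕ (suc n)) * logs n i) ≈ 0ℝ
    im-annihilates n = pointwise-≈0
      (im (sumℂ λ i → ℂ[x].eval (p i) (ofReal (fromℕ (suc n))) ℂ-raw.* ofReal (logs n i)))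
      (sum λ i → ℝ[x].eval (map im (p i)) (fromℕ (suc n)) * logs n i)
      (im-sum p (fromℕ (suc n)) (logs n)) (proj₂ (annihilates (suc n) (ℕ.s≤s ℕ.z≤n)))

mainTheorem1 : (em : ExcludedMiddle 0ℓ) →
    ((d : ℕ) (b : Fin (suc d) → ℝ) (p : Fin (suc d) → ℝ[x].Poly) →
    b zero ≈ 0ℝ →
    (∀ i j → i Fin.< j → b i < b j) →
    ¬ (∀ i → ℝ[x].IsZero (p i)) →
    FinitelyMany (λ x → 0ℝ < x × logSum em p b x ≈ 0ℝ))
    × ¬ Holonomic (λ n → ofReal (log em (fromℕ n)))
mainTheorem1 em = (λ d → logSum-finitely-many-zeros) , log-not-holonomic
  where open RealLogarithm em
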